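{- Let $t\ge2$ be an integer and $g=2t-2$. Let $\lambda\in\mathcal{DD}_{g}^{'2}$, let $\mathbf{v}\in\mathbb{Z}^t$ be its $V_{g,t}$-coding, and set $r_i=v_i-g/2+1$ for $1\le i\le t$. Then $$|\lambda| = \frac{1}{g}\sum_{i=1}^{t} r_i^2-\frac{(g/2+1)(g+1)}{12}.$$ Moreover, setting $\alpha_i(\lambda)=\#\{s\in\lambda\mid h_s=g-i,\ \varepsilon'_s=1\}$, for any field $F$ and any function $\tau:\mathbb{Z}\to F^{\times}$, $$\prod_{s\in\lambda}\frac{\tau(h_s-\varepsilon'_s g)}{\tau(h_s)}=\prod_{s\in\lambda'}\frac{\tau(h_s+\varepsilon_s g)}{\tau(h_s)}=\prod_{i=1}^{g-1}\left(\frac{\tau(-i)}{\tau(i)}\right)^{\alpha_i(\lambda)}\prod_{i=1}^t\frac{\tau(2r_i)}{\tau(r_i)}\prod_{i=1}^{t-1}\frac{\tau(i)}{\tau(2i)}\prod_{1\le i<j\le t} \frac{\tau(r_i-r_j)}{\tau(j-i)}\, \frac{\tau(r_i+r_j)}{\tau(g+2-i-j)},$$ where $\lambda'$ is the conjugate of $\lambda$.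
   Context: For a partition, $h_s$ is the hook length of a box $s$. In the Ferrers diagram (English convention): $\varepsilon_s=-1$ if $s$ is strictly below the main diagonal and $\varepsilon_s=1$ otherwise; $\varepsilon'_s=1$ if $s$ is strictly above the main diagonal and $\varepsilon'_s=-1$ otherwise. With $d_\lambda=\max\{s:\lambda_s\ge s\}$, $\mathcal{DD}$ is the set of partitions with $\lambda_i=\lambda'_i+1$ for $1\le i\le d_\lambda$ ($\lambda'$ the conjugate; the empty partition included), and $\mathcal{DD}'=\{\lambda'\mid\lambda\in\mathcal{DD}\}$. Word of a partition: $\psi(\lambda)=(c_k)_{k\in\mathbb{Z}}\in\{0,1\}^{\mathbb{Z}}$ encodes the border of the Ferrers diagram read from South-West to North-East ($0$ vertical step, $1$ horizontal step), indexed so that $\#\{k\le -1: c_k=1\}=\#\{k\ge 0: c_k=0\}$; equivalently $c_k=0$ iff $k=\lambda_i-i$ for some $i\ge1$ (with $\lambda_i=0$ beyond the length). The $g$-quotient of $\lambda$ is $(\nu^{(0)},\dots,\nu^{(g-1)})$, where $\nu^{(k)}$ is the partition whose word is, up to a shift of indices, the subword $(c_{gi+k})_{i\in\mathbb{Z}}$. $\mathcal{DD}_{2t-2}^{'2}$ is the set of $\lambda\in\mathcal{DD}'$ whose $(2t-2)$-quotient satisfies: $\nu^{(k)}=\emptyset$ for all $k\notin\{t-2,2t-3\}$; $\nu^{(2t-3)}$ is, for some integer $m_1\ge1$, the rectangular partition with $m_1$ parts all equal to $m_1-1$ (empty if $m_1=1$); and $\nu^{(t-2)}$ is, for some integer $m_t\ge0$,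 the $m_t\times m_t$ square partition. $V_{g,t}$-coding: for $i\in\{0,\dots,g-1\}$ let $\beta_i=\max\{(k+1)g+i\mid k\in\mathbb{Z},\ c_{kg+i}=0\}$; the $V_{g,t}$-coding is $\mathbf{v}=(v_1>\dots>v_t)$, the $t$ largest of the distinct integers $\beta_0,\dots,\beta_{g-1}$ in decreasing order. -}

module Defs where

open import Algebra.Apartness.Bundles using (HeytingCommutativeRing; HeytingField)
open import Algebra.Bundles using (module CommutativeRing)
import Algebra.Properties.Semiring.Exp as Exp
open import Data.Bool.Base using (if_then_else_)
open import Data.Fin.Base as Fin using (Fin; toℕ)
import Data.Fin.Properties as Fin
open import Data.Fin.Patterns using (0F; 1F)
open import Data.Integer.Base as ℤ using (ℤ; +_; 0ℤ; 1ℤ; -1ℤ)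
import Data.Integer.Properties as ℤ
open import Data.List.Base
  using (List; []; _∷_; length; map; filter; foldr; concatMap; applyUpTo; replicate; allFin)
open import Data.List.Properties using (filter-accept; filter-reject)
open import Data.List.Extrema.Nat using (max)
open import Data.List.Relation.Unary.All using (All; []; _∷_)
import Data.List.Relation.Unary.All.Properties as All
open import Data.List.Relation.Unary.Linked using (Linked; []; [-]; _∷_)
import Data.List.Relation.Unary.Linked.Properties as Linked
open import Data.Nat.Base
open import Data.Nat.ListAction using (sum)
open import Data.Nat.Properties
open import Data.Product.Base using (Σ; ∃; _×_; _,_)
open import Data.Sum.Base using (_⊎_)
open import Relation.Binary.PropositionalEquality
open import Relation.Nullary using (Dec; yes; no; does; contradiction; _×-dec_; map′)
open import Relation.Unary using (Pred)
open import Level using (0ℓ)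

record Partition : Set where
  field
    parts    : List ℕ
    sorted   : Linked _≥_ parts
    positive : All (0 <_) parts

open Partition public

[1⋯_] : ℕ → List ℕ
[1⋯ n ] = applyUpTo suc n

size : Partition → ℕ
size μ = sum (parts μ)

nth : List ℕ → ℕ → ℕ
nth []       _       = 0
nth (x ∷ _)  zero    = x
nth (_ ∷ xs) (suc i) = nth xs i

-- The i-th part, counted from i = 1, and 0 beyond the last part.  The
-- value at i = 0 carries no meaning.
infix 9 _‼_
_‼_ : Partition → ℕ → ℕ
μ ‼ i = nth (parts μ) (pred i)

∅ : Partition
∅ = record { parts = [] ; sorted = [] ; positive = [] }

-- m parts, all equal to n; this is empty when n = 0.
rectangle : ℕ → ℕ → Partition
rectangle m zero      = ∅
rectangle m n@(suc _) = record
  { parts    = replicate m n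
  ; sorted   = constant m
  ; positive = All.replicate⁺ m z<s
  }
  where
  constant : ∀ k → Linked _≥_ (replicate k n)
  constant zero          = []
  constant (suc zero)    = [-]
  constant (suc (suc k)) = ≤-refl ∷ constant (suc k)

partsAtLeast : List ℕ → ℕ → ℕ
partsAtLeast xs j = length (filter (j ≤?_) xs)

partsAtLeast-suc : ∀ xs j → partsAtLeast xs j ≥ partsAtLeast xs (suc j)
partsAtLeast-suc []       j = z≤n
partsAtLeast-suc (x ∷ xs) j with suc j ≤? x | j ≤? x
... | yes j<x | no j≰x = contradiction (<⇒≤ j<x) j≰x
... | yes j<x | yes j≤x
  rewrite filter-accept (suc j ≤?_) {xs = xs} j<x | filter-accept (j ≤?_) {xs = xs} j≤x
  = s≤s (partsAtLeast-suc xs j)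
... | no j≮x  | yes j≤x
  rewrite filter-reject (suc j ≤?_) {xs = xs} j≮x | filter-accept (j ≤?_) {xs = xs} j≤x
  = m≤n⇒m≤1+n (partsAtLeast-suc xs j)
... | no j≮x  | no j≰x
  rewrite filter-reject (suc j ≤?_) {xs = xs} j≮x | filter-reject (j ≤?_) {xs = xs} j≰x
  = partsAtLeast-suc xs j

partsAtLeast-pos : ∀ xs {j} → j < nth xs 0 → 0 < partsAtLeast xs (suc j)
partsAtLeast-pos (x ∷ xs) {j} j<x
  rewrite filter-accept (suc j ≤?_) {xs = xs} j<x = z<s

-- The j-th part of the conjugate is the number of parts ≥ j, for
-- 1 ≤ j ≤ μ ‼ 1.
conj : Partition → Partition
conj μ = record
  { parts    = applyUpTo (λ j → partsAtLeast (parts μ) (suc j)) (μ ‼ 1)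
  ; sorted   = Linked.applyUpTo⁺₂ _ (μ ‼ 1) (λ j → partsAtLeast-suc (parts μ) (suc j))
  ; positive = All.applyUpTo⁺₁ _ (μ ‼ 1) (partsAtLeast-pos (parts μ))
  }

-- (row , column), both counted from 1.
Box : Set
Box = ℕ × ℕ

boxes : Partition → List Box
boxes μ = concatMap (λ i → map (i ,_) [1⋯ μ ‼ i ]) [1⋯ length (parts μ) ]

-- 1 + arm + leg; the truncated subtractions are exact on boxes of μ.
hook : Partition → Box → ℕ
hook μ (i , j) = 1 + (μ ‼ i ∸ j) + (conj μ ‼ j ∸ i)

ε : Box → ℤ
ε (i , j) = if j <ᵇ i then -1ℤ else 1ℤ

ε′ : Box → ℤ
ε′ (i , j) = if i <ᵇ j then 1ℤ else -1ℤ

α : (g i : ℕ) → Partition → ℕ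
α g i μ = length (filter
  (λ s → (+ hook μ s ℤ.≟ + g ℤ.- + i) ×-dec (ε′ s ℤ.≟ 1ℤ)) (boxes μ))

durfee : Partition → ℕ
durfee μ = max 0 (filter (λ s → s ≤? μ ‼ s) [1⋯ length (parts μ) ])

DD : Pred Partition 0ℓ
DD μ = ∀ i → 1 ≤ i → i ≤ durfee μ → μ ‼ i ≡ conj μ ‼ i + 1

DD′ : Pred Partition 0ℓ
DD′ μ = ∃ λ ρ → DD ρ × μ ≡ conj ρ

-- The vertical steps of the border, i.e. the indices k with c_k = 0.  This
-- indexing has as many horizontal steps at k ≤ -1 as vertical ones at k ≥ 0.
IsVertical : Partition → ℤ → Set
IsVertical μ k = ∃ λ i → 1 ≤ i × k ≡ + (μ ‼ i) ℤ.- + i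

nth≤sum : ∀ xs i → nth xs i ≤ sum xs
nth≤sum []       i       = z≤n
nth≤sum (x ∷ xs) zero    = m≤m+n x (sum xs)
nth≤sum (x ∷ xs) (suc i) = ≤-trans (nth≤sum xs i) (m≤n+m (sum xs) x)

i-[i-j]≡j : ∀ i j → i ℤ.- (i ℤ.- j) ≡ j
i-[i-j]≡j i j = begin
  i ℤ.+ ℤ.- (i ℤ.+ ℤ.- j)            ≡⟨ cong (ℤ._+_ i) (ℤ.neg-distrib-+ i (ℤ.- j)) ⟩
  i ℤ.+ (ℤ.- i ℤ.+ (ℤ.- (ℤ.- j)))    ≡⟨ ℤ.+-assoc i (ℤ.- i) (ℤ.- (ℤ.- j)) ⟨
  (i ℤ.+ ℤ.- i) ℤ.+ (ℤ.- (ℤ.- j))    ≡⟨ cong₂ ℤ._+_ (ℤ.+-inverseʳ i) (ℤ.neg-involutive j) ⟩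
  0ℤ ℤ.+ j                           ≡⟨ ℤ.+-identityˡ j ⟩
  j                                  ∎
  where open ≡-Reasoning

vertical-bound : ∀ μ k i → k ≡ + (μ ‼ i) ℤ.- + i → i < suc (size μ + ℤ.∣ k ∣)
vertical-bound μ k i eq = s≤s (begin
  i                                 ≡⟨ cong ℤ.∣_∣ (i-[i-j]≡j (+ (μ ‼ i)) (+ i)) ⟨
  ℤ.∣ + (μ ‼ i) ℤ.- (+ (μ ‼ i) ℤ.- + i) ∣
                                    ≡⟨ cong (λ x → ℤ.∣ + (μ ‼ i) ℤ.- x ∣) eq ⟨
  ℤ.∣ + (μ ‼ i) ℤ.- k ∣             ≤⟨ ℤ.∣i-j∣≤∣i∣+∣j∣ (+ (μ ‼ i)) k ⟩
  μ ‼ i + ℤ.∣ k ∣                   ≤⟨ +-monoˡ-≤ ℤ.∣ k ∣ (nth≤sum (parts μ) (pred i)) ⟩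
  size μ + ℤ.∣ k ∣                  ∎)
  where open ≤-Reasoning

isVertical? : ∀ μ k → Dec (IsVertical μ k)
isVertical? μ k = map′
  (λ (i , _ , p) → i , p)
  (λ (i , 1≤i , eq) → i , vertical-bound μ k i eq , 1≤i , eq)
  (anyUpTo? (λ i → (1 ≤? i) ×-dec (k ℤ.≟ + (μ ‼ i) ℤ.- + i)) (suc (size μ + ℤ.∣ k ∣)))

word : Partition → ℤ → Fin 2
word μ k = if does (isVertical? μ k) then 0F else 1F

-- ν is the g-quotient of μ; a is the shift of indices, allowed to
-- depend on the component.
IsQuotient : (g : ℕ) → Partition → (Fin g → Partition) → Set
IsQuotient g μ ν = ∀ k → ∃ λ a → ∀ i →
  word (ν k) i ≡ word μ (+ g ℤ.* (i ℤ.+ a) ℤ.+ + toℕ k)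

-- Only meant for t ≥ 2, where the truncated subtractions are exact.
DD′² : ℕ → Pred Partition 0ℓ
DD′² t μ = DD′ μ × Σ (Fin g → Partition) λ ν → IsQuotient g μ ν
  × (∀ k → toℕ k ≢ t ∸ 2 → toℕ k ≢ 2 * t ∸ 3 → ν k ≡ ∅)
  × (∀ k → toℕ k ≡ 2 * t ∸ 3 → ∃ λ m₁ → 1 ≤ m₁ × ν k ≡ rectangle m₁ (m₁ ∸ 1))
  × (∀ k → toℕ k ≡ t ∸ 2 → ∃ λ mₜ → ν k ≡ rectangle mₜ mₜ)
  where
  g = 2 * t ∸ 2

IsMaximum : Pred ℤ 0ℓ → ℤ → Set
IsMaximum P m = P m × (∀ n → P n → n ℤ.≤ m)

-- v is the V_{g,t}-coding of μ, with v₁, …, v_t stored at 0, …, t - 1.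
IsCoding : (g t : ℕ) → Partition → (Fin t → ℤ) → Set
IsCoding g t μ v = Σ (Fin g → ℤ) λ β →
    (∀ i → IsMaximum
      (λ n → ∃ λ k → n ≡ (k ℤ.+ 1ℤ) ℤ.* + g ℤ.+ + toℕ i × word μ (k ℤ.* + g ℤ.+ + toℕ i) ≡ 0F)
      (β i))
  × (∀ i j → i Fin.< j → v j ℤ.< v i)
  × (∀ i → ∃ λ k → v i ≡ β k)
  × (∀ k → (∃ λ i → v i ≡ β k) ⊎ (∀ i → β k ℤ.< v i))

instance
  2t∸2-nonZero : ∀ {t} .{{_ : NonTrivial t}} → NonZero (2 * t ∸ 2)
  2t∸2-nonZero {suc (suc t)} = >-nonZero (subst (0 <_) (sym (+-suc t (suc (t + 0)))) z<s)

index : ∀ {t} → Fin t → ℕ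
index i = suc (toℕ i)

after : ∀ {t} → Fin t → List (Fin t)
after {t} i = filter (i Fin.<?_) (allFin t)

∑ : {A : Set} → List A → (A → ℤ) → ℤ
∑ xs f = foldr ℤ._+_ 0ℤ (map f xs)

infix 5 ∑
syntax ∑ xs (λ x → e) = ∑[ x ∈ xs ] e

-- HeytingField covers every field in the usual sense, with x # y taken
-- to be x ≉ y; 1# # 0# follows from invertible⇒#.
module Products {c ℓ₁ ℓ₂} (F : HeytingField c ℓ₁ ℓ₂) where
  open HeytingField F public using (Carrier; _≈_) renaming (_*_ to _·_)
  open HeytingField F using (1#; heytingCommutativeRing)
  open HeytingCommutativeRing heytingCommutativeRing using (commutativeRing)
  open import Algebra.Definitions _≈_ using (Invertible)
  open Exp (CommutativeRing.semiring commutativeRing) public using (_^_)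

  F× : Set _
  F× = ∃ (Invertible 1# _·_)

  infixl 8 _÷_
  _÷_ : F× → F× → Carrier
  (x , _) ÷ (_ , y⁻¹ , _) = x · y⁻¹

  ∏ : {A : Set} → List A → (A → Carrier) → Carrier
  ∏ xs f = foldr _·_ 1# (map f xs)

  infix 5 ∏
  syntax ∏ xs (λ x → e) = ∏[ x ∈ xs ] e

{-# OPTIONS --safe #-}
-- Number the steps of the border by x = k + 1.  Then μ ∈ DD′ says that the
-- step 0 is vertical and that x ≠ 0 is vertical iff - x is horizontal, so μ is
-- determined by the set U of its positive vertical steps.  A box is a pair of a
-- horizontal x and a vertical y > x; its hook length is y - x, and it lies
-- strictly above the diagonal iff x + y > 0.  Hence sums over the boxes are
-- single and double sums over U.
--
-- Write g = 2p.  The quotient and the coding say that U is the disjoint union of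
-- the progressions ρᵢ + p, ρᵢ + p + g, …, rᵢ - p, where |ρ₁|, …, |ρ_t| is a
-- permutation of 0, …, p.  For an even function f, the sum over the boxes of
-- f (h - ε′ g) - f h becomes a sum over U of central differences with step p, so
-- it telescopes to Ψ r - Ψ ρ, where Ψ s collects f (2 sᵢ) - f sᵢ and
-- f (sᵢ ± sⱼ), and Ψ ρ depends only on the absolute values 0, …, p.  The size
-- telescopes in the same way to the sum of rᵢ² - ρᵢ².
--
-- The product formula follows because a formal product of quotients τ a ÷ τ b is
-- determined by the sums of f a - f b for all f : ℤ → ℤ.

module Submission where

open import Algebra.Apartness.Bundles using (HeytingCommutativeRing; HeytingField)
open import Algebra.Bundles using (CommutativeMonoid; module CommutativeRing)
open import Data.Bool.Base using (if_then_else_; true; false; T)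
open import Data.Empty using (⊥-elim)
open import Data.Fin.Base as Fin using (Fin; toℕ; fromℕ<)
open import Data.Fin.Patterns using (0F; 1F)
import Data.Fin.Properties as Fin
open import Data.Integer.Base using (ℤ; +_; -_; -[1+_]; 0ℤ; 1ℤ; -1ℤ; _+_; _-_; _*_; _≤_; _<_; ∣_∣; +≤+; -≤-; +<+; -<+)
import Data.Integer.Properties as ℤ
open import Data.Integer.Tactic.RingSolver using (solve-∀)
open import Data.List.Base using (List; []; _∷_; _++_; length; map; filter; concatMap; applyUpTo; upTo; replicate; allFin)
open import Data.List.Extrema.Nat using (xs≤max)
open import Data.List.Membership.Propositional using (_∈_; find; lose)
open import Data.List.Membership.Propositional.Properties
open import Data.List.Membership.Propositional.Properties.WithK using (unique∧set⇒bag)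
import Data.List.Properties as List
open import Data.List.Relation.Binary.BagAndSetEquality using (∼bag⇒↭)
open import Data.List.Relation.Binary.Permutation.Propositional as ↭ using (_↭_; ↭-sym)
open import Data.List.Relation.Binary.Permutation.Propositional.Properties using (shift)
open import Data.List.Relation.Unary.All as All using ([]; _∷_)
import Data.List.Relation.Unary.All.Properties as All
open import Data.List.Relation.Unary.AllPairs as AllPairs using ([]; _∷_)
import Data.List.Relation.Unary.AllPairs.Properties as AllPairs
open import Data.List.Relation.Unary.Any using (here; there)
open import Data.List.Relation.Unary.Linked using (Linked; []; [-]; _∷_)
open import Data.List.Relation.Unary.Unique.Propositional using (Unique)
import Data.List.Relation.Unary.Unique.Propositional.Properties as Unique
open import Data.Nat.Base as ℕ using (ℕ; zero; suc; NonTrivial; NonZero; z≤n; s≤s)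
import Data.Nat.DivMod as ℕ
open import Data.Nat.ListAction using (sum)
import Data.Nat.Properties as ℕ
open import Data.Product.Base using (∃; _×_; _,_; proj₁; proj₂)
open import Data.Rational.Base as ℚ using (_/_)
import Data.Rational.Properties as ℚ
open import Data.Rational.Unnormalised.Base as ℚᵘ using (mkℚᵘ; *≡*)
import Data.Rational.Unnormalised.Properties as ℚᵘ
open import Data.Sum.Base using (_⊎_; inj₁; inj₂)
open import Function.Base using (_∘_; id)
open import Function.Bundles using (_⇔_; mk⇔; Equivalence)
open import Level using (0ℓ)
open import Relation.Binary.Definitions using (tri<; tri≈; tri>)
open import Relation.Binary.PropositionalEquality
open import Relation.Nullary using (¬_; Dec; yes; no; does; contradiction; _×-dec_; ¬?)
open import Relation.Unary using (Pred; Decidable)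
open import Algebra.Properties.AbelianGroup ℤ.+-0-abelianGroup using () renaming (∙-cancelˡ to +-cancelˡ)
open import Data.List.Membership.DecPropositional ℤ._≟_ using (_∈?_)
open import Defs

-- Finite sums

-- The shift `g/2 - 1` and the number `t = p + 1` come from reflecting the border. In the shifted
-- numbering, `x ↦ - x` exchanges the residue classes `c` and `g - 2 - c`. The classes `p - 1` and
-- `g - 1` are their own opposites, and these are the two where the quotient may be nonempty; the
-- other classes form `p - 1` opposite pairs. Once `p - 1` is subtracted, the `β` of opposite
-- classes are negatives of each other, so one of each pair survives as nonnegative. Together with
-- the two special classes this makes `p + 1` values, the largest ones, and they are the `r i`.
--
-- Which class of a pair survives depends on the partition, so the starting values `ρ` are known
-- only up to sign. Hence the telescoped sum can be compared with a fixed vector only for even `f`.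
-- An arbitrary `f` is replaced by `f` of the absolute value. On the side of the `r i` this changes
-- nothing, because all arguments there are nonnegative; on the side of the hooks it produces
-- exactly the exponents `α`.

variable
  A B : Set

∑-cong : ∀ (xs : List A) {f h : A → ℤ} → (∀ x → x ∈ xs → f x ≡ h x) → ∑ xs f ≡ ∑ xs h
∑-cong []       eq = refl
∑-cong (x ∷ xs) eq = cong₂ _+_ (eq x (here refl)) (∑-cong xs (λ y y∈xs → eq y (there y∈xs)))

∑-ext : ∀ (xs : List A) {f h : A → ℤ} → (∀ x → f x ≡ h x) → ∑ xs f ≡ ∑ xs h
∑-ext xs eq = ∑-cong xs (λ x _ → eq x)

∑-0 : ∀ (xs : List A) → ∑[ x ∈ xs ] 0ℤ ≡ 0ℤ
∑-0 []       = refl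
∑-0 (x ∷ xs) = trans (ℤ.+-identityˡ _) (∑-0 xs)

∑-+ : ∀ (xs : List A) (f h : A → ℤ) → ∑[ x ∈ xs ] (f x + h x) ≡ ∑ xs f + ∑ xs h
∑-+ []       f h = refl
∑-+ (x ∷ xs) f h = trans (cong (_+_ (f x + h x)) (∑-+ xs f h)) (lemma (f x) (h x) (∑ xs f) (∑ xs h))
  where
  lemma : ∀ a b c d → a + b + (c + d) ≡ a + c + (b + d)
  lemma = solve-∀

∑-* : ∀ c (xs : List A) (f : A → ℤ) → ∑[ x ∈ xs ] (c * f x) ≡ c * ∑ xs f
∑-* c []       f = sym (ℤ.*-zeroʳ c)
∑-* c (x ∷ xs) f = trans (cong (_+_ (c * f x)) (∑-* c xs f)) (sym (ℤ.*-distribˡ-+ c (f x) (∑ xs f)))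

∑-- : ∀ (xs : List A) (f h : A → ℤ) → ∑[ x ∈ xs ] (f x - h x) ≡ ∑ xs f - ∑ xs h
∑-- []       f h = refl
∑-- (x ∷ xs) f h = trans (cong (_+_ (f x - h x)) (∑-- xs f h)) (lemma (f x) (h x) (∑ xs f) (∑ xs h))
  where
  lemma : ∀ a b c d → a - b + (c - d) ≡ a + c - (b + d)
  lemma = solve-∀

∑-++ : ∀ (xs ys : List A) (f : A → ℤ) → ∑ (xs ++ ys) f ≡ ∑ xs f + ∑ ys f
∑-++ []       ys f = sym (ℤ.+-identityˡ _)
∑-++ (x ∷ xs) ys f = trans (cong (_+_ (f x)) (∑-++ xs ys f)) (sym (ℤ.+-assoc (f x) _ _))

∑-map : ∀ (h : A → B) xs (f : B → ℤ) → ∑ (map h xs) f ≡ ∑[ x ∈ xs ] f (h x)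
∑-map h []       f = refl
∑-map h (x ∷ xs) f = cong (_+_ (f (h x))) (∑-map h xs f)

∑-concatMap : ∀ (h : A → List B) xs (f : B → ℤ) → ∑ (concatMap h xs) f ≡ ∑[ x ∈ xs ] ∑ (h x) f
∑-concatMap h []       f = refl
∑-concatMap h (x ∷ xs) f = trans (∑-++ (h x) (concatMap h xs) f) (cong (_+_ (∑ (h x) f)) (∑-concatMap h xs f))

∑-swap : ∀ (xs : List A) (ys : List B) (f : A → B → ℤ) →
  ∑[ x ∈ xs ] ∑[ y ∈ ys ] f x y ≡ ∑[ y ∈ ys ] ∑[ x ∈ xs ] f x y
∑-swap []       ys f = sym (∑-0 ys)
∑-swap (x ∷ xs) ys f = trans (cong (_+_ (∑ ys (f x))) (∑-swap xs ys f))
  (sym (∑-+ ys (f x) (λ y → ∑[ x ∈ xs ] f x y)))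

∑-↭ : ∀ {xs ys : List A} → xs ↭ ys → (f : A → ℤ) → ∑ xs f ≡ ∑ ys f
∑-↭ ↭.refl           f = refl
∑-↭ (↭.prep x xs↭ys) f = cong (_+_ (f x)) (∑-↭ xs↭ys f)
∑-↭ (↭.swap {xs} {ys} x y xs↭ys) f =
  trans (cong (λ s → f x + (f y + s)) (∑-↭ xs↭ys f)) (lemma (f x) (f y) (∑ ys f))
  where
  lemma : ∀ a b c → a + (b + c) ≡ b + (a + c)
  lemma = solve-∀
∑-↭ (↭.trans p q) f = trans (∑-↭ p f) (∑-↭ q f)

𝟙 : ∀ {P : Set} → Dec P → ℤ
𝟙 P? = if does P? then 1ℤ else 0ℤ

𝟙-yes : ∀ {P : Set} (P? : Dec P) → P → 𝟙 P? ≡ 1ℤ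
𝟙-yes (yes _) p = refl
𝟙-yes (no ¬p) p = contradiction p ¬p

𝟙-no : ∀ {P : Set} (P? : Dec P) → ¬ P → 𝟙 P? ≡ 0ℤ
𝟙-no (yes p) ¬p = contradiction p ¬p
𝟙-no (no _)  ¬p = refl

𝟙-⇔ : ∀ {P Q : Set} (P? : Dec P) (Q? : Dec Q) → (P → Q) → (Q → P) → 𝟙 P? ≡ 𝟙 Q?
𝟙-⇔ P? (yes q) to from = 𝟙-yes P? (from q)
𝟙-⇔ P? (no ¬q) to from = 𝟙-no P? (¬q ∘ to)

𝟙-¬ : ∀ {P Q : Set} (P? : Dec P) (Q? : Dec Q) → (P → ¬ Q) → (¬ Q → P) → 𝟙 P? ≡ 1ℤ - 𝟙 Q?
𝟙-¬ P? (yes q) to from = 𝟙-no P? (λ p → to p q)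
𝟙-¬ P? (no ¬q) to from = 𝟙-yes P? (from ¬q)

𝟙-*-absorb : ∀ {P : Set} (P? : Dec P) {z} → (¬ P → z ≡ 0ℤ) → 𝟙 P? * z ≡ z
𝟙-*-absorb (yes _) _    = ℤ.*-identityˡ _
𝟙-*-absorb (no ¬p) ¬p⇒z≡0 = sym (¬p⇒z≡0 ¬p)

𝟙-¬-× : ∀ {P Q : Set} (P? : Dec P) (Q? : Dec Q) → 𝟙 (¬? P? ×-dec Q?) ≡ (1ℤ - 𝟙 P?) * 𝟙 Q?
𝟙-¬-× (yes _) (yes _) = refl
𝟙-¬-× (yes _) (no _)  = refl
𝟙-¬-× (no _)  (yes _) = refl
𝟙-¬-× (no _)  (no _)  = refl

if-yes : ∀ {P : Set} (P? : Dec P) {a b : A} → P → (if does P? then a else b) ≡ a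
if-yes (yes _) _ = refl
if-yes (no ¬p) p = contradiction p ¬p

if-no : ∀ {P : Set} (P? : Dec P) {a b : A} → ¬ P → (if does P? then a else b) ≡ b
if-no (yes p) ¬p = contradiction p ¬p
if-no (no _)  _  = refl

∑-filter : ∀ {P : Pred A 0ℓ} (P? : Decidable P) xs (f : A → ℤ) →
  ∑ (filter P? xs) f ≡ ∑[ x ∈ xs ] 𝟙 (P? x) * f x
∑-filter P? []       f = refl
∑-filter P? (x ∷ xs) f with P? x
... | yes _ = cong₂ _+_ (sym (ℤ.*-identityˡ (f x))) (∑-filter P? xs f)
... | no  _ = trans (∑-filter P? xs f) (sym (ℤ.+-identityˡ _))

∑-1 : ∀ (xs : List A) → ∑[ x ∈ xs ] 1ℤ ≡ + length xs
∑-1 []       = refl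
∑-1 (x ∷ xs) = cong (_+_ 1ℤ) (∑-1 xs)

-- The image of `xs` under `κ` and the part of `ys` where `P` holds are duplicate-free with the same
-- members, hence permutations of each other. The condition appears as a 0/1 factor so that it can
-- take part in ring identities and exchanges of summation.
∑-reindex : ∀ {xs : List A} {ys : List B} (κ : A → B) {P : Pred B 0ℓ} (P? : Decidable P) →
  Unique xs → Unique ys → (∀ {a b} → κ a ≡ κ b → a ≡ b) →
  (∀ {a} → a ∈ xs → κ a ∈ ys × P (κ a)) →
  (∀ {b} → b ∈ ys → P b → ∃ λ a → a ∈ xs × b ≡ κ a) →
  ∀ f → ∑[ a ∈ xs ] f (κ a) ≡ ∑[ b ∈ ys ] 𝟙 (P? b) * f b
∑-reindex {xs = xs} {ys} κ P? !xs !ys inj to from f = begin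
  ∑[ a ∈ xs ] f (κ a)             ≡⟨ ∑-map κ xs f ⟨
  ∑ (map κ xs) f                  ≡⟨ ∑-↭ (∼bag⇒↭ (unique∧set⇒bag (Unique.map⁺ inj !xs) (Unique.filter⁺ P? !ys) (mk⇔ fwd bwd))) f ⟩
  ∑ (filter P? ys) f              ≡⟨ ∑-filter P? ys f ⟩
  ∑[ b ∈ ys ] 𝟙 (P? b) * f b      ∎
  where
  open ≡-Reasoning
  fwd : ∀ {b} → b ∈ map κ xs → b ∈ filter P? ys
  fwd b∈ with a , a∈xs , refl ← ∈-map⁻ κ b∈ = let κa∈ys , p = to a∈xs in ∈-filter⁺ P? κa∈ys p
  bwd : ∀ {b} → b ∈ filter P? ys → b ∈ map κ xs
  bwd b∈ with b∈ys , p ← ∈-filter⁻ P? {xs = ys} b∈ with a , a∈xs , refl ← from b∈ys p = ∈-map⁺ κ a∈xs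

∑-δ : ∀ {xs : List A} (_≈?_ : ∀ (a b : A) → Dec (a ≡ b)) → Unique xs → ∀ {k} → k ∈ xs → ∀ (f : A → ℤ) →
  ∑[ x ∈ xs ] 𝟙 (x ≈? k) * f x ≡ f k
∑-δ {xs = xs} _≈?_ !xs {k} k∈xs f =
  trans (sym (∑-reindex id (_≈? k) ([] ∷ []) !xs id (λ { (here refl) → k∈xs , refl }) (λ { _ refl → k , here refl , refl }) f))
        (ℤ.+-identityʳ (f k))

-- Sums over ranges of natural numbers

∈-[1⋯]⁺ : ∀ {n i} → 1 ℕ.≤ i → i ℕ.≤ n → i ∈ [1⋯ n ]
∈-[1⋯]⁺ {i = suc i} _ i<n = ∈-applyUpTo⁺ suc i<n

∈-[1⋯]⁻ : ∀ {n i} → i ∈ [1⋯ n ] → 1 ℕ.≤ i × i ℕ.≤ n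
∈-[1⋯]⁻ i∈ with _ , j<n , refl ← ∈-applyUpTo⁻ suc i∈ = s≤s z≤n , j<n

[1⋯]-unique : ∀ n → Unique [1⋯ n ]
[1⋯]-unique n = Unique.applyUpTo⁺₁ suc n (λ i<j _ si≡sj → ℕ.<⇒≢ i<j (ℕ.suc-injective si≡sj))

-- Gives ranges of varying length a common bound, as an exchange of summation requires.
∑-extend : ∀ {m n} → m ℕ.≤ n → ∀ f → ∑ [1⋯ m ] f ≡ ∑[ j ∈ [1⋯ n ] ] 𝟙 (j ℕ.≤? m) * f j
∑-extend {m} {n} m≤n = ∑-reindex id (ℕ._≤? m) ([1⋯]-unique m) ([1⋯]-unique n) id
  (λ a∈ → let 1≤a , a≤m = ∈-[1⋯]⁻ a∈ in ∈-[1⋯]⁺ 1≤a (ℕ.≤-trans a≤m m≤n) , a≤m)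
  (λ b∈ b≤m → _ , ∈-[1⋯]⁺ (proj₁ (∈-[1⋯]⁻ b∈)) b≤m , refl)

∑-upTo-suc : ∀ n (f : ℕ → ℤ) → ∑ (upTo (suc n)) f ≡ ∑ (upTo n) f + f n
∑-upTo-suc n f = begin
  ∑ (upTo (suc n)) f           ≡⟨ cong (λ xs → ∑ xs f) (List.applyUpTo-∷ʳ id n) ⟨
  ∑ (upTo n ++ n ∷ []) f       ≡⟨ ∑-++ (upTo n) (n ∷ []) f ⟩
  ∑ (upTo n) f + (f n + 0ℤ)    ≡⟨ cong (_+_ (∑ (upTo n) f)) (ℤ.+-identityʳ (f n)) ⟩
  ∑ (upTo n) f + f n           ∎
  where open ≡-Reasoning

∑-[1⋯] : ∀ n (f : ℕ → ℤ) → ∑ [1⋯ n ] f ≡ ∑[ k ∈ upTo n ] f (suc k)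
∑-[1⋯] n f = trans (cong (λ xs → ∑ xs f) (sym (List.map-upTo suc n))) (∑-map suc (upTo n) f)

-- Formal products of quotients

-- Tested on the indicator of `x`, the hypothesis forces `x` to occur in `ys`; with `x` removed from
-- both lists it still holds by cancellation.
∑-determines-↭ : ∀ (xs ys : List ℤ) → (∀ f → ∑ xs f ≡ ∑ ys f) → xs ↭ ys
∑-determines-↭ [] []       eq = ↭.refl
∑-determines-↭ [] (y ∷ ys) eq with () ← trans (eq (λ _ → 1ℤ)) (∑-1 (y ∷ ys))
∑-determines-↭ (x ∷ xs) ys eq with x ∈? ys
... | no x∉ys = contradiction (trans (eq δ) ∑ys) ∑xs
  where
  δ : ℤ → ℤ
  δ z = 𝟙 (z ℤ.≟ x) * 1ℤ
  ∑ys : ∑ ys δ ≡ 0ℤ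
  ∑ys = trans (∑-cong ys (λ z z∈ys → cong (_* 1ℤ) (𝟙-no (z ℤ.≟ x) (λ { refl → x∉ys z∈ys })))) (∑-0 ys)
  ∑xs : ∑ (x ∷ xs) δ ≢ 0ℤ
  ∑xs rewrite 𝟙-yes (x ℤ.≟ x) refl | sym (∑-filter (ℤ._≟ x) xs (λ _ → 1ℤ)) | ∑-1 (filter (ℤ._≟ x) xs) = λ ()
... | yes x∈ys with as , bs , refl ← ∈-∃++ x∈ys =
  ↭.trans (↭.prep x (∑-determines-↭ xs (as ++ bs) tail)) (↭-sym (shift x as bs))
  where
  tail : ∀ f → ∑ xs f ≡ ∑ (as ++ bs) f
  tail f = +-cancelˡ (f x) _ _ (trans (eq f) (∑-↭ (shift x as bs) f))

module FormalQuotients {c ℓ₁ ℓ₂} (F : HeytingField c ℓ₁ ℓ₂) where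
  open Products F
  open HeytingField F using (1#; heytingCommutativeRing)
  open CommutativeRing (HeytingCommutativeRing.commutativeRing heytingCommutativeRing)
    using (*-commutativeMonoid; *-cong; *-congˡ; *-congʳ; *-assoc; *-comm; *-identityˡ; *-identityʳ)
    renaming (refl to ≈-refl; sym to ≈-sym; trans to ≈-trans; setoid to ≈-setoid) public
  open import Algebra.Properties.CommutativeSemigroup (CommutativeMonoid.commutativeSemigroup *-commutativeMonoid)
    using (interchange; x∙yz≈y∙xz)
  open import Relation.Binary.Reasoning.Setoid ≈-setoid

  ∏-ext : ∀ (xs : List A) {f h : A → Carrier} → (∀ x → f x ≈ h x) → ∏ xs f ≈ ∏ xs h
  ∏-ext []       eq = ≈-refl
  ∏-ext (x ∷ xs) eq = *-cong (eq x) (∏-ext xs eq)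

  ∏-++ : ∀ (xs ys : List A) (f : A → Carrier) → ∏ (xs ++ ys) f ≈ ∏ xs f · ∏ ys f
  ∏-++ []       ys f = ≈-sym (*-identityˡ _)
  ∏-++ (x ∷ xs) ys f = ≈-trans (*-congˡ (∏-++ xs ys f)) (≈-sym (*-assoc _ _ _))

  ∏-map : ∀ (h : A → B) xs (f : B → Carrier) → ∏ (map h xs) f ≈ ∏ xs (λ x → f (h x))
  ∏-map h []       f = ≈-refl
  ∏-map h (x ∷ xs) f = *-congˡ (∏-map h xs f)

  ∏-concatMap : ∀ (h : A → List B) xs (f : B → Carrier) → ∏ (concatMap h xs) f ≈ ∏ xs (λ x → ∏ (h x) f)
  ∏-concatMap h []       f = ≈-refl
  ∏-concatMap h (x ∷ xs) f = ≈-trans (∏-++ (h x) (concatMap h xs) f) (*-congˡ (∏-concatMap h xs f))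

  ∏-replicate : ∀ n (x : A) (f : A → Carrier) → ∏ (replicate n x) f ≈ f x ^ n
  ∏-replicate zero    x f = ≈-refl
  ∏-replicate (suc n) x f = *-congˡ (∏-replicate n x f)

  ∏-↭ : ∀ {xs ys : List A} → xs ↭ ys → (f : A → Carrier) → ∏ xs f ≈ ∏ ys f
  ∏-↭ ↭.refl           f = ≈-refl
  ∏-↭ (↭.prep x p)     f = *-congˡ (∏-↭ p f)
  ∏-↭ (↭.swap x y p)   f = ≈-trans (*-congˡ (*-congˡ (∏-↭ p f))) (x∙yz≈y∙xz _ _ _)
  ∏-↭ (↭.trans p q)    f = ≈-trans (∏-↭ p f) (∏-↭ q f)

  module _ (τ : ℤ → F×) where

    ⟦_⟧ : List (ℤ × ℤ) → Carrier
    ⟦ xs ⟧ = ∏ xs (λ (a , b) → τ a ÷ τ b)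

    private
      value inverse : ℤ → Carrier
      value n   = proj₁ (τ n)
      inverse n = proj₁ (proj₂ (τ n))

    ⟦⟧-denominators : ∀ xs → ⟦ xs ⟧ · ∏ (map proj₂ xs) value ≈ ∏ (map proj₁ xs) value
    ⟦⟧-denominators []             = *-identityˡ 1#
    ⟦⟧-denominators ((a , b) ∷ xs) = begin
      (value a · inverse b · ⟦ xs ⟧) · (value b · ds)    ≈⟨ interchange _ _ _ _ ⟩
      (value a · inverse b · value b) · (⟦ xs ⟧ · ds)    ≈⟨ *-cong cancel (⟦⟧-denominators xs) ⟩
      value a · ∏ (map proj₁ xs) value                   ∎
      where
      ds = ∏ (map proj₂ xs) value
      cancel : value a · inverse b · value b ≈ value a
      cancel = ≈-trans (*-assoc _ _ _) (≈-trans (*-congˡ (proj₁ (proj₂ (proj₂ (τ b))))) (*-identityʳ _))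

    value-inverse : ∀ ns → ∏ ns value · ∏ ns inverse ≈ 1#
    value-inverse []       = *-identityˡ 1#
    value-inverse (n ∷ ns) = ≈-trans (interchange _ _ _ _)
      (≈-trans (*-cong (proj₂ (proj₂ (proj₂ (τ n)))) (value-inverse ns)) (*-identityˡ 1#))

    -- The hypothesis says that the numerators of `xs` with the denominators of `ys`, and the
    -- numerators of `ys` with the denominators of `xs`, have equal sums under every `f`; they are
    -- therefore the same multiset. This is the equality after cross multiplication, and the common
    -- denominator `V` cancels because it has the inverse `I`.
    ⟦⟧-cong : ∀ xs ys →
      (∀ (f : ℤ → ℤ) → ∑[ (a , b) ∈ xs ] (f a - f b) ≡ ∑[ (a , b) ∈ ys ] (f a - f b)) →
      ⟦ xs ⟧ ≈ ⟦ ys ⟧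
    ⟦⟧-cong xs ys eq = begin
      ⟦ xs ⟧                     ≈⟨ absorb xs ⟨
      ⟦ xs ⟧ · V · I             ≈⟨ *-congʳ common ⟩
      ⟦ ys ⟧ · V · I             ≈⟨ absorb ys ⟩
      ⟦ ys ⟧                     ∎
      where
      ds = map proj₂ xs ++ map proj₂ ys
      V = ∏ ds value
      I = ∏ ds inverse
      absorb : ∀ zs → ⟦ zs ⟧ · V · I ≈ ⟦ zs ⟧
      absorb zs = ≈-trans (*-assoc _ _ _) (≈-trans (*-congˡ (value-inverse ds)) (*-identityʳ _))
      num den : (ℤ → ℤ) → List (ℤ × ℤ) → ℤ
      num f zs = ∑ (map proj₁ zs) f
      den f zs = ∑ (map proj₂ zs) f
      split : ∀ f zs → ∑[ (a , b) ∈ zs ] (f a - f b) ≡ num f zs - den f zs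
      split f zs = trans (∑-- zs (λ z → f (proj₁ z)) (λ z → f (proj₂ z)))
        (sym (cong₂ _-_ (∑-map proj₁ zs f) (∑-map proj₂ zs f)))
      lemma : ∀ a b c d → a - b ≡ c - d → a + d ≡ c + b
      lemma a b c d e = trans (s a b d) (trans (cong (λ z → z + b + d) e) (t c d b))
        where
        s : ∀ a b d → a + d ≡ a - b + b + d
        s = solve-∀
        t : ∀ c d b → c - d + b + d ≡ c + b
        t = solve-∀
      perm : map proj₁ xs ++ map proj₂ ys ↭ map proj₁ ys ++ map proj₂ xs
      perm = ∑-determines-↭ _ _ λ f →
        trans (∑-++ (map proj₁ xs) _ f)
          (trans (lemma (num f xs) (den f xs) (num f ys) (den f ys)
                   (trans (sym (split f xs)) (trans (eq f) (split f ys))))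
                 (sym (∑-++ (map proj₁ ys) _ f)))
      common : ⟦ xs ⟧ · V ≈ ⟦ ys ⟧ · V
      common = begin
        ⟦ xs ⟧ · V                                                      ≈⟨ *-congˡ (∏-++ (map proj₂ xs) _ value) ⟩
        ⟦ xs ⟧ · (∏ (map proj₂ xs) value · ∏ (map proj₂ ys) value)      ≈⟨ *-assoc _ _ _ ⟨
        ⟦ xs ⟧ · ∏ (map proj₂ xs) value · ∏ (map proj₂ ys) value        ≈⟨ *-congʳ (⟦⟧-denominators xs) ⟩
        ∏ (map proj₁ xs) value · ∏ (map proj₂ ys) value                 ≈⟨ ∏-++ (map proj₁ xs) _ value ⟨
        ∏ (map proj₁ xs ++ map proj₂ ys) value                          ≈⟨ ∏-↭ perm value ⟩
        ∏ (map proj₁ ys ++ map proj₂ xs) value                          ≈⟨ ∏-++ (map proj₁ ys) _ value ⟩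
        ∏ (map proj₁ ys) value · ∏ (map proj₂ xs) value                 ≈⟨ *-congʳ (⟦⟧-denominators ys) ⟨
        ⟦ ys ⟧ · ∏ (map proj₂ ys) value · ∏ (map proj₂ xs) value        ≈⟨ *-assoc _ _ _ ⟩
        ⟦ ys ⟧ · (∏ (map proj₂ ys) value · ∏ (map proj₂ xs) value)      ≈⟨ *-congˡ (*-comm _ _) ⟩
        ⟦ ys ⟧ · (∏ (map proj₂ xs) value · ∏ (map proj₂ ys) value)      ≈⟨ *-congˡ (∏-++ (map proj₂ xs) _ value) ⟨
        ⟦ ys ⟧ · V                                                      ∎

-- The border of a partition

-- Turns a strict inequality into a nonnegative quantity. Linear inequalities are then proved by
-- adding such quantities, with the ring solver matching the total to the target.
gap : ∀ {i j} → i < j → 0ℤ ≤ j - i - 1ℤ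
gap {i} {j} i<j = subst (0ℤ ≤_) (lemma i j) (ℤ.i≤j⇒0≤j-i (ℤ.i<j⇒suc[i]≤j i<j))
  where
  lemma : ∀ i j → j - (1ℤ + i) ≡ j - i - 1ℤ
  lemma = solve-∀

from-gap : ∀ {i j s} → 0ℤ ≤ s → s ≡ j - i - 1ℤ → i < j
from-gap {i} {j} 0≤s refl = ℤ.suc[i]≤j⇒i<j (ℤ.0≤i-j⇒j≤i (subst (0ℤ ≤_) (lemma i j) 0≤s))
  where
  lemma : ∀ i j → j - i - 1ℤ ≡ j - (1ℤ + i)
  lemma = solve-∀

from-gap≤ : ∀ {i j s} → 0ℤ ≤ s → s ≡ j - i → i ≤ j
from-gap≤ 0≤s refl = ℤ.0≤i-j⇒j≤i 0≤s

ℕ-gap : ∀ {m n} → m ℕ.≤ n → 0ℤ ≤ + n - + m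
ℕ-gap m≤n = ℤ.i≤j⇒0≤j-i (+≤+ m≤n)

0≤-+ : ∀ {i j} → 0ℤ ≤ i → 0ℤ ≤ j → 0ℤ ≤ i + j
0≤-+ = ℤ.+-mono-≤

≤⇒∃ : ∀ {i j} → i ≤ j → ∃ λ k → j ≡ i + + k
≤⇒∃ {i} {j} i≤j = ∣ j - i ∣ , trans (lemma i j) (cong (_+_ i) (sym (ℤ.0≤i⇒+∣i∣≡i (ℤ.i≤j⇒0≤j-i i≤j))))
  where
  lemma : ∀ i j → j ≡ i + (j - i)
  lemma = solve-∀

nth-head : ∀ {x xs} → Linked ℕ._≥_ (x ∷ xs) → ∀ i → nth (x ∷ xs) i ℕ.≤ x
nth-head _            zero          = ℕ.≤-refl
nth-head [-]          (suc i)       = z≤n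
nth-head (x≥y ∷ rest) (suc i)       = ℕ.≤-trans (nth-head rest i) x≥y

tail-sorted : ∀ {x xs} → Linked ℕ._≥_ (x ∷ xs) → Linked ℕ._≥_ xs
tail-sorted [-]      = []
tail-sorted (_ ∷ xs) = xs

nth-positive : ∀ xs i → 1 ℕ.≤ nth xs i → i ℕ.< length xs
nth-positive (x ∷ xs) zero    _ = s≤s z≤n
nth-positive (x ∷ xs) (suc i) p = s≤s (nth-positive xs i p)

-- The adjunction behind conjugation. Sortedness makes the parts that are at least `j` an initial
-- segment of the list, so counting them locates the last one.
partsAtLeast-nth : ∀ {xs} → Linked ℕ._≥_ xs → ∀ i {j} → 1 ℕ.≤ j →
  (i ℕ.< partsAtLeast xs j) ⇔ (j ℕ.≤ nth xs i)
partsAtLeast-nth {[]}     _ i {suc j} _ = mk⇔ (λ ()) (λ ())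
partsAtLeast-nth {x ∷ xs} s i {j} 1≤j with j ℕ.≤? x
... | yes j≤x rewrite List.filter-accept (j ℕ.≤?_) {xs = xs} j≤x = mk⇔ (to i) (from i)
  where
  module Rest i = Equivalence (partsAtLeast-nth (tail-sorted s) i 1≤j)
  to : ∀ i → i ℕ.< suc (partsAtLeast xs j) → j ℕ.≤ nth (x ∷ xs) i
  to zero    _         = j≤x
  to (suc i) (s≤s i<)  = Rest.to i i<
  from : ∀ i → j ℕ.≤ nth (x ∷ xs) i → i ℕ.< suc (partsAtLeast xs j)
  from zero    _  = s≤s z≤n
  from (suc i) j≤ = s≤s (Rest.from i j≤)
... | no j≰x rewrite List.filter-reject (j ℕ.≤?_) {xs = xs} j≰x = mk⇔
  (λ i< → contradiction (ℕ.≤-trans (Equivalence.to (partsAtLeast-nth (tail-sorted s) i 1≤j) i<) (nth-head s (suc i))) j≰x)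
  (λ j≤ → contradiction (ℕ.≤-trans j≤ (nth-head s i)) j≰x)

nth-applyUpTo : ∀ (f : ℕ → ℕ) n i → i ℕ.< n → nth (applyUpTo f n) i ≡ f i
nth-applyUpTo f (suc n) zero    _         = refl
nth-applyUpTo f (suc n) (suc i) (s≤s i<n) = nth-applyUpTo (f ∘ suc) n i i<n

nth-applyUpTo-beyond : ∀ (f : ℕ → ℕ) n i → n ℕ.≤ i → nth (applyUpTo f n) i ≡ 0
nth-applyUpTo-beyond f zero    i       _         = refl
nth-applyUpTo-beyond f (suc n) (suc i) (s≤s n≤i) = nth-applyUpTo-beyond (f ∘ suc) n i n≤i

module _ (μ : Partition) where

  conj-‼ : ∀ {j} → 1 ℕ.≤ j → conj μ ‼ j ≡ partsAtLeast (parts μ) j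
  conj-‼ {suc j} 1≤j with j ℕ.<? μ ‼ 1
  ... | yes j<μ₁ = nth-applyUpTo _ _ j j<μ₁
  ... | no  j≮μ₁ = trans (nth-applyUpTo-beyond _ _ j (ℕ.≮⇒≥ j≮μ₁)) (sym (ℕ.n≤0⇒n≡0 (ℕ.≮⇒≥
      (λ 0< → j≮μ₁ (Equivalence.to (partsAtLeast-nth (sorted μ) 0 1≤j) 0<)))))

  conj-galois : ∀ {i j} → 1 ℕ.≤ i → 1 ℕ.≤ j → (i ℕ.≤ conj μ ‼ j) ⇔ (j ℕ.≤ μ ‼ i)
  conj-galois {suc i} 1≤i 1≤j rewrite conj-‼ 1≤j = partsAtLeast-nth (sorted μ) i 1≤j

  conj-≤⇒ : ∀ {i j} → 1 ℕ.≤ i → 1 ℕ.≤ j → i ℕ.≤ conj μ ‼ j → j ℕ.≤ μ ‼ i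
  conj-≤⇒ 1≤i 1≤j = Equivalence.to (conj-galois 1≤i 1≤j)

  ≤⇒conj-≤ : ∀ {i j} → 1 ℕ.≤ i → 1 ℕ.≤ j → j ℕ.≤ μ ‼ i → i ℕ.≤ conj μ ‼ j
  ≤⇒conj-≤ 1≤i 1≤j = Equivalence.from (conj-galois 1≤i 1≤j)

  ‼-positive : ∀ {i} → 1 ℕ.≤ μ ‼ i → i ℕ.≤ length (parts μ)
  ‼-positive {zero}  _ = z≤n
  ‼-positive {suc i} p = nth-positive (parts μ) i p

-- Compares two numbers by their positive lower bounds, the form in which `conj-galois` delivers
-- information.
≤-reflecting⇒≡ : ∀ {m n} → (∀ k → 1 ℕ.≤ k → k ℕ.≤ m → k ℕ.≤ n) → (∀ k → 1 ℕ.≤ k → k ℕ.≤ n → k ℕ.≤ m) → m ≡ n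
≤-reflecting⇒≡ {m} {n} to from = ℕ.≤-antisym (half to) (half from)
  where
  half : ∀ {m n} → (∀ k → 1 ℕ.≤ k → k ℕ.≤ m → k ℕ.≤ n) → m ℕ.≤ n
  half {zero}  h = z≤n
  half {suc m} h = h (suc m) (s≤s z≤n) ℕ.≤-refl

conj-involutive-‼ : ∀ μ {i} → 1 ℕ.≤ i → conj (conj μ) ‼ i ≡ μ ‼ i
conj-involutive-‼ μ 1≤i = ≤-reflecting⇒≡
  (λ k 1≤k p → conj-≤⇒ μ 1≤i 1≤k (conj-≤⇒ (conj μ) 1≤k 1≤i p))
  (λ k 1≤k p → ≤⇒conj-≤ (conj μ) 1≤k 1≤i (≤⇒conj-≤ μ 1≤i 1≤k p))

‼-antitone : ∀ μ {i j} → 1 ℕ.≤ i → i ℕ.≤ j → μ ‼ j ℕ.≤ μ ‼ i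
‼-antitone μ {i} {j} 1≤i i≤j with μ ‼ j in eq
... | zero  = z≤n
... | suc k = conj-≤⇒ μ 1≤i (s≤s z≤n) (ℕ.≤-trans i≤j (≤⇒conj-≤ μ (ℕ.≤-trans 1≤i i≤j) (s≤s z≤n) (ℕ.≤-reflexive (sym eq))))

-- Steps of the border are numbered by k + 1 from here on, which makes the
-- words of DD′ antisymmetric about 0.
Vertical : Partition → ℤ → Set
Vertical μ x = IsVertical μ (x - 1ℤ)

vertical? : ∀ μ x → Dec (Vertical μ x)
vertical? μ x = isVertical? μ (x - 1ℤ)

-- The positions, in the shifted numbering, of the vertical step that ends row `i` and of the
-- horizontal step that ends column `j`.
rowEnd colEnd : Partition → ℕ → ℤ
rowEnd μ i = + (μ ‼ i) + 1ℤ - + i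
colEnd μ j = + j - + (conj μ ‼ j)

module _ (μ : Partition) where

  rowEnd-vertical : ∀ {i} → 1 ℕ.≤ i → Vertical μ (rowEnd μ i)
  rowEnd-vertical {i} 1≤i = i , 1≤i , lemma (+ (μ ‼ i)) (+ i)
    where
    lemma : ∀ a i → a + 1ℤ - i - 1ℤ ≡ a - i
    lemma = solve-∀

  vertical-rowEnd : ∀ {x} → Vertical μ x → ∃ λ i → 1 ℕ.≤ i × x ≡ rowEnd μ i
  vertical-rowEnd {x} (i , 1≤i , eq) = i , 1≤i , trans (lemma x) (trans (cong (_+ 1ℤ) eq) (lemma₂ (+ (μ ‼ i)) (+ i)))
    where
    lemma : ∀ x → x ≡ x - 1ℤ + 1ℤ
    lemma = solve-∀
    lemma₂ : ∀ a i → a - i + 1ℤ ≡ a + 1ℤ - i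
    lemma₂ = solve-∀

  rowEnd-anti : ∀ {i j} → 1 ℕ.≤ i → i ℕ.≤ j → rowEnd μ j ≤ rowEnd μ i
  rowEnd-anti {i} {j} 1≤i i≤j = from-gap≤ (0≤-+ (ℕ-gap (‼-antitone μ 1≤i i≤j)) (ℕ-gap i≤j))
    (lemma (+ (μ ‼ i)) (+ (μ ‼ j)) (+ i) (+ j))
    where
    lemma : ∀ a b i j → a - b + (j - i) ≡ a + 1ℤ - i - (b + 1ℤ - j)
    lemma = solve-∀

  rowEnd-strict : ∀ {i j} → 1 ℕ.≤ i → i ℕ.< j → rowEnd μ j < rowEnd μ i
  rowEnd-strict {i} {j} 1≤i i<j = from-gap (0≤-+ (ℕ-gap (‼-antitone μ 1≤i (ℕ.<⇒≤ i<j))) (ℕ-gap i<j))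
    (trans (cong (λ z → + (μ ‼ i) - + (μ ‼ j) + (+ j - z)) (ℤ.pos-+ 1 i)) (lemma (+ (μ ‼ i)) (+ (μ ‼ j)) (+ i) (+ j)))
    where
    lemma : ∀ a b i j → a - b + (j - (1ℤ + i)) ≡ a + 1ℤ - i - (b + 1ℤ - j) - 1ℤ
    lemma = solve-∀

  colEnd-strict : ∀ {i j} → 1 ℕ.≤ i → i ℕ.< j → colEnd μ i < colEnd μ j
  colEnd-strict {i} {j} 1≤i i<j = from-gap (0≤-+ (ℕ-gap (‼-antitone (conj μ) 1≤i (ℕ.<⇒≤ i<j))) (ℕ-gap i<j))
    (trans (cong (λ z → + (conj μ ‼ i) - + (conj μ ‼ j) + (+ j - z)) (ℤ.pos-+ 1 i)) (lemma (+ (conj μ ‼ i)) (+ (conj μ ‼ j)) (+ i) (+ j)))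
    where
    lemma : ∀ a b i j → a - b + (j - (1ℤ + i)) ≡ j - b - (i - a) - 1ℤ
    lemma = solve-∀

  -- The gap is arm plus leg, both nonnegative on a box. Off the diagram both become negative, which
  -- reverses the inequality.
  box⇒colEnd<rowEnd : ∀ {i j} → 1 ℕ.≤ i → 1 ℕ.≤ j → j ℕ.≤ μ ‼ i → colEnd μ j < rowEnd μ i
  box⇒colEnd<rowEnd {i} {j} 1≤i 1≤j j≤ = from-gap (0≤-+ (ℕ-gap j≤) (ℕ-gap (≤⇒conj-≤ μ 1≤i 1≤j j≤)))
    (lemma (+ (μ ‼ i)) (+ (conj μ ‼ j)) (+ i) (+ j))
    where
    lemma : ∀ a b i j → a - j + (b - i) ≡ a + 1ℤ - i - (j - b) - 1ℤ
    lemma = solve-∀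

  ¬box⇒rowEnd<colEnd : ∀ {i j} → 1 ℕ.≤ i → 1 ℕ.≤ j → μ ‼ i ℕ.< j → rowEnd μ i < colEnd μ j
  ¬box⇒rowEnd<colEnd {i} {j} 1≤i 1≤j a<j = from-gap (0≤-+ (gap (+<+ a<j)) (gap (+<+ b<i)))
    (lemma (+ (μ ‼ i)) (+ (conj μ ‼ j)) (+ i) (+ j))
    where
    b<i : conj μ ‼ j ℕ.< i
    b<i = ℕ.≰⇒> (λ i≤ → ℕ.<⇒≱ a<j (conj-≤⇒ μ 1≤i 1≤j i≤))
    lemma : ∀ a b i j → j - a - 1ℤ + (i - b - 1ℤ) ≡ j - b - (a + 1ℤ - i) - 1ℤ
    lemma = solve-∀

  colEnd≢rowEnd : ∀ {i j} → 1 ℕ.≤ i → 1 ℕ.≤ j → colEnd μ j ≢ rowEnd μ i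
  colEnd≢rowEnd {i} {j} 1≤i 1≤j eq with j ℕ.≤? μ ‼ i
  ... | yes j≤ = ℤ.<-irrefl eq (box⇒colEnd<rowEnd 1≤i 1≤j j≤)
  ... | no  j≰ = ℤ.<-irrefl (sym eq) (¬box⇒rowEnd<colEnd 1≤i 1≤j (ℕ.≰⇒> j≰))

  colEnd<rowEnd⇒box : ∀ {i j} → 1 ℕ.≤ i → 1 ℕ.≤ j → colEnd μ j < rowEnd μ i → j ℕ.≤ μ ‼ i
  colEnd<rowEnd⇒box {i} {j} 1≤i 1≤j c<r with j ℕ.≤? μ ‼ i
  ... | yes j≤ = j≤
  ... | no  j≰ = contradiction c<r (ℤ.<-asym (¬box⇒rowEnd<colEnd 1≤i 1≤j (ℕ.≰⇒> j≰)))

  colEnd-¬vertical : ∀ {j} → 1 ℕ.≤ j → ¬ Vertical μ (colEnd μ j)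
  colEnd-¬vertical 1≤j v = let i , 1≤i , eq = vertical-rowEnd v in colEnd≢rowEnd 1≤i 1≤j eq

  private
    -- If x lies strictly between two consecutive row ends, the first n of
    -- which exceed x, then x ends the column of index x + n.
    between : ∀ x n → (∀ i → 1 ℕ.≤ i → i ℕ.≤ n → x < rowEnd μ i) → rowEnd μ (suc n) < x →
      ∃ λ j → 1 ℕ.≤ j × x ≡ colEnd μ j
    between x n above below with ≤⇒∃ (from-gap≤ {0ℤ} {x + + n} (0≤-+ (gap below) (+≤+ (z≤n {suc (μ ‼ suc n)}))) eq)
      where
      eq : x - rowEnd μ (suc n) - 1ℤ + + suc (μ ‼ suc n) ≡ x + + n - 0ℤ
      eq rewrite ℤ.pos-+ 1 (μ ‼ suc n) | ℤ.pos-+ 1 n = lemma (+ (μ ‼ suc n)) (+ n) x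
        where
        lemma : ∀ a n x → x - (a + 1ℤ - (1ℤ + n)) - 1ℤ + (1ℤ + a) ≡ x + n - 0ℤ
        lemma = solve-∀
    ... | j , x+n≡j = j , 1≤j , trans (lemma₁ x (+ n)) (cong₂ _-_ x+n≡j′ (cong +_ n≡b))
      where
      x+n≡j′ : x + + n ≡ + j
      x+n≡j′ = trans x+n≡j (ℤ.+-identityˡ (+ j))
      lemma₁ : ∀ x n → x ≡ x + n - n
      lemma₁ = solve-∀
      a<j : μ ‼ suc n ℕ.< j
      a<j = ℤ.drop‿+<+ (from-gap (gap below) (trans (lemma₂ (+ (μ ‼ suc n)) (+ n) x) (cong (λ z → z - + (μ ‼ suc n) - 1ℤ) x+n≡j′)))
        where
        lemma₂ : ∀ a n x → x - (a + 1ℤ - (1ℤ + n)) - 1ℤ ≡ x + n - a - 1ℤ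
        lemma₂ = solve-∀
      1≤j : 1 ℕ.≤ j
      1≤j = ℕ.≤-trans (s≤s z≤n) a<j
      b≤n : conj μ ‼ j ℕ.≤ n
      b≤n = ℕ.≮⇒≥ (λ n<b → ℕ.<⇒≱ a<j (conj-≤⇒ μ (s≤s z≤n) 1≤j n<b))
      n≤b : ∀ m → m ≡ n → m ℕ.≤ conj μ ‼ j
      n≤b zero    _    = z≤n
      n≤b (suc m) refl = ≤⇒conj-≤ μ (s≤s z≤n) 1≤j (ℤ.drop‿+≤+ (from-gap≤ (gap (above (suc m) (s≤s z≤n) ℕ.≤-refl))
        (trans (lemma₃ (+ (μ ‼ suc m)) (+ suc m) x) (cong (λ z → + (μ ‼ suc m) - z) x+n≡j′))))
        where
        lemma₃ : ∀ a n x → a + 1ℤ - n - x - 1ℤ ≡ a - (x + n)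
        lemma₃ = solve-∀
      n≡b : n ≡ conj μ ‼ j
      n≡b = ℕ.≤-antisym (n≤b n refl) b≤n

    scan : ∀ x n → (∃ λ i → 1 ℕ.≤ i × x ≡ rowEnd μ i) ⊎ (∃ λ j → 1 ℕ.≤ j × x ≡ colEnd μ j)
                 ⊎ (∀ i → 1 ℕ.≤ i → i ℕ.≤ n → x < rowEnd μ i)
    scan x zero    = inj₂ (inj₂ λ { (suc _) _ () })
    scan x (suc n) with scan x n
    ... | inj₁ v        = inj₁ v
    ... | inj₂ (inj₁ h) = inj₂ (inj₁ h)
    ... | inj₂ (inj₂ above) with ℤ.<-cmp x (rowEnd μ (suc n))
    ...   | tri≈ _ eq _ = inj₁ (suc n , s≤s z≤n , eq)
    ...   | tri> _ _ gt = inj₂ (inj₁ (between x n above gt))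
    ...   | tri< lt _ _ = inj₂ (inj₂ λ i 1≤i i≤ → ℤ.<-≤-trans lt (rowEnd-anti 1≤i i≤))

  -- The row ends decrease without bound, so the scan cannot find all of them above `x`: row
  -- `μ ‼ 1 + ∣ x ∣ + 1` already ends at or below `- ∣ x ∣`.
  ¬vertical-colEnd : ∀ {x} → ¬ Vertical μ x → ∃ λ j → 1 ℕ.≤ j × x ≡ colEnd μ j
  ¬vertical-colEnd {x} ¬v with scan x n
    where n = suc (μ ‼ 1 ℕ.+ ∣ x ∣)
  ... | inj₁ (i , 1≤i , refl) = contradiction (rowEnd-vertical 1≤i) ¬v
  ... | inj₂ (inj₁ h)         = h
  ... | inj₂ (inj₂ above)     = contradiction (above n (s≤s z≤n) ℕ.≤-refl) (ℤ.≤⇒≯ rowEnd≤x)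
    where
    n = suc (μ ‼ 1 ℕ.+ ∣ x ∣)
    rowEnd≤x : rowEnd μ n ≤ x
    rowEnd≤x = from-gap≤ (0≤-+ (ℕ-gap (‼-antitone μ {1} {n} (s≤s z≤n) (s≤s z≤n))) (ℤ.i≤j⇒0≤j-i (-∣x∣≤x x)))
      (trans (lemma (+ (μ ‼ n)) (+ (μ ‼ 1)) (+ ∣ x ∣) x)
        (cong (λ z → x - (+ (μ ‼ n) + 1ℤ - z)) (sym (trans (ℤ.pos-+ 1 (μ ‼ 1 ℕ.+ ∣ x ∣)) (cong (_+_ 1ℤ) (ℤ.pos-+ (μ ‼ 1) ∣ x ∣))))))
      where
      lemma : ∀ a b c x → b - a + (x - - c) ≡ x - (a + 1ℤ - (1ℤ + (b + c)))
      lemma = solve-∀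
      -∣x∣≤x : ∀ x → - (+ ∣ x ∣) ≤ x
      -∣x∣≤x (+ n)    = ℤ.neg-≤-pos {n} {n}
      -∣x∣≤x -[1+ n ] = ℤ.≤-refl

-- Sums over the boxes of a partition in DD′

≤-durfee : ∀ μ {i} → 1 ℕ.≤ i → i ℕ.≤ μ ‼ i → i ℕ.≤ durfee μ
≤-durfee μ {i} 1≤i i≤ = All.lookup (xs≤max 0 (filter (λ s → s ℕ.≤? μ ‼ s) [1⋯ length (parts μ) ]))
  (∈-filter⁺ (λ s → s ℕ.≤? μ ‼ s) (∈-[1⋯]⁺ 1≤i (‼-positive μ (ℕ.≤-trans 1≤i i≤))) i≤)

-- `DD′` read off the diagonal boxes: there the leg is one more than the arm. The bound by the
-- Durfee size becomes the condition that `(i , i)` is a box.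
LegsExceedArms : Partition → Set
LegsExceedArms μ = ∀ {i} → 1 ℕ.≤ i → i ℕ.≤ μ ‼ i → conj μ ‼ i ≡ suc (μ ‼ i)

DD′⇒legsExceedArms : ∀ {μ} → DD′ μ → LegsExceedArms μ
DD′⇒legsExceedArms (ρ , dd , refl) {i} 1≤i i≤ = trans (conj-involutive-‼ ρ 1≤i)
  (trans (dd i 1≤i (≤-durfee ρ 1≤i (conj-≤⇒ ρ 1≤i 1≤i i≤))) (ℕ.+-comm _ 1))

-- The integers from `- n` to `n`, listed so that a sum splits into the term at 0 and the terms at
-- `k` and `- k`, the orbits of the reflection.
interval : ℕ → List ℤ
interval n = 0ℤ ∷ map +_ [1⋯ n ] ++ map (λ k → - (+ k)) [1⋯ n ]

∑-interval : ∀ n f → ∑ (interval n) f ≡ f 0ℤ + (∑[ k ∈ [1⋯ n ] ] (f (+ k) + f (- (+ k))))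
∑-interval n f = cong (_+_ (f 0ℤ)) (trans (∑-++ (map +_ [1⋯ n ]) _ f)
  (trans (cong₂ _+_ (∑-map +_ [1⋯ n ] f) (∑-map (λ k → - (+ k)) [1⋯ n ] f))
         (sym (∑-+ [1⋯ n ] (λ k → f (+ k)) (λ k → f (- (+ k)))))))

interval-unique : ∀ n → Unique (interval n)
interval-unique n = All.++⁺ (All.map⁺ (All.tabulate (λ { k∈ refl → contradiction (proj₁ (∈-[1⋯]⁻ {n} k∈)) (λ ()) })))
                            (All.map⁺ (All.tabulate (λ k∈ 0≡-k → nonzero (proj₁ (∈-[1⋯]⁻ {n} k∈)) 0≡-k)))
                  ∷ Unique.++⁺ (Unique.map⁺ ℤ.+-injective ([1⋯]-unique n))
                               (Unique.map⁺ (ℤ.+-injective ∘ ℤ.neg-injective) ([1⋯]-unique n)) disjoint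
  where
  nonzero : ∀ {k} → 1 ℕ.≤ k → 0ℤ ≢ - (+ k)
  nonzero (s≤s z≤n) ()
  disjoint : ∀ {x} → ¬ (x ∈ map +_ [1⋯ n ] × x ∈ map (λ k → - (+ k)) [1⋯ n ])
  disjoint (p , q) with k , k∈ , refl ← ∈-map⁻ +_ p with l , l∈ , eq ← ∈-map⁻ (λ k → - (+ k)) q
    with s≤s z≤n ← proj₁ (∈-[1⋯]⁻ {n} k∈) with s≤s z≤n ← proj₁ (∈-[1⋯]⁻ {n} l∈) with () ← eq

∈-interval⁺ : ∀ {n x} → x ≤ + n → - (+ n) ≤ x → x ∈ interval n
∈-interval⁺ {x = + zero}  _ _            = here refl
∈-interval⁺ {x = + suc k} (+≤+ k≤n) _    = there (∈-++⁺ˡ (∈-map⁺ +_ (∈-[1⋯]⁺ (s≤s z≤n) k≤n)))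
∈-interval⁺ {suc n} {x = -[1+ k ]} _ (-≤- k≤n) = there (∈-++⁺ʳ (map +_ [1⋯ suc n ]) (∈-map⁺ (λ k → - (+ k)) (∈-[1⋯]⁺ (s≤s z≤n) (s≤s k≤n))))

∈-interval⁻ : ∀ {n x} → x ∈ interval n → x ≤ + n × - (+ n) ≤ x
∈-interval⁻ {n} (here refl) = +≤+ z≤n , ℤ.neg-≤-pos {n} {0}
∈-interval⁻ {n} (there x∈) with ∈-++⁻ (map +_ [1⋯ n ]) x∈
... | inj₁ p with k , k∈ , refl ← ∈-map⁻ +_ p = +≤+ (proj₂ (∈-[1⋯]⁻ k∈)) , ℤ.neg-≤-pos {n} {k}
... | inj₂ p with k , k∈ , refl ← ∈-map⁻ (λ k → - (+ k)) p = ℤ.neg-≤-pos {k} {n} , ℤ.neg-mono-≤ (+≤+ (proj₂ (∈-[1⋯]⁻ k∈)))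

∑-boxes : ∀ μ {M} → length (parts μ) ℕ.≤ M → (F : Box → ℤ) →
  ∑ (boxes μ) F ≡ ∑[ i ∈ [1⋯ M ] ] ∑[ j ∈ [1⋯ μ ‼ i ] ] F (i , j)
∑-boxes μ {M} ℓ≤M F = begin
  ∑ (boxes μ) F
    ≡⟨ ∑-concatMap (λ i → map (i ,_) [1⋯ μ ‼ i ]) [1⋯ length (parts μ) ] F ⟩
  (∑[ i ∈ [1⋯ length (parts μ) ] ] ∑ (map (i ,_) [1⋯ μ ‼ i ]) F)
    ≡⟨ ∑-ext [1⋯ length (parts μ) ] (λ i → ∑-map (i ,_) [1⋯ μ ‼ i ] F) ⟩
  (∑[ i ∈ [1⋯ length (parts μ) ] ] row i)
    ≡⟨ ∑-extend ℓ≤M row ⟩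
  (∑[ i ∈ [1⋯ M ] ] 𝟙 (i ℕ.≤? length (parts μ)) * row i)
    ≡⟨ ∑-ext [1⋯ M ] drop ⟩
  (∑[ i ∈ [1⋯ M ] ] row i)
    ∎
  where
  open ≡-Reasoning
  row : ℕ → ℤ
  row i = ∑[ j ∈ [1⋯ μ ‼ i ] ] F (i , j)
  beyond : ∀ i → ¬ i ℕ.≤ length (parts μ) → row i ≡ 0ℤ
  beyond i i≰ with μ ‼ i in eq
  ... | zero  = refl
  ... | suc k = contradiction (‼-positive μ (ℕ.≤-trans (s≤s z≤n) (ℕ.≤-reflexive (sym eq)))) i≰
  drop : ∀ i → 𝟙 (i ℕ.≤? length (parts μ)) * row i ≡ row i
  drop i = 𝟙-*-absorb (i ℕ.≤? length (parts μ)) (beyond i)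

-- A bound beyond which the border is constant: every step below `- extent μ` is vertical and every
-- step above `extent μ` is horizontal.
extent : Partition → ℕ
extent μ = μ ‼ 1 ℕ.+ length (parts μ)

conj-‼-≤-length : ∀ μ {j} → 1 ℕ.≤ j → conj μ ‼ j ℕ.≤ length (parts μ)
conj-‼-≤-length μ {j} 1≤j with conj μ ‼ j in eq
... | zero  = z≤n
... | suc k = ‼-positive μ (ℕ.≤-trans 1≤j (conj-≤⇒ μ (s≤s z≤n) 1≤j (ℕ.≤-reflexive (sym eq))))

-- The hook length of the box (i, j) is rowEnd i - colEnd j, so a sum over the
-- boxes becomes a sum over the pairs x < y with y vertical and x horizontal.
module BoxSum (μ : Partition) (legs : LegsExceedArms μ) where

  private
    N = extent μ
    V? = vertical? μ

  -- A horizontal step at 0 would end a column of length `j` with index `j`. Then `(j , j)` is a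
  -- box, where the column has length `suc (μ ‼ j)`, which exceeds `j`.
  vertical-0 : Vertical μ 0ℤ
  vertical-0 with V? 0ℤ
  ... | yes v = v
  ... | no ¬v with j , 1≤j , eq ← ¬vertical-colEnd μ {0ℤ} ¬v = contradiction (ℕ.≤-trans (ℕ.≤-reflexive (sym (legs 1≤j j≤))) (ℕ.≤-reflexive (sym j≡))) (ℕ.≤⇒≯ j≤)
    where
    j≡ : j ≡ conj μ ‼ j
    j≡ = ℤ.+-injective (ℤ.i-j≡0⇒i≡j _ _ (sym eq))
    j≤ : j ℕ.≤ μ ‼ j
    j≤ = conj-≤⇒ μ 1≤j 1≤j (ℕ.≤-reflexive j≡)

  private
    -- The shift of the numbering by 1 absorbs the excess of the leg over the arm, which makes the
    -- two ends exactly opposite.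
    colEnd-diagonal : ∀ {i} → 1 ℕ.≤ i → i ℕ.≤ μ ‼ i → colEnd μ i ≡ - rowEnd μ i
    colEnd-diagonal {i} 1≤i i≤ = trans (cong (λ z → + i - + z) (legs 1≤i i≤))
      (trans (cong (λ z → + i - z) (ℤ.pos-+ 1 (μ ‼ i))) (lemma (+ i) (+ (μ ‼ i))))
      where
      lemma : ∀ i a → i - (1ℤ + a) ≡ - (a + 1ℤ - i)
      lemma = solve-∀

  -- A positive vertical step ends a row that reaches the diagonal; the column through the same
  -- diagonal box ends, horizontally, at the opposite position.
  vertical⇒¬vertical-neg : ∀ {n} → 1 ℕ.≤ n → Vertical μ (+ n) → ¬ Vertical μ (- (+ n))
  vertical⇒¬vertical-neg {n} 1≤n v with i , 1≤i , eq ← vertical-rowEnd μ {+ n} v =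
    subst (¬_ ∘ Vertical μ) (trans (colEnd-diagonal 1≤i i≤) (cong -_ (sym eq))) (colEnd-¬vertical μ 1≤i)
    where
    lemma : ∀ a i → a + 1ℤ - i - 1ℤ ≡ a - i
    lemma = solve-∀
    i≤ : i ℕ.≤ μ ‼ i
    i≤ = ℤ.drop‿+≤+ (from-gap≤ (subst (λ z → 0ℤ ≤ z - 1ℤ) eq (ℕ-gap 1≤n)) (lemma (+ (μ ‼ i)) (+ i)))

  ¬vertical-neg⇒vertical : ∀ {n} → 1 ℕ.≤ n → ¬ Vertical μ (- (+ n)) → Vertical μ (+ n)
  ¬vertical-neg⇒vertical {n} 1≤n ¬v with j , 1≤j , eq ← ¬vertical-colEnd μ { - (+ n)} ¬v =
    subst (Vertical μ) (trans (sym (ℤ.neg-involutive _)) (trans (cong -_ (trans (sym (colEnd-diagonal 1≤j j≤)) (sym eq))) (ℤ.neg-involutive _)))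
      (rowEnd-vertical μ 1≤j)
    where
    lemma : ∀ j b → - (j - b) ≡ b - j
    lemma = solve-∀
    j≤ : j ℕ.≤ μ ‼ j
    j≤ = conj-≤⇒ μ 1≤j 1≤j (ℤ.drop‿+≤+ (from-gap≤ {s = + n} (+≤+ z≤n)
      (trans (sym (ℤ.neg-involutive (+ n))) (trans (cong -_ eq) (lemma (+ j) (+ (conj μ ‼ j)))))))

  private
    -- `colEnd μ j` lies beyond `colEnd μ i`, which is `- rowEnd μ i` because `(i , i)` is a box as
    -- well.
    above-diagonal : ∀ {i j} → 1 ℕ.≤ i → i ℕ.< j → j ℕ.≤ μ ‼ i → 0ℤ < colEnd μ j + rowEnd μ i
    above-diagonal {i} {j} 1≤i i<j j≤ = from-gap (gap (colEnd-strict μ 1≤i i<j))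
      (trans (cong (λ z → colEnd μ j - z - 1ℤ) (colEnd-diagonal 1≤i (ℕ.≤-trans (ℕ.<⇒≤ i<j) j≤))) (lemma (colEnd μ j) (rowEnd μ i)))
      where
      lemma : ∀ a b → a - - b - 1ℤ ≡ a + b - 0ℤ - 1ℤ
      lemma = solve-∀

    below-diagonal : ∀ {i j} → 1 ℕ.≤ j → j ℕ.≤ i → j ℕ.≤ μ ‼ i → colEnd μ j + rowEnd μ i ≤ 0ℤ
    below-diagonal {i} {j} 1≤j j≤i j≤ = from-gap≤ (ℤ.i≤j⇒0≤j-i (rowEnd-anti μ 1≤j j≤i))
      (trans (lemma (rowEnd μ j) (rowEnd μ i)) (cong (λ z → 0ℤ - (z + rowEnd μ i)) (sym (colEnd-diagonal 1≤j
        (ℕ.≤-trans j≤ (‼-antitone μ 1≤j j≤i))))))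
      where
      lemma : ∀ a b → a - b ≡ 0ℤ - (- a + b)
      lemma = solve-∀

  weight : ℤ → ℤ
  weight x = 𝟙 (V? x)

  module _ (A B : ℤ → ℤ) where

    -- The sign of `x + y` tells the side of the diagonal, so `A` is applied to the hooks with
    -- `ε′ = 1` and `B` to the others.
    kernel : ℤ → ℤ → ℤ
    kernel x y = if does (0ℤ ℤ.<? x + y) then A (y - x) else B (y - x)

    kernel-> : ∀ x y → 0ℤ < x + y → kernel x y ≡ A (y - x)
    kernel-> x y = if-yes (0ℤ ℤ.<? x + y)

    kernel-≤ : ∀ x y → x + y ≤ 0ℤ → kernel x y ≡ B (y - x)
    kernel-≤ x y ≤0 = if-no (0ℤ ℤ.<? x + y) (ℤ.≤⇒≯ ≤0)

  hook-ends : ∀ {i j} → 1 ℕ.≤ i → 1 ℕ.≤ j → j ℕ.≤ μ ‼ i → + hook μ (i , j) ≡ rowEnd μ i - colEnd μ j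
  hook-ends {i} {j} 1≤i 1≤j j≤ = begin
    + (1 ℕ.+ (μ ‼ i ℕ.∸ j) ℕ.+ (conj μ ‼ j ℕ.∸ i))            ≡⟨ ℤ.pos-+ (1 ℕ.+ (μ ‼ i ℕ.∸ j)) _ ⟩
    + (1 ℕ.+ (μ ‼ i ℕ.∸ j)) + + (conj μ ‼ j ℕ.∸ i)            ≡⟨ cong (_+ + (conj μ ‼ j ℕ.∸ i)) (ℤ.pos-+ 1 (μ ‼ i ℕ.∸ j)) ⟩
    1ℤ + + (μ ‼ i ℕ.∸ j) + + (conj μ ‼ j ℕ.∸ i)               ≡⟨ cong₂ (λ a b → 1ℤ + a + b) (exact j≤) (exact (≤⇒conj-≤ μ 1≤i 1≤j j≤)) ⟩
    1ℤ + (+ (μ ‼ i) - + j) + (+ (conj μ ‼ j) - + i)           ≡⟨ lemma (+ (μ ‼ i)) (+ j) (+ (conj μ ‼ j)) (+ i) ⟩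
    rowEnd μ i - colEnd μ j                                    ∎
    where
    open ≡-Reasoning
    exact : ∀ {m n} → m ℕ.≤ n → + (n ℕ.∸ m) ≡ + n - + m
    exact {m} {n} m≤n = trans (sym (ℤ.⊖-≥ m≤n)) (sym (ℤ.m-n≡m⊖n n m))
    lemma : ∀ a j b i → 1ℤ + (a - j) + (b - i) ≡ a + 1ℤ - i - (j - b)
    lemma = solve-∀

  box-kernel : ∀ (H : ℤ → ℤ → ℤ) {i j} → 1 ℕ.≤ i → 1 ℕ.≤ j → j ℕ.≤ μ ‼ i →
    H (ε′ (i , j)) (+ hook μ (i , j)) ≡ kernel (H 1ℤ) (H -1ℤ) (colEnd μ j) (rowEnd μ i)
  box-kernel H {i} {j} 1≤i 1≤j j≤ with i ℕ.<? j
  ... | yes i<j = trans (cong₂ H (ε′-above i<j) (hook-ends 1≤i 1≤j j≤)) (sym (kernel-> (H 1ℤ) (H -1ℤ) (colEnd μ j) (rowEnd μ i) (above-diagonal 1≤i i<j j≤)))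
    where
    ε′-above : ∀ {i j} → i ℕ.< j → ε′ (i , j) ≡ 1ℤ
    ε′-above {i} {j} i<j with i ℕ.<ᵇ j in eq
    ... | true  = refl
    ... | false = ⊥-elim (subst T eq (ℕ.<⇒<ᵇ i<j))
  ... | no  i≮j = trans (cong₂ H (ε′-below i≮j) (hook-ends 1≤i 1≤j j≤)) (sym (kernel-≤ (H 1ℤ) (H -1ℤ) (colEnd μ j) (rowEnd μ i) (below-diagonal 1≤j (ℕ.≮⇒≥ i≮j) j≤)))
    where
    ε′-below : ∀ {i j} → ¬ i ℕ.< j → ε′ (i , j) ≡ -1ℤ
    ε′-below {i} {j} i≮j with i ℕ.<ᵇ j in eq
    ... | true  = contradiction (ℕ.<ᵇ⇒< i j (subst T (sym eq) _)) i≮j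
    ... | false = refl

  private
    length≤N : length (parts μ) ℕ.≤ N
    length≤N = ℕ.m≤n+m _ _

    colEnd∈interval : ∀ {i j} → 1 ℕ.≤ i → 1 ℕ.≤ j → j ℕ.≤ μ ‼ i → colEnd μ j ∈ interval N
    colEnd∈interval {i} {j} 1≤i 1≤j j≤ = ∈-interval⁺
      (ℤ.≤-trans (from-gap≤ {s = + (conj μ ‼ j)} (+≤+ z≤n) (lemma (+ j) (+ (conj μ ‼ j))))
        (+≤+ (ℕ.≤-trans j≤ (ℕ.≤-trans (‼-antitone μ (s≤s z≤n) 1≤i) (ℕ.m≤m+n _ _)))))
      (from-gap≤ {s = + N - + (conj μ ‼ j) + + j} (0≤-+ (ℕ-gap (ℕ.≤-trans (conj-‼-≤-length μ 1≤j) length≤N)) (+≤+ z≤n))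
        (lemma₂ (+ N) (+ (conj μ ‼ j)) (+ j)))
      where
      lemma : ∀ j b → b ≡ j - (j - b)
      lemma = solve-∀
      lemma₂ : ∀ n b j → n - b + j ≡ j - b - - n
      lemma₂ = solve-∀

    rowEnd∈interval : ∀ {i} → 1 ℕ.≤ i → i ℕ.≤ suc N → rowEnd μ i ∈ interval N
    rowEnd∈interval {i} 1≤i i≤ = ∈-interval⁺
      (ℤ.≤-trans (from-gap≤ (ℕ-gap 1≤i) (lemma (+ i) (+ (μ ‼ i))))
        (+≤+ (ℕ.≤-trans (‼-antitone μ (s≤s z≤n) 1≤i) (ℕ.m≤m+n _ _))))
      (from-gap≤ {s = + suc N - + i + + (μ ‼ i)} (0≤-+ (ℕ-gap i≤) (+≤+ z≤n))
        (trans (cong (λ z → z - + i + + (μ ‼ i)) (ℤ.pos-+ 1 N)) (lemma₂ (+ N) (+ (μ ‼ i)) (+ i))))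
      where
      lemma : ∀ i a → i - 1ℤ ≡ a - (a + 1ℤ - i)
      lemma = solve-∀
      lemma₂ : ∀ n a i → 1ℤ + n - i + a ≡ a + 1ℤ - i - - n
      lemma₂ = solve-∀

    strict⇒injective : ∀ (κ : ℕ → ℤ) → (∀ {i j} → i ℕ.< j → κ i ≢ κ j) → ∀ {i j} → κ i ≡ κ j → i ≡ j
    strict⇒injective κ apart {i} {j} eq with ℕ.<-cmp i j
    ... | tri< i<j _ _ = contradiction eq (apart i<j)
    ... | tri≈ _ i≡j _ = i≡j
    ... | tri> _ _ j<i = contradiction (sym eq) (apart j<i)

    ∑-columns : ∀ {i} → 1 ℕ.≤ i → ∀ F → ∑[ j ∈ [1⋯ μ ‼ i ] ] F (colEnd μ j)
      ≡ ∑[ x ∈ interval N ] 𝟙 (¬? (V? x) ×-dec (x ℤ.<? rowEnd μ i)) * F x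
    ∑-columns {i} 1≤i F = trans (∑-[1⋯] (μ ‼ i) (λ j → F (colEnd μ j)))
      (∑-reindex (colEnd μ ∘ suc) (λ x → ¬? (V? x) ×-dec (x ℤ.<? rowEnd μ i)) (Unique.upTo⁺ _) (interval-unique N)
        (strict⇒injective _ (λ i<j → ℤ.<⇒≢ (colEnd-strict μ (s≤s z≤n) (s≤s i<j))))
        (λ j∈ → let j≤ = ∈-upTo⁻ j∈ in colEnd∈interval 1≤i (s≤s z≤n) j≤ , colEnd-¬vertical μ (s≤s z≤n) , box⇒colEnd<rowEnd μ 1≤i (s≤s z≤n) j≤)
        from F)
      where
      from : ∀ {x} → x ∈ interval N → (¬ Vertical μ x) × x < rowEnd μ i → ∃ λ k → k ∈ upTo (μ ‼ i) × x ≡ colEnd μ (suc k)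
      from {x} _ (¬v , x<) with suc k , 1≤j , refl ← ¬vertical-colEnd μ {x} ¬v = k , ∈-upTo⁺ (colEnd<rowEnd⇒box μ 1≤i 1≤j x<) , refl

    -- The range has `suc N` rows because row `suc N`, which is empty, ends at `- N`, the lower end
    -- of the interval.
    ∑-rows : ∀ F → ∑[ i ∈ [1⋯ suc N ] ] F (rowEnd μ i) ≡ ∑[ y ∈ interval N ] weight y * F y
    ∑-rows F = trans (∑-[1⋯] (suc N) (λ i → F (rowEnd μ i)))
      (∑-reindex (rowEnd μ ∘ suc) V? (Unique.upTo⁺ _) (interval-unique N)
        (strict⇒injective _ (λ i<j → ℤ.<⇒≢ (rowEnd-strict μ (s≤s z≤n) (s≤s i<j)) ∘ sym))
        (λ i∈ → rowEnd∈interval (s≤s z≤n) (∈-upTo⁻ i∈) , rowEnd-vertical μ (s≤s z≤n))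
        from F)
      where
      from : ∀ {y} → y ∈ interval N → Vertical μ y → ∃ λ k → k ∈ upTo (suc N) × y ≡ rowEnd μ (suc k)
      from {y} y∈ v with vertical-rowEnd μ {y} v
      ... | suc k , 1≤i , refl with k ℕ.≤? N
      ...   | yes k≤N = k , ∈-upTo⁺ (s≤s k≤N) , refl
      ...   | no  k≰N with μ ‼ suc k in eq
      ...     | suc _ = contradiction (ℕ.<⇒≤ (ℕ.≤-trans (‼-positive μ (ℕ.≤-trans (s≤s z≤n) (ℕ.≤-reflexive (sym eq)))) length≤N)) k≰N
      ...     | zero  = contradiction (proj₂ (∈-interval⁻ {N} y∈)) (ℤ.<⇒≱ (from-gap (gap (+<+ {N} {k} (ℕ.≰⇒> k≰N)))
                (trans (lemma (+ N) (+ k)) (cong (λ z → - (+ N) - (0ℤ + 1ℤ - z) - 1ℤ) (sym (ℤ.pos-+ 1 k))))))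
        where
        lemma : ∀ n k → k - n - 1ℤ ≡ - n - (0ℤ + 1ℤ - (1ℤ + k)) - 1ℤ
        lemma = solve-∀

  ∑-boxes-kernel : ∀ (H : ℤ → ℤ → ℤ) → ∑[ s ∈ boxes μ ] H (ε′ s) (+ hook μ s)
    ≡ ∑[ y ∈ interval N ] weight y * (∑[ x ∈ interval N ] (1ℤ - weight x) * 𝟙 (x ℤ.<? y) * kernel (H 1ℤ) (H -1ℤ) x y)
  ∑-boxes-kernel H = begin
    (∑[ s ∈ boxes μ ] H (ε′ s) (+ hook μ s))
      ≡⟨ ∑-boxes μ (ℕ.m≤n⇒m≤1+n length≤N) _ ⟩
    (∑[ i ∈ [1⋯ suc N ] ] ∑[ j ∈ [1⋯ μ ‼ i ] ] H (ε′ (i , j)) (+ hook μ (i , j)))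
      ≡⟨ ∑-cong [1⋯ suc N ] (λ i i∈ → ∑-cong [1⋯ μ ‼ i ] (λ j j∈ →
           let 1≤j , j≤ = ∈-[1⋯]⁻ j∈ in box-kernel H (proj₁ (∈-[1⋯]⁻ i∈)) 1≤j j≤)) ⟩
    (∑[ i ∈ [1⋯ suc N ] ] ∑[ j ∈ [1⋯ μ ‼ i ] ] k (colEnd μ j) (rowEnd μ i))
      ≡⟨ ∑-cong [1⋯ suc N ] (λ i i∈ → ∑-columns (proj₁ (∈-[1⋯]⁻ i∈)) (λ x → k x (rowEnd μ i))) ⟩
    (∑[ i ∈ [1⋯ suc N ] ] ∑[ x ∈ interval N ] 𝟙 (¬? (V? x) ×-dec (x ℤ.<? rowEnd μ i)) * k x (rowEnd μ i))
      ≡⟨ ∑-ext [1⋯ suc N ] (λ i → ∑-ext (interval N) (λ x → cong (_* k x (rowEnd μ i)) (factor x (rowEnd μ i)))) ⟩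
    (∑[ i ∈ [1⋯ suc N ] ] ∑[ x ∈ interval N ] (1ℤ - weight x) * 𝟙 (x ℤ.<? rowEnd μ i) * k x (rowEnd μ i))
      ≡⟨ ∑-rows (λ y → ∑[ x ∈ interval N ] (1ℤ - weight x) * 𝟙 (x ℤ.<? y) * k x y) ⟩
    (∑[ y ∈ interval N ] weight y * (∑[ x ∈ interval N ] (1ℤ - weight x) * 𝟙 (x ℤ.<? y) * k x y))
      ∎
    where
    open ≡-Reasoning
    k = kernel (H 1ℤ) (H -1ℤ)
    factor : ∀ x y → 𝟙 (¬? (V? x) ×-dec (x ℤ.<? y)) ≡ (1ℤ - weight x) * 𝟙 (x ℤ.<? y)
    factor x y = 𝟙-¬-× (V? x) (x ℤ.<? y)

-- Box sums as sums over the positive vertical steps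

∑∑-symmetrise : ∀ (xs : List A) (f : A → A → ℤ) →
  + 2 * (∑[ x ∈ xs ] ∑[ y ∈ xs ] f x y) ≡ ∑[ x ∈ xs ] ∑[ y ∈ xs ] (f x y + f y x)
∑∑-symmetrise xs f = begin
  + 2 * S                                                         ≡⟨ double S ⟩
  S + S                                                           ≡⟨ cong (_+_ S) (∑-swap xs xs f) ⟩
  S + (∑[ x ∈ xs ] ∑[ y ∈ xs ] f y x)                             ≡⟨ ∑-+ xs _ _ ⟨
  (∑[ x ∈ xs ] ((∑[ y ∈ xs ] f x y) + (∑[ y ∈ xs ] f y x)))       ≡⟨ ∑-ext xs (λ x → ∑-+ xs (f x) (λ y → f y x)) ⟨
  (∑[ x ∈ xs ] ∑[ y ∈ xs ] (f x y + f y x))                       ∎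
  where
  open ≡-Reasoning
  S = ∑[ x ∈ xs ] ∑[ y ∈ xs ] f x y
  double : ∀ s → + 2 * s ≡ s + s
  double = solve-∀

∑-reverse : ∀ m (Φ : ℤ → ℤ) → ∑[ k ∈ upTo m ] Φ (+ m - + k) ≡ ∑[ k ∈ [1⋯ m ] ] Φ (+ k)
∑-reverse zero    Φ = refl
∑-reverse (suc m) Φ = begin
  Φ (+ suc m - 0ℤ) + ∑ (applyUpTo suc m) (λ k → Φ (+ suc m - + k))
    ≡⟨ cong₂ _+_ (cong Φ (ℤ.+-identityʳ (+ suc m))) (∑-[1⋯] m (λ k → Φ (+ suc m - + k))) ⟩
  Φ (+ suc m) + (∑[ k ∈ upTo m ] Φ (+ suc m - + suc k))
    ≡⟨ cong (_+_ (Φ (+ suc m))) (∑-ext (upTo m) (λ k → cong Φ (shift-both m k))) ⟩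
  Φ (+ suc m) + (∑[ k ∈ upTo m ] Φ (+ m - + k))
    ≡⟨ cong (_+_ (Φ (+ suc m))) (trans (∑-reverse m Φ) (∑-[1⋯] m (λ k → Φ (+ k)))) ⟩
  Φ (+ suc m) + (∑[ k ∈ upTo m ] Φ (+ suc k))
    ≡⟨ ℤ.+-comm (Φ (+ suc m)) _ ⟩
  (∑[ k ∈ upTo m ] Φ (+ suc k)) + Φ (+ suc m)
    ≡⟨ ∑-upTo-suc m (λ k → Φ (+ suc k)) ⟨
  (∑[ k ∈ upTo (suc m) ] Φ (+ suc k))
    ≡⟨ ∑-[1⋯] (suc m) (λ k → Φ (+ k)) ⟨
  (∑[ k ∈ [1⋯ suc m ] ] Φ (+ k))
    ∎
  where
  open ≡-Reasoning
  shift-both : ∀ m k → + suc m - + suc k ≡ + m - + k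
  shift-both m k rewrite ℤ.pos-+ 1 m | ℤ.pos-+ 1 k = lemma (+ m) (+ k)
    where
    lemma : ∀ m k → 1ℤ + m - (1ℤ + k) ≡ m - k
    lemma = solve-∀

-- The differences from `m` to the smaller positive positions are `1, …, m - 1`. The range on the
-- right starts at 0 to fit the later window sums, whence the subtracted `Φ 0ℤ`.
∑-below : ∀ {m n} → 1 ℕ.≤ m → m ℕ.≤ n → ∀ (Φ : ℤ → ℤ) →
  ∑[ k ∈ [1⋯ n ] ] 𝟙 (k ℕ.<? m) * Φ (+ m - + k) ≡ (∑[ k ∈ upTo m ] Φ (+ k)) - Φ 0ℤ
∑-below {suc m} {n} _ m<n Φ = begin
  (∑[ k ∈ [1⋯ n ] ] 𝟙 (k ℕ.<? suc m) * Φ (+ suc m - + k))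
    ≡⟨ ∑-ext [1⋯ n ] (λ k → cong (_* Φ (+ suc m - + k)) (𝟙-⇔ (k ℕ.<? suc m) (k ℕ.≤? m) ℕ.≤-pred s≤s)) ⟩
  (∑[ k ∈ [1⋯ n ] ] 𝟙 (k ℕ.≤? m) * Φ (+ suc m - + k))
    ≡⟨ ∑-extend (ℕ.<⇒≤ m<n) (λ k → Φ (+ suc m - + k)) ⟨
  (∑[ k ∈ [1⋯ m ] ] Φ (+ suc m - + k))
    ≡⟨ lemma (Φ 0ℤ) (Φ (+ suc m)) _ ⟩
  Φ (+ suc m) + (∑[ k ∈ [1⋯ m ] ] Φ (+ suc m - + k)) - Φ (+ suc m)
    ≡⟨ cong (λ z → Φ z + (∑[ k ∈ [1⋯ m ] ] Φ (+ suc m - + k)) - Φ (+ suc m)) (ℤ.+-identityʳ (+ suc m)) ⟨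
  (∑[ k ∈ upTo (suc m) ] Φ (+ suc m - + k)) - Φ (+ suc m)
    ≡⟨ cong (_- Φ (+ suc m)) (trans (∑-reverse (suc m) Φ) (trans (∑-[1⋯] (suc m) (λ k → Φ (+ k))) (∑-upTo-suc m (λ k → Φ (+ suc k))))) ⟩
  (∑[ k ∈ upTo m ] Φ (+ suc k)) + Φ (+ suc m) - Φ (+ suc m)
    ≡⟨ lemma₂ (Φ 0ℤ) _ _ ⟩
  Φ 0ℤ + (∑[ k ∈ upTo m ] Φ (+ suc k)) - Φ 0ℤ
    ≡⟨ cong (λ z → Φ 0ℤ + z - Φ 0ℤ) (∑-[1⋯] m (λ k → Φ (+ k))) ⟨
  (∑[ k ∈ upTo (suc m) ] Φ (+ k)) - Φ 0ℤ
    ∎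
  where
  open ≡-Reasoning
  lemma : ∀ a b c → c ≡ b + c - b
  lemma = solve-∀
  lemma₂ : ∀ a b c → b + c - c ≡ a + b - a
  lemma₂ = solve-∀

positiveVerticals : Partition → List ℕ
positiveVerticals μ = filter (λ n → vertical? μ (+ n)) [1⋯ extent μ ]

-- The reflection sends a pair `x < y` off the diagonal to `- y < - x`, a box with the same hook on
-- the other side. `A` and `B` therefore enter together, as `Φ`, except at the diagonal boxes and at
-- the pairs that contain position 0. This is why evenness is asked of `A + B`.
module BoxSumFormula (μ : Partition) (legs : LegsExceedArms μ) (A B : ℤ → ℤ)
  (even : ∀ n → A (- n) + B (- n) ≡ A n + B n) where

  open BoxSum μ legs

  Φ : ℤ → ℤ
  Φ n = A n + B n

  private
    N = extent μ
    R = [1⋯ N ]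
    U = positiveVerticals μ
    K = kernel A B

    w : ℕ → ℤ
    w n = weight (+ n)

    _≺_ : ℕ → ℕ → ℤ
    m ≺ n = 𝟙 (m ℕ.<? n)

    weight-0 : weight 0ℤ ≡ 1ℤ
    weight-0 = 𝟙-yes (vertical? μ 0ℤ) vertical-0

    weight-neg : ∀ {n} → 1 ℕ.≤ n → weight (- (+ n)) ≡ 1ℤ - w n
    weight-neg {n} 1≤n = 𝟙-¬ (vertical? μ (- (+ n))) (vertical? μ (+ n))
      (λ v v′ → vertical⇒¬vertical-neg 1≤n v′ v)
      λ ¬v → flip ¬v
      where
      flip : ¬ Vertical μ (+ n) → Vertical μ (- (+ n))
      flip ¬v with vertical? μ (- (+ n))
      ... | yes v = v
      ... | no ¬v′ = contradiction (¬vertical-neg⇒vertical 1≤n ¬v′) ¬v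

    w-idem : ∀ n → w n * w n ≡ w n
    w-idem n = lemma (vertical? μ (+ n))
      where
      lemma : ∀ {P : Set} (P? : Dec P) → 𝟙 P? * 𝟙 P? ≡ 𝟙 P?
      lemma (yes _) = refl
      lemma (no _)  = refl

    inner : ℤ → ℤ
    inner y = ∑[ x ∈ interval N ] (1ℤ - weight x) * 𝟙 (x ℤ.<? y) * K x y

    -- The step at 0 is vertical and so is no candidate for `x`; at `x = - n` the antisymmetry turns
    -- `1ℤ - weight x` into `w n`.
    inner-split : ∀ y → inner y ≡ ∑[ n ∈ R ] ((1ℤ - w n) * 𝟙 (+ n ℤ.<? y) * K (+ n) y + w n * 𝟙 (- (+ n) ℤ.<? y) * K (- (+ n)) y)
    inner-split y = trans (∑-interval N (λ x → (1ℤ - weight x) * 𝟙 (x ℤ.<? y) * K x y)) (trans (cong₂ _+_ zero-term (∑-cong R λ n n∈ →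
        cong (λ z → (1ℤ - w n) * 𝟙 (+ n ℤ.<? y) * K (+ n) y + z * 𝟙 (- (+ n) ℤ.<? y) * K (- (+ n)) y)
          (trans (cong (λ z → 1ℤ - z) (weight-neg (proj₁ (∈-[1⋯]⁻ n∈)))) (i-[i-j]≡j 1ℤ (w n))))) (ℤ.+-identityˡ _))
      where
      zero-term : (1ℤ - weight 0ℤ) * 𝟙 (0ℤ ℤ.<? y) * K 0ℤ y ≡ 0ℤ
      zero-term = cong (λ z → (1ℤ - z) * 𝟙 (0ℤ ℤ.<? y) * K 0ℤ y) weight-0

    +-≮-neg : ∀ m n → ¬ (+ m < - (+ n))
    +-≮-neg m n = ℤ.≤⇒≯ (ℤ.neg-≤-pos {n} {m})

    neg-<-+ : ∀ {m} n → 1 ℕ.≤ m → - (+ m) < + n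
    neg-<-+ n (s≤s z≤n) = -<+

    neg-swap : ∀ m n → 𝟙 (- (+ n) ℤ.<? - (+ m)) ≡ m ≺ n
    neg-swap m n = 𝟙-⇔ (- (+ n) ℤ.<? - (+ m)) (m ℕ.<? n) (λ lt → ℤ.drop‿+<+ (ℤ.neg-cancel-< lt)) (λ lt → ℤ.neg-mono-< (+<+ lt))

    +-swap : ∀ m n → 𝟙 (+ n ℤ.<? + m) ≡ n ≺ m
    +-swap m n = 𝟙-⇔ (+ n ℤ.<? + m) (n ℕ.<? m) ℤ.drop‿+<+ +<+

    drop-first : ∀ a b c d → b ≡ 0ℤ → a * b * c + d ≡ d
    drop-first a b c d refl = trans (cong (λ z → z * c + d) (ℤ.*-zeroʳ a)) (ℤ.+-identityˡ d)

    inner-0 : inner 0ℤ ≡ ∑[ n ∈ R ] w n * B (+ n)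
    inner-0 = trans (inner-split 0ℤ) (∑-cong R λ n n∈ →
      trans (drop-first (1ℤ - w n) _ (K (+ n) 0ℤ) _ (𝟙-no (+ n ℤ.<? 0ℤ) (+-≮-neg n 0)))
        (trans (cong (λ z → w n * z * K (- (+ n)) 0ℤ) (𝟙-yes (- (+ n) ℤ.<? 0ℤ) (neg-<-+ 0 (proj₁ (∈-[1⋯]⁻ n∈)))))
          (cong₂ _*_ (ℤ.*-identityʳ (w n)) (trans (kernel-≤ A B (- (+ n)) 0ℤ (ℤ.≤-trans (ℤ.≤-reflexive (ℤ.+-identityʳ _)) (ℤ.neg-≤-pos {n} {0})))
            (cong B (trans (ℤ.+-identityˡ _) (ℤ.neg-involutive (+ n))))))))

    inner-+ : ∀ {m} → 1 ℕ.≤ m → inner (+ m) ≡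
      ∑[ n ∈ R ] ((1ℤ - w n) * (n ≺ m) * A (+ m - + n) + w n * K (- (+ n)) (+ m))
    inner-+ {m} 1≤m = trans (inner-split (+ m)) (∑-cong R λ n n∈ → cong₂ _+_
      (cong₂ (λ a b → (1ℤ - w n) * a * b) (+-swap m n)
        (kernel-> A B (+ n) (+ m) (ℤ.<-≤-trans (+<+ 1≤m) (+≤+ (ℕ.m≤n+m m n)))))
      (cong (_* K (- (+ n)) (+ m)) (trans (cong (w n *_) (𝟙-yes (- (+ n) ℤ.<? + m) (neg-<-+ m (proj₁ (∈-[1⋯]⁻ n∈))))) (ℤ.*-identityʳ (w n)))))

    inner-neg : ∀ m → inner (- (+ m)) ≡ ∑[ n ∈ R ] w n * ((m ≺ n) * B (+ n - + m))
    inner-neg m = trans (inner-split (- (+ m))) (∑-cong R λ n n∈ →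
      trans (drop-first (1ℤ - w n) _ (K (+ n) (- (+ m))) _ (𝟙-no (+ n ℤ.<? - (+ m)) (+-≮-neg n m)))
        (trans (ℤ.*-assoc (w n) _ _) (cong (w n *_) (cong₂ _*_ (neg-swap m n)
          (trans (kernel-≤ A B (- (+ n)) (- (+ m)) (subst (_≤ 0ℤ) (ℤ.neg-distrib-+ (+ n) (+ m)) (ℤ.neg-≤-pos {n ℕ.+ m} {0})))
            (cong B (lemma (+ m) (+ n))))))))
      where
      lemma : ∀ m n → - m - - n ≡ n - m
      lemma = solve-∀

    -- Collects the pairs with `y = ± m` and `x = ± n`. The combination `y = - m`, `x = + n` is
    -- absent because it never satisfies `x < y`.
    X : ℕ → ℕ → ℤ
    X m n = w m * ((1ℤ - w n) * (n ≺ m) * A (+ m - + n) + w n * K (- (+ n)) (+ m))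
          + (1ℤ - w m) * (w n * ((m ≺ n) * B (+ n - + m)))

    kernel-sum : ∑[ y ∈ interval N ] weight y * inner y ≡ (∑[ n ∈ R ] w n * B (+ n)) + (∑[ m ∈ R ] ∑[ n ∈ R ] X m n)
    kernel-sum = trans (∑-interval N (λ y → weight y * inner y)) (cong₂ _+_
      (trans (cong₂ _*_ weight-0 inner-0) (ℤ.*-identityˡ _))
      (∑-cong R λ m m∈ → let 1≤m = proj₁ (∈-[1⋯]⁻ m∈) in
        trans (cong₂ _+_ (trans (cong (w m *_) (inner-+ 1≤m)) (sym (∑-* (w m) R _)))
                         (trans (cong₂ _*_ (weight-neg 1≤m) (inner-neg m)) (sym (∑-* (1ℤ - w m) R _))))
              (sym (∑-+ R _ _))))

    -- For `n < m` there is a contribution only if `m` is vertical: `Φ (m - n)` if `n` is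
    -- horizontal, and `Φ (m + n)` in its place if `n` is vertical. `Z` takes the first value
    -- throughout and `E` corrects it.
    Z E : ℕ → ℕ → ℤ
    Z m n = w m * ((n ≺ m) * Φ (+ m - + n))
    E m n = w m * (w n * (Φ (+ m + + n) - Φ (+ m - + n)))

    -- For `n = m` the only box is the pair `- m`, `+ m`. It lies on the diagonal, is counted with
    -- `B` and is its own mirror image; this term is the excess of `+ 2 * B (+ m + + m)` over the
    -- share supplied by `E m m`.
    diagonal : ℕ → ℤ
    diagonal m = + 2 * B (+ m + + m) - Φ (+ m + + m) + Φ 0ℤ

    swap-gap : ∀ m n → m - n - 1ℤ ≡ - n + m - 0ℤ - 1ℤ
    swap-gap = solve-∀

    neg-gap : ∀ m n → m - n ≡ 0ℤ - (- m + n)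
    neg-gap = solve-∀

    minus-neg : ∀ m n → m - - n ≡ m + n
    minus-neg = solve-∀

    neg-minus : ∀ m n → - (m - n) ≡ n - m
    neg-minus = solve-∀

    X-below : ∀ m n → n ℕ.< m → X m n + X n m ≡ Z m n + Z n m + E m n
    X-below m n n<m
      rewrite 𝟙-yes (n ℕ.<? m) n<m | 𝟙-no (m ℕ.<? n) (ℕ.<-asym n<m)
            | kernel-> A B (- (+ n)) (+ m) (from-gap (gap (+<+ n<m)) (swap-gap (+ m) (+ n)))
            | kernel-≤ A B (- (+ m)) (+ n) (from-gap≤ (ℕ-gap (ℕ.<⇒≤ n<m)) (neg-gap (+ m) (+ n)))
            | minus-neg (+ m) (+ n) | minus-neg (+ n) (+ m) | ℤ.+-comm (+ n) (+ m)
      = lemma (w m) (w n) (A (+ m - + n)) (A (+ n - + m)) (B (+ n - + m)) (B (+ m - + n)) (A (+ m + + n)) (B (+ m + + n))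
      where
      lemma : ∀ u v a a′ b′ b c d →
        u * ((1ℤ - v) * 1ℤ * a + v * c) + (1ℤ - u) * (v * (0ℤ * b′)) + (v * ((1ℤ - u) * 0ℤ * a′ + u * d) + (1ℤ - v) * (u * (1ℤ * b)))
        ≡ u * (1ℤ * (a + b)) + v * (0ℤ * (a′ + b′)) + u * (v * (c + d - (a + b)))
      lemma = solve-∀

    -- Evenness of `Φ` enters here: it identifies `Φ (m - n)` with `Φ (n - m)`.
    E-sym : ∀ m n → E m n ≡ E n m
    E-sym m n rewrite ℤ.+-comm (+ n) (+ m) | sym (even (+ m - + n)) | neg-minus (+ m) (+ n) = lemma (w m) (w n) _
      where
      lemma : ∀ u v a → u * (v * a) ≡ v * (u * a)
      lemma = solve-∀

    X-diagonal : ∀ m → X m m + X m m ≡ Z m m + Z m m + E m m + w m * w m * diagonal m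
    X-diagonal m
      rewrite 𝟙-no (m ℕ.<? m) (ℕ.<-irrefl refl)
            | kernel-≤ A B (- (+ m)) (+ m) (ℤ.≤-reflexive (ℤ.+-inverseˡ (+ m)))
            | minus-neg (+ m) (+ m) | ℤ.+-inverseʳ (+ m)
      = lemma (w m) (A 0ℤ) (B 0ℤ) (A (+ m + + m)) (B (+ m + + m))
      where
      lemma : ∀ u a b c d →
        u * ((1ℤ - u) * 0ℤ * a + u * d) + (1ℤ - u) * (u * (0ℤ * b)) + (u * ((1ℤ - u) * 0ℤ * a + u * d) + (1ℤ - u) * (u * (0ℤ * b)))
        ≡ u * (0ℤ * (a + b)) + u * (0ℤ * (a + b)) + u * (u * (c + d - (a + b))) + u * u * (+ 2 * d - (c + d) + (a + b))
      lemma = solve-∀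

    X-sym : ∀ m n → X m n + X n m ≡ Z m n + Z n m + E m n + 𝟙 (n ℕ.≟ m) * (w m * w n * diagonal n)
    X-sym m n with ℕ.<-cmp n m
    ... | tri< n<m n≢m _ rewrite 𝟙-no (n ℕ.≟ m) n≢m = trans (X-below m n n<m) (sym (ℤ.+-identityʳ _))
    ... | tri≈ _ refl _ rewrite 𝟙-yes (m ℕ.≟ m) refl = trans (X-diagonal m) (cong (_+_ (Z m m + Z m m + E m m)) (sym (ℤ.*-identityˡ _)))
    ... | tri> _ n≢m m<n rewrite 𝟙-no (n ℕ.≟ m) n≢m = trans (ℤ.+-comm (X m n) (X n m))
      (trans (X-below n m m<n) (trans (cong₂ _+_ (ℤ.+-comm (Z n m) (Z m n)) (E-sym n m)) (sym (ℤ.+-identityʳ _))))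

  -- The summands come from the pair `- m`, 0, from the diagonal box and from `Z`. Doubling `Z`
  -- subtracts `Φ 0ℤ` twice, and `diagonal` gives it back once.
  single : ℕ → ℤ
  single m = + 2 * B (+ m) + (+ 2 * B (+ m + + m) - Φ (+ m + + m)) + (+ 2 * (∑[ k ∈ upTo m ] Φ (+ k)) - Φ 0ℤ)

  private
    ∑-verticals : ∀ f → ∑[ m ∈ R ] w m * f m ≡ ∑ U f
    ∑-verticals f = sym (∑-filter (λ n → vertical? μ (+ n)) R f)

    column : ℕ → ℤ
    column m = ∑[ n ∈ R ] (n ≺ m) * Φ (+ m - + n)

    double-sum : + 2 * (∑[ m ∈ R ] ∑[ n ∈ R ] X m n) ≡
      (∑[ m ∈ R ] w m * (+ 2 * column m + diagonal m)) + (∑[ m ∈ R ] ∑[ n ∈ R ] E m n)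
    double-sum = begin
      + 2 * (∑[ m ∈ R ] ∑[ n ∈ R ] X m n)
        ≡⟨ ∑∑-symmetrise R X ⟩
      (∑[ m ∈ R ] ∑[ n ∈ R ] (X m n + X n m))
        ≡⟨ ∑-ext R (λ m → ∑-ext R (X-sym m)) ⟩
      (∑[ m ∈ R ] ∑[ n ∈ R ] (Z m n + Z n m + E m n + D m n))
        ≡⟨ ∑-ext R (λ m → trans (∑-+ R _ (D m)) (cong (_+ ∑ R (D m)) (∑-+ R _ (E m)))) ⟩
      (∑[ m ∈ R ] ((∑[ n ∈ R ] (Z m n + Z n m)) + (∑[ n ∈ R ] E m n) + ∑ R (D m)))
        ≡⟨ trans (∑-+ R _ _) (cong (_+ (∑[ m ∈ R ] ∑ R (D m))) (∑-+ R _ _)) ⟩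
      (∑[ m ∈ R ] ∑[ n ∈ R ] (Z m n + Z n m)) + (∑[ m ∈ R ] ∑[ n ∈ R ] E m n) + (∑[ m ∈ R ] ∑ R (D m))
        ≡⟨ cong₂ (λ a b → a + (∑[ m ∈ R ] ∑[ n ∈ R ] E m n) + b)
             (trans (sym (∑∑-symmetrise R Z)) (cong (+ 2 *_) (∑-ext R λ m → ∑-* (w m) R _)))
             (∑-cong R λ m m∈ → trans (∑-δ ℕ._≟_ ([1⋯]-unique N) m∈ (λ n → w m * w n * diagonal n)) (cong (_* diagonal m) (w-idem m))) ⟩
      + 2 * (∑[ m ∈ R ] w m * column m) + (∑[ m ∈ R ] ∑[ n ∈ R ] E m n) + (∑[ m ∈ R ] w m * diagonal m)
        ≡⟨ lemma (+ 2 * (∑[ m ∈ R ] w m * column m)) _ _ ⟩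
      + 2 * (∑[ m ∈ R ] w m * column m) + (∑[ m ∈ R ] w m * diagonal m) + (∑[ m ∈ R ] ∑[ n ∈ R ] E m n)
        ≡⟨ cong (_+ (∑[ m ∈ R ] ∑[ n ∈ R ] E m n)) (trans (cong (_+ (∑[ m ∈ R ] w m * diagonal m)) (sym (∑-* (+ 2) R _))) (sym (∑-+ R _ _))) ⟩
      (∑[ m ∈ R ] (+ 2 * (w m * column m) + w m * diagonal m)) + (∑[ m ∈ R ] ∑[ n ∈ R ] E m n)
        ≡⟨ cong (_+ (∑[ m ∈ R ] ∑[ n ∈ R ] E m n)) (∑-ext R λ m → lemma₂ (w m) (column m) (diagonal m)) ⟩
      (∑[ m ∈ R ] w m * (+ 2 * column m + diagonal m)) + (∑[ m ∈ R ] ∑[ n ∈ R ] E m n)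
        ∎
      where
      open ≡-Reasoning
      D : ℕ → ℕ → ℤ
      D m n = 𝟙 (n ℕ.≟ m) * (w m * w n * diagonal n)
      lemma : ∀ a b c → a + b + c ≡ a + c + b
      lemma = solve-∀
      lemma₂ : ∀ u a b → + 2 * (u * a) + u * b ≡ u * (+ 2 * a + b)
      lemma₂ = solve-∀

    kernel-sum-formula : + 2 * (∑[ y ∈ interval N ] weight y * inner y) ≡
      ∑ U single + (∑[ m ∈ U ] ∑[ n ∈ U ] (Φ (+ m + + n) - Φ (+ m - + n)))
    kernel-sum-formula = begin
      + 2 * (∑[ y ∈ interval N ] weight y * inner y)
        ≡⟨ cong (+ 2 *_) kernel-sum ⟩
      + 2 * ((∑[ n ∈ R ] w n * B (+ n)) + (∑[ m ∈ R ] ∑[ n ∈ R ] X m n))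
        ≡⟨ ℤ.*-distribˡ-+ (+ 2) (∑[ n ∈ R ] w n * B (+ n)) _ ⟩
      + 2 * (∑[ n ∈ R ] w n * B (+ n)) + + 2 * (∑[ m ∈ R ] ∑[ n ∈ R ] X m n)
        ≡⟨ cong₂ _+_ (sym (∑-* (+ 2) R _)) double-sum ⟩
      (∑[ n ∈ R ] + 2 * (w n * B (+ n))) + ((∑[ m ∈ R ] w m * (+ 2 * column m + diagonal m)) + (∑[ m ∈ R ] ∑[ n ∈ R ] E m n))
        ≡⟨ ℤ.+-assoc (∑[ n ∈ R ] + 2 * (w n * B (+ n))) _ _ ⟨
      (∑[ n ∈ R ] + 2 * (w n * B (+ n))) + (∑[ m ∈ R ] w m * (+ 2 * column m + diagonal m)) + (∑[ m ∈ R ] ∑[ n ∈ R ] E m n)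
        ≡⟨ cong₂ _+_ (trans (sym (∑-+ R _ _)) (trans (∑-cong R single-term) (∑-verticals single)))
             (trans (∑-ext R (λ m → trans (∑-* (w m) R _) (cong (w m *_) (∑-verticals _)))) (∑-verticals _)) ⟩
      ∑ U single + (∑[ m ∈ U ] ∑[ n ∈ U ] (Φ (+ m + + n) - Φ (+ m - + n)))
        ∎
      where
      open ≡-Reasoning
      single-term : ∀ m → m ∈ R → + 2 * (w m * B (+ m)) + w m * (+ 2 * column m + diagonal m) ≡ w m * single m
      single-term m m∈ = trans
        (cong (λ z → + 2 * (w m * B (+ m)) + w m * (+ 2 * z + diagonal m)) (let 1≤m , m≤N = ∈-[1⋯]⁻ m∈ in ∑-below 1≤m m≤N Φ))
        (lemma (w m) (B (+ m)) (∑[ k ∈ upTo m ] Φ (+ k)) (Φ 0ℤ) (B (+ m + + m)) (Φ (+ m + + m)))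
        where
        lemma : ∀ u b s z c d → + 2 * (u * b) + u * (+ 2 * (s - z) + (+ 2 * c - d + z)) ≡ u * (+ 2 * b + (+ 2 * c - d) + (+ 2 * s - z))
        lemma = solve-∀

  -- Stated for twice the sum, since symmetrising over ordered pairs doubles everything and keeps
  -- both ranges equal to all of `U`.
  box-sum-formula : ∀ (H : ℤ → ℤ → ℤ) → H 1ℤ ≡ A → H -1ℤ ≡ B →
    + 2 * (∑[ s ∈ boxes μ ] H (ε′ s) (+ hook μ s)) ≡
    ∑ U single + (∑[ m ∈ U ] ∑[ n ∈ U ] (Φ (+ m + + n) - Φ (+ m - + n)))
  box-sum-formula H refl refl = trans (cong (+ 2 *_) (∑-boxes-kernel H)) kernel-sum-formula

-- Telescoping for even functions

-- Pigeonhole: if `k` were missed, punching it out would give an injection of `Fin (suc n)` into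
-- `Fin n`.
injective⇒surjective : ∀ {n} (f : Fin n → Fin n) → (∀ {i j} → f i ≡ f j → i ≡ j) → ∀ k → ∃ λ i → f i ≡ k
injective⇒surjective {suc n} f inj k with Fin.any? (λ i → f i Fin.≟ k)
... | yes p = p
... | no ¬p = contradiction
  (Fin.injective⇒≤ {f = λ i → Fin.punchOut {i = k} {j = f i} (λ eq → ¬p (i , sym eq))}
    (λ {i} {j} eq → inj (Fin.punchOut-injective (λ eq → ¬p (i , sym eq)) (λ eq → ¬p (j , sym eq)) eq)))
  (ℕ.<⇒≱ ℕ.≤-refl)

bounded-injection⇒surjective : ∀ {n} (σ : Fin n → ℕ) → (∀ i → σ i ℕ.< n) → (∀ {i j} → σ i ≡ σ j → i ≡ j) →
  ∀ {k} → k ℕ.< n → ∃ λ i → σ i ≡ k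
bounded-injection⇒surjective σ σ<n inj {k} k<n =
  let i , eq = injective⇒surjective (λ i → fromℕ< (σ<n i)) (λ {i} {j} eq → inj (Fin.fromℕ<-injective (σ i) (σ j) (σ<n i) (σ<n j) eq)) (fromℕ< k<n)
  in i , Fin.fromℕ<-injective (σ i) k (σ<n i) k<n eq

∑-injection : ∀ {n} (σ : Fin n → ℕ) → (∀ i → σ i ℕ.< n) → (∀ {i j} → σ i ≡ σ j → i ≡ j) →
  ∀ h → ∑[ i ∈ allFin n ] h (σ i) ≡ ∑ (upTo n) h
∑-injection {n} σ σ<n inj h = trans (sym (∑-map σ (allFin n) h))
  (∑-↭ (∼bag⇒↭ (unique∧set⇒bag (Unique.map⁺ inj (Unique.allFin⁺ n)) (Unique.upTo⁺ n) (mk⇔ fwd bwd))) h)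
  where
  fwd : ∀ {k} → k ∈ map σ (allFin n) → k ∈ upTo n
  fwd k∈ with i , _ , refl ← ∈-map⁻ σ k∈ = ∈-upTo⁺ (σ<n i)
  bwd : ∀ {k} → k ∈ upTo n → k ∈ map σ (allFin n)
  bwd k∈ with i , refl ← bounded-injection⇒surjective σ σ<n inj (∈-upTo⁻ k∈) = ∈-map⁺ σ (∈-allFin i)

-- The sums of an even function over s and over 0, …, p agree; equivalently,
-- the absolute values of s are a permutation of 0, …, p.
FoldsTo : ∀ {n} → ℕ → (Fin n → ℤ) → Set
FoldsTo {n} p s = ∀ (h : ℤ → ℤ) → (∀ x → h (- x) ≡ h x) → ∑[ i ∈ allFin n ] h (s i) ≡ ∑[ k ∈ upTo (suc p) ] h (+ k)

even-∣∣ : ∀ {h : ℤ → ℤ} → (∀ n → h (- n) ≡ h n) → ∀ n → h n ≡ h (+ ∣ n ∣)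
even-∣∣ even (+ n)    = refl
even-∣∣ even -[1+ n ] = even (+ suc n)

folds-to : ∀ {p} (s : Fin (suc p) → ℤ) → (∀ i → ∣ s i ∣ ℕ.≤ p) → (∀ {i j} → ∣ s i ∣ ≡ ∣ s j ∣ → i ≡ j) → FoldsTo p s
folds-to {p} s bound inj h even = trans (∑-ext (allFin (suc p)) (λ i → even-∣∣ even (s i)))
  (∑-injection (λ i → ∣ s i ∣) (λ i → s≤s (bound i)) inj (λ k → h (+ k)))

-- The window sum W x = f (x - p) + … + f (x + p) turns the sum of Φ over an
-- initial segment, which occurs in the box-sum formula, into a central
-- difference.
module EvenFunction (f : ℤ → ℤ) (even : ∀ n → f (- n) ≡ f n) (p : ℕ) where

  private
    g = + 2 * + p

  D : ℤ → ℤ → ℤ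
  D a b = f (a + b) + f (a - b)

  D-sym : ∀ a b → D a b ≡ D b a
  D-sym a b = cong₂ _+_ (cong f (ℤ.+-comm a b)) (trans (sym (even (a - b))) (cong f (lemma a b)))
    where
    lemma : ∀ a b → - (a - b) ≡ b - a
    lemma = solve-∀

  D-even : ∀ a b → D a (- b) ≡ D a b
  D-even a b = trans (ℤ.+-comm (f (a + - b)) (f (a - - b))) (cong (λ z → f (a + z) + f (a - b)) (ℤ.neg-involutive b))

  D-evenˡ : ∀ a b → D (- a) b ≡ D a b
  D-evenˡ a b = trans (D-sym (- a) b) (trans (D-even b a) (D-sym b a))

  W : ℤ → ℤ
  W x = (∑[ k ∈ upTo (suc p) ] D x (+ k)) - f x

  W-even : ∀ x → W (- x) ≡ W x
  W-even x = cong₂ _-_ (∑-ext (upTo (suc p)) (λ k → D-evenˡ x (+ k))) (even x)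

  -- Moving the window by 1 gains its new right end and loses its old left end. The induction is on
  -- the half-width, with `x` fixed.
  W-step : ∀ x → W (x + 1ℤ) ≡ W x + f (x + 1ℤ + + p) - f (x - + p)
  W-step x = go p
    where
    window : ℤ → ℕ → ℤ
    window x q = (∑[ k ∈ upTo (suc q) ] D x (+ k)) - f x
    go : ∀ q → window (x + 1ℤ) q ≡ window x q + f (x + 1ℤ + + q) - f (x - + q)
    go zero rewrite ℤ.+-identityʳ x | ℤ.+-identityʳ (x + 1ℤ) = lemma (f x) (f (x + 1ℤ))
      where
      lemma : ∀ a b → b + b + 0ℤ - b ≡ a + a + 0ℤ - a + b - a
      lemma = solve-∀
    go (suc q) = begin
      (∑[ k ∈ upTo (suc (suc q)) ] D (x + 1ℤ) (+ k)) - f (x + 1ℤ)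
        ≡⟨ cong (_- f (x + 1ℤ)) (∑-upTo-suc (suc q) (λ k → D (x + 1ℤ) (+ k))) ⟩
      (∑[ k ∈ upTo (suc q) ] D (x + 1ℤ) (+ k)) + D (x + 1ℤ) (+ suc q) - f (x + 1ℤ)
        ≡⟨ lemma₁ (∑[ k ∈ upTo (suc q) ] D (x + 1ℤ) (+ k)) (D (x + 1ℤ) (+ suc q)) (f (x + 1ℤ)) ⟩
      window (x + 1ℤ) q + D (x + 1ℤ) (+ suc q)
        ≡⟨ cong₂ _+_ (go q) (cong (λ z → f (x + 1ℤ + + suc q) + f z) x+1-) ⟩
      window x q + f (x + 1ℤ + + q) - f (x - + q) + (f (x + 1ℤ + + suc q) + f (x - + q))
        ≡⟨ cong (λ z → window x q + f z - f (x - + q) + (f (x + 1ℤ + + suc q) + f (x - + q))) x+1+ ⟩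
      window x q + f (x + + suc q) - f (x - + q) + (f (x + 1ℤ + + suc q) + f (x - + q))
        ≡⟨ lemma₂ (∑[ k ∈ upTo (suc q) ] D x (+ k)) (f x) (f (x + + suc q)) (f (x - + suc q)) (f (x - + q)) (f (x + 1ℤ + + suc q)) ⟩
      (∑[ k ∈ upTo (suc q) ] D x (+ k)) + D x (+ suc q) - f x + f (x + 1ℤ + + suc q) - f (x - + suc q)
        ≡⟨ cong (λ z → z - f x + f (x + 1ℤ + + suc q) - f (x - + suc q)) (∑-upTo-suc (suc q) (λ k → D x (+ k))) ⟨
      window x (suc q) + f (x + 1ℤ + + suc q) - f (x - + suc q)
        ∎
      where
      open ≡-Reasoning
      x+1- : x + 1ℤ - + suc q ≡ x - + q
      x+1- rewrite ℤ.pos-+ 1 q = lemma x (+ q)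
        where
        lemma : ∀ x q → x + 1ℤ - (1ℤ + q) ≡ x - q
        lemma = solve-∀
      x+1+ : x + 1ℤ + + q ≡ x + + suc q
      x+1+ rewrite ℤ.pos-+ 1 q = ℤ.+-assoc x 1ℤ (+ q)
      lemma₁ : ∀ a b c → a + b - c ≡ a - c + b
      lemma₁ = solve-∀
      lemma₂ : ∀ s a b b′ c d → s - a + b - c + (d + c) ≡ s + (b + b′) - a + d - b′
      lemma₂ = solve-∀

  Φ : ℤ → ℤ
  Φ n = f (n + g) + f (n - g) - + 2 * f n

  -- Raising `m` by 1 moves both windows. The near ends of their increments fall on `m` and `m + 1`,
  -- the far ones on `m + 1 + g` and `m - g`, which is the change of the left side. At `m = 0` the
  -- constant `f g - f 0ℤ` balances the left side, and the right side vanishes because `W` is even.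
  W-difference : ∀ m → f (+ m + g) - f (+ m) + (∑[ k ∈ upTo m ] Φ (+ k)) - (f g - f 0ℤ) ≡ W (+ m + + p) - W (+ m - + p)
  W-difference zero = trans
    (cong (λ z → f z - f 0ℤ + 0ℤ - (f g - f 0ℤ)) (ℤ.+-identityˡ g))
    (trans (lemma (f g) (f 0ℤ) (W (+ p)))
           (sym (cong₂ (λ a b → W a - b) (ℤ.+-identityˡ (+ p)) (trans (cong W (ℤ.+-identityˡ (- (+ p)))) (W-even (+ p))))))
    where
    lemma : ∀ a b c → a - b + 0ℤ - (a - b) ≡ c - c
    lemma = solve-∀
  W-difference (suc m) = begin
    f (+ suc m + g) - f (+ suc m) + (∑[ k ∈ upTo (suc m) ] Φ (+ k)) - (f g - f 0ℤ)
      ≡⟨ cong (λ z → f (+ suc m + g) - f (+ suc m) + z - (f g - f 0ℤ)) (∑-upTo-suc m (λ k → Φ (+ k))) ⟩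
    f (+ suc m + g) - f (+ suc m) + ((∑[ k ∈ upTo m ] Φ (+ k)) + Φ (+ m)) - (f g - f 0ℤ)
      ≡⟨ lemma (f (+ suc m + g)) (f (+ suc m)) (∑[ k ∈ upTo m ] Φ (+ k)) (f (+ m + g)) (f (+ m - g)) (f (+ m)) (f g - f 0ℤ) ⟩
    f (+ m + g) - f (+ m) + (∑[ k ∈ upTo m ] Φ (+ k)) - (f g - f 0ℤ) + (f (+ suc m + g) - f (+ suc m) - f (+ m) + f (+ m - g))
      ≡⟨ cong (_+ (f (+ suc m + g) - f (+ suc m) - f (+ m) + f (+ m - g))) (W-difference m) ⟩
    W (+ m + + p) - W (+ m - + p) + (f (+ suc m + g) - f (+ suc m) - f (+ m) + f (+ m - g))
      ≡⟨ cong₂ (λ u v → W (+ m + + p) - W (+ m - + p) + (f u - f (+ suc m) - f (+ m) + f v)) up (lemma₃ (+ m) (+ p)) ⟩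
    W (+ m + + p) - W (+ m - + p) + (f (+ m + + p + 1ℤ + + p) - f (+ suc m) - f (+ m) + f (+ m - + p - + p))
      ≡⟨ cong₂ (λ u v → W (+ m + + p) - W (+ m - + p) + (f (+ m + + p + 1ℤ + + p) - f u - f v + f (+ m - + p - + p))) mid (lemma₂ (+ m) (+ p)) ⟩
    W (+ m + + p) - W (+ m - + p) + (f (+ m + + p + 1ℤ + + p) - f (+ m - + p + 1ℤ + + p) - f (+ m + + p - + p) + f (+ m - + p - + p))
      ≡⟨ lemma₄ (W (+ m + + p)) (W (+ m - + p)) (f (+ m + + p + 1ℤ + + p)) (f (+ m - + p + 1ℤ + + p)) (f (+ m + + p - + p)) (f (+ m - + p - + p)) ⟩
    (W (+ m + + p) + f (+ m + + p + 1ℤ + + p) - f (+ m + + p - + p)) - (W (+ m - + p) + f (+ m - + p + 1ℤ + + p) - f (+ m - + p - + p))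
      ≡⟨ cong₂ _-_ (W-step (+ m + + p)) (W-step (+ m - + p)) ⟨
    W (+ m + + p + 1ℤ) - W (+ m - + p + 1ℤ)
      ≡⟨ cong₂ (λ u v → W u - W v) (sym (suc-out (+ p))) (sym (suc-out (- (+ p)))) ⟩
    W (+ suc m + + p) - W (+ suc m - + p)
      ∎
    where
    open ≡-Reasoning
    suc-out : ∀ x → + suc m + x ≡ + m + x + 1ℤ
    suc-out x rewrite ℤ.pos-+ 1 m = lemma₅ (+ m) x
      where
      lemma₅ : ∀ m x → 1ℤ + m + x ≡ m + x + 1ℤ
      lemma₅ = solve-∀
    up : + suc m + g ≡ + m + + p + 1ℤ + + p
    up = trans (suc-out g) (lemma₆ (+ m) (+ p))
      where
      lemma₆ : ∀ m p → m + + 2 * p + 1ℤ ≡ m + p + 1ℤ + p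
      lemma₆ = solve-∀
    mid : + suc m ≡ + m - + p + 1ℤ + + p
    mid = trans (ℤ.pos-+ 1 m) (lemma₇ (+ m) (+ p))
      where
      lemma₇ : ∀ m p → 1ℤ + m ≡ m - p + 1ℤ + p
      lemma₇ = solve-∀
    lemma : ∀ a b s c d e k → a - b + (s + (c + d - + 2 * e)) - k ≡ c - e + s - k + (a - b - e + d)
    lemma = solve-∀
    lemma₂ : ∀ m p → m ≡ m + p - p
    lemma₂ = solve-∀
    lemma₃ : ∀ m p → m - + 2 * p ≡ m - p - p
    lemma₃ = solve-∀
    lemma₄ : ∀ w v a b c d → w - v + (a - b - c + d) ≡ (w + a - c) - (v + b - d)
    lemma₄ = solve-∀

  -- The inner sum includes `j = i`, so that each coordinate enters through an even function and the
  -- folding hypothesis can be applied to both indices in turn.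
  Ψ : ∀ {n} → (Fin n → ℤ) → ℤ
  Ψ {n} s = ∑[ i ∈ allFin n ] (f (s i + s i) - + 2 * f (s i) + (∑[ j ∈ allFin n ] D (s i) (s j)))

  Ψ-folds : ∀ {n} (s : Fin n → ℤ) → FoldsTo p s →
    Ψ s ≡ ∑[ k ∈ upTo (suc p) ] (f (+ k + + k) - + 2 * f (+ k) + (∑[ l ∈ upTo (suc p) ] D (+ k) (+ l)))
  Ψ-folds {n} s folds = trans
    (∑-ext (allFin n) (λ i → cong (_+_ (f (s i + s i) - + 2 * f (s i))) (folds (D (s i)) (D-even (s i)))))
    (folds (λ x → f (x + x) - + 2 * f x + (∑[ l ∈ upTo (suc p) ] D x (+ l)))
      (λ x → cong₂ _+_ (cong₂ (λ a b → a - + 2 * b) (trans (cong f (sym (ℤ.neg-distrib-+ x x))) (even (x + x))) (even x))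
                       (∑-ext (upTo (suc p)) (λ l → D-evenˡ x (+ l)))))

  module _ {n : ℕ} (U : List ℕ) (r ρ : Fin n → ℤ)
    (telescope : ∀ (K : ℤ → ℤ) → ∑[ u ∈ U ] (K (+ u + + p) - K (+ u - + p)) ≡ ∑[ i ∈ allFin n ] (K (r i) - K (ρ i)))
    (folds : FoldsTo p ρ) where

    private
      I = allFin n

      L : ℤ → ℤ
      L x = ∑[ i ∈ I ] (D x (r i) - D x (ρ i))

      K : ℤ → ℤ
      K x = f (x + x) + + 2 * W x

      M : ℤ → ℤ
      M x = f (x + x) - + 2 * f x + ((∑[ i ∈ I ] D x (r i)) + (∑[ i ∈ I ] D x (ρ i)))

      -- The absolute values of `ρ` are `0, …, p`, so `W x` is the sum of the `D x (ρ i)` minus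
      -- `f x`. Adding twice this to `L x` reverses the sign of the part with `ρ`, and `r` and `ρ`
      -- enter `M` symmetrically.
      K+L : ∀ x → K x + L x ≡ M x
      K+L x = trans (cong₂ (λ a b → f (x + x) + + 2 * (a - f x) + b) (sym (folds (D x) (D-even x))) (∑-- I (λ i → D x (r i)) (λ i → D x (ρ i))))
        (lemma (f (x + x)) (f x) (∑[ i ∈ I ] D x (r i)) (∑[ i ∈ I ] D x (ρ i)))
        where
        lemma : ∀ a b c d → a + + 2 * (d - b) + (c - d) ≡ a - + 2 * b + (c + d)
        lemma = solve-∀

      ∑M : ∀ (s : Fin n → ℤ) → ∑[ i ∈ I ] M (s i) ≡ (∑[ i ∈ I ] (f (s i + s i) - + 2 * f (s i)))
        + ((∑[ j ∈ I ] ∑[ i ∈ I ] D (s j) (r i)) + (∑[ j ∈ I ] ∑[ i ∈ I ] D (s j) (ρ i)))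
      ∑M s = trans (∑-+ I _ _) (cong (_+_ (∑[ i ∈ I ] (f (s i + s i) - + 2 * f (s i)))) (∑-+ I _ _))

      -- `Φ` is a second difference with step `2p`, so `Φ (m + u) - Φ (m - u)` is a mixed second
      -- difference of `D` with step `p` in each of `m` and `u`. Telescoping in `u` leaves the
      -- difference in `m`.
      double : ∀ m → ∑[ u ∈ U ] (Φ (+ m + + u) - Φ (+ m - + u)) ≡ L (+ m + + p) - L (+ m - + p)
      double m = begin
        (∑[ u ∈ U ] (Φ (+ m + + u) - Φ (+ m - + u)))
          ≡⟨ ∑-ext U (λ u → second-difference (+ u)) ⟩
        (∑[ u ∈ U ] (K′ (+ u + + p) - K′ (+ u - + p)))
          ≡⟨ telescope K′ ⟩
        (∑[ i ∈ I ] (K′ (r i) - K′ (ρ i)))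
          ≡⟨ ∑-ext I (λ i → lemma (D x (r i)) (D y (r i)) (D x (ρ i)) (D y (ρ i))) ⟩
        (∑[ i ∈ I ] ((D x (r i) - D x (ρ i)) - (D y (r i) - D y (ρ i))))
          ≡⟨ ∑-- I _ _ ⟩
        L x - L y
          ∎
        where
        open ≡-Reasoning
        x = + m + + p
        y = + m - + p
        K′ : ℤ → ℤ
        K′ z = D x z - D y z
        lemma : ∀ a b c d → a - b - (c - d) ≡ (a - c) - (b - d)
        lemma = solve-∀
        e₁ : ∀ m n p → m + p + (n + p) ≡ m + n + + 2 * p
        e₁ = solve-∀
        e₂ : ∀ m n p → m + p - (n + p) ≡ m - n
        e₂ = solve-∀
        e₃ : ∀ m n p → m - p + (n + p) ≡ m + n
        e₃ = solve-∀
        e₄ : ∀ m n p → m - p - (n + p) ≡ m - n - + 2 * p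
        e₄ = solve-∀
        e₅ : ∀ m n p → m + p + (n - p) ≡ m + n
        e₅ = solve-∀
        e₆ : ∀ m n p → m + p - (n - p) ≡ m - n + + 2 * p
        e₆ = solve-∀
        e₇ : ∀ m n p → m - p + (n - p) ≡ m + n - + 2 * p
        e₇ = solve-∀
        e₈ : ∀ m n p → m - p - (n - p) ≡ m - n
        e₈ = solve-∀
        second-difference : ∀ n → Φ (+ m + n) - Φ (+ m - n) ≡ K′ (n + + p) - K′ (n - + p)
        second-difference n
          rewrite e₁ (+ m) n (+ p) | e₂ (+ m) n (+ p) | e₃ (+ m) n (+ p) | e₄ (+ m) n (+ p)
                | e₅ (+ m) n (+ p) | e₆ (+ m) n (+ p) | e₇ (+ m) n (+ p) | e₈ (+ m) n (+ p) =
          l (f (+ m + n + g)) (f (+ m + n - g)) (f (+ m + n)) (f (+ m - n + g)) (f (+ m - n - g)) (f (+ m - n))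
          where
          l : ∀ a b c a′ b′ c′ → a + b - + 2 * c - (a′ + b′ - + 2 * c′) ≡ a + c′ - (c + b′) - (c + a′ - (b + c′))
          l = solve-∀

    telescoped : ∀ (single : ℕ → ℤ) →
      (∀ m → single m ≡ + 2 * (f (+ m + g) - f (+ m)) + (f (+ m + + m + g) - f (+ m + + m - g)) + (+ 2 * (∑[ k ∈ upTo m ] Φ (+ k)) - + 2 * (f g - f 0ℤ))) →
      ∑ U single + (∑[ m ∈ U ] ∑[ u ∈ U ] (Φ (+ m + + u) - Φ (+ m - + u))) ≡ Ψ r - Ψ ρ
    telescoped single single≡ = begin
      ∑ U single + (∑[ m ∈ U ] ∑[ u ∈ U ] (Φ (+ m + + u) - Φ (+ m - + u)))
        ≡⟨ cong₂ _+_ (∑-ext U single-difference) (∑-ext U double) ⟩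
      (∑[ m ∈ U ] (K (+ m + + p) - K (+ m - + p))) + (∑[ m ∈ U ] (L (+ m + + p) - L (+ m - + p)))
        ≡⟨ cong₂ _+_ (telescope K) (telescope L) ⟩
      (∑[ i ∈ I ] (K (r i) - K (ρ i))) + (∑[ i ∈ I ] (L (r i) - L (ρ i)))
        ≡⟨ ∑-+ I _ _ ⟨
      (∑[ i ∈ I ] (K (r i) - K (ρ i) + (L (r i) - L (ρ i))))
        ≡⟨ ∑-ext I (λ i → trans (lemma (K (r i)) (K (ρ i)) (L (r i)) (L (ρ i))) (cong₂ _-_ (K+L (r i)) (K+L (ρ i)))) ⟩
      (∑[ i ∈ I ] (M (r i) - M (ρ i)))
        ≡⟨ trans (∑-- I (λ i → M (r i)) (λ i → M (ρ i))) (cong₂ _-_ (∑M r) (∑M ρ)) ⟩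
      Fr + (Drr + Drρ) - (Fρ + (Dρr + Dρρ))
        -- The mixed sums of `r` against `ρ` occur in both halves and cancel because `D` is
        -- symmetric.
        ≡⟨ cong (λ z → Fr + (Drr + Drρ) - (Fρ + (z + Dρρ))) (trans (∑-swap I I _) (∑-ext I λ i → ∑-ext I λ j → D-sym (ρ j) (r i))) ⟩
      Fr + (Drr + Drρ) - (Fρ + (Drρ + Dρρ))
        ≡⟨ lemma₂ Fr Drr Drρ Fρ Dρρ ⟩
      (Fr + Drr) - (Fρ + Dρρ)
        ≡⟨ cong₂ _-_ (∑-+ I _ _) (∑-+ I _ _) ⟨
      Ψ r - Ψ ρ
        ∎
      where
      open ≡-Reasoning
      Fr = ∑[ i ∈ I ] (f (r i + r i) - + 2 * f (r i))
      Fρ = ∑[ i ∈ I ] (f (ρ i + ρ i) - + 2 * f (ρ i))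
      Drr = ∑[ j ∈ I ] ∑[ i ∈ I ] D (r j) (r i)
      Drρ = ∑[ j ∈ I ] ∑[ i ∈ I ] D (r j) (ρ i)
      Dρr = ∑[ j ∈ I ] ∑[ i ∈ I ] D (ρ j) (r i)
      Dρρ = ∑[ j ∈ I ] ∑[ i ∈ I ] D (ρ j) (ρ i)
      lemma : ∀ a b c d → a - b + (c - d) ≡ (a + c) - (b + d)
      lemma = solve-∀
      lemma₂ : ∀ a b c d e → a + (b + c) - (d + (c + e)) ≡ a + b - (d + e)
      lemma₂ = solve-∀
      single-difference : ∀ m → single m ≡ K (+ m + + p) - K (+ m - + p)
      single-difference m = trans (single≡ m) (trans
        (rearrange (f (+ m + g)) (f (+ m)) (f (+ m + + m + g)) (f (+ m + + m - g)) (∑[ k ∈ upTo m ] Φ (+ k)) (f g - f 0ℤ))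
        (trans (cong (λ z → f (+ m + + m + g) - f (+ m + + m - g) + + 2 * z) (W-difference m))
          (trans (cong₂ (λ a b → f a - f b + + 2 * (W (+ m + + p) - W (+ m - + p))) (e₁ (+ m) (+ p)) (e₂ (+ m) (+ p)))
            (collect (f (+ m + + p + (+ m + + p))) (f (+ m - + p + (+ m - + p))) (W (+ m + + p)) (W (+ m - + p))))))
        where
        rearrange : ∀ a b c d s k → + 2 * (a - b) + (c - d) + (+ 2 * s - + 2 * k) ≡ c - d + + 2 * (a - b + s - k)
        rearrange = solve-∀
        e₁ : ∀ m p → m + m + + 2 * p ≡ m + p + (m + p)
        e₁ = solve-∀
        e₂ : ∀ m p → m + m - + 2 * p ≡ m - p + (m - p)
        e₂ = solve-∀
        collect : ∀ a b c d → a - b + + 2 * (c - d) ≡ a + + 2 * c - (b + + 2 * d)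
        collect = solve-∀

  half : ∀ {n} → (Fin n → ℤ) → ℤ
  half {n} s = (∑[ i ∈ allFin n ] (f (+ 2 * s i) - f (s i))) + (∑[ i ∈ allFin n ] ∑[ j ∈ after i ] D (s i) (s j))

  -- In `Ψ` every unordered pair counts twice. The term with `j = i` is `f (2 sᵢ) + f 0`: its first
  -- part raises the coefficient of `f (2 sᵢ)` to 2, its second part is subtracted.
  double-half : ∀ {n} (s : Fin n → ℤ) → + 2 * half s ≡ Ψ s - (∑[ i ∈ allFin n ] f 0ℤ)
  double-half {n} s = begin
    + 2 * half s
      ≡⟨ ℤ.*-distribˡ-+ (+ 2) (∑[ i ∈ I ] (f (+ 2 * s i) - f (s i))) _ ⟩
    + 2 * (∑[ i ∈ I ] (f (+ 2 * s i) - f (s i))) + + 2 * (∑[ i ∈ I ] ∑[ j ∈ after i ] D (s i) (s j))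
      ≡⟨ cong₂ _+_ (sym (∑-* (+ 2) I _)) (cong (+ 2 *_) (∑-ext I λ i → ∑-filter (i Fin.<?_) I (λ j → D (s i) (s j)))) ⟩
    (∑[ i ∈ I ] + 2 * (f (+ 2 * s i) - f (s i))) + + 2 * (∑[ i ∈ I ] ∑[ j ∈ I ] 𝟙 (i Fin.<? j) * D (s i) (s j))
      ≡⟨ cong (_+_ (∑[ i ∈ I ] + 2 * (f (+ 2 * s i) - f (s i)))) (∑∑-symmetrise I _) ⟩
    (∑[ i ∈ I ] + 2 * (f (+ 2 * s i) - f (s i))) + (∑[ i ∈ I ] ∑[ j ∈ I ] (𝟙 (i Fin.<? j) * D (s i) (s j) + 𝟙 (j Fin.<? i) * D (s j) (s i)))
      ≡⟨ cong (_+_ (∑[ i ∈ I ] + 2 * (f (+ 2 * s i) - f (s i)))) (∑-ext I λ i → trans (∑-ext I (off-diagonal i))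
           (trans (∑-- I _ _) (cong (λ z → (∑[ j ∈ I ] D (s i) (s j)) - z) (∑-δ Fin._≟_ (Unique.allFin⁺ n) (∈-allFin i) (λ j → D (s j) (s j)))))) ⟩
    (∑[ i ∈ I ] + 2 * (f (+ 2 * s i) - f (s i))) + (∑[ i ∈ I ] ((∑[ j ∈ I ] D (s i) (s j)) - D (s i) (s i)))
      ≡⟨ ∑-+ I _ _ ⟨
    (∑[ i ∈ I ] (+ 2 * (f (+ 2 * s i) - f (s i)) + ((∑[ j ∈ I ] D (s i) (s j)) - D (s i) (s i))))
      ≡⟨ ∑-ext I pointwise ⟩
    (∑[ i ∈ I ] (f (s i + s i) - + 2 * f (s i) + (∑[ j ∈ I ] D (s i) (s j)) - f 0ℤ))
      ≡⟨ ∑-- I _ _ ⟩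
    Ψ s - (∑[ i ∈ I ] f 0ℤ)
      ∎
    where
    open ≡-Reasoning
    I = allFin n
    off-diagonal : ∀ i j → 𝟙 (i Fin.<? j) * D (s i) (s j) + 𝟙 (j Fin.<? i) * D (s j) (s i) ≡ D (s i) (s j) - 𝟙 (j Fin.≟ i) * D (s j) (s j)
    off-diagonal i j with Fin.<-cmp i j
    ... | tri< i<j i≢j j≮i rewrite 𝟙-yes (i Fin.<? j) i<j | 𝟙-no (j Fin.<? i) j≮i | 𝟙-no (j Fin.≟ i) (i≢j ∘ sym) =
      l (D (s i) (s j)) (D (s j) (s i)) (D (s j) (s j))
      where
      l : ∀ a b c → 1ℤ * a + 0ℤ * b ≡ a - 0ℤ * c
      l = solve-∀
    ... | tri≈ i≮i refl _ rewrite 𝟙-no (i Fin.<? i) i≮i | 𝟙-yes (i Fin.≟ i) refl = l (D (s i) (s i))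
      where
      l : ∀ a → 0ℤ * a + 0ℤ * a ≡ a - 1ℤ * a
      l = solve-∀
    ... | tri> i≮j i≢j j<i rewrite 𝟙-no (i Fin.<? j) i≮j | 𝟙-yes (j Fin.<? i) j<i | 𝟙-no (j Fin.≟ i) (i≢j ∘ sym) | D-sym (s j) (s i) =
      l (D (s i) (s j)) (D (s j) (s j))
      where
      l : ∀ a c → 0ℤ * a + 1ℤ * a ≡ a - 0ℤ * c
      l = solve-∀
    pointwise : ∀ i → + 2 * (f (+ 2 * s i) - f (s i)) + ((∑[ j ∈ I ] D (s i) (s j)) - D (s i) (s i))
                    ≡ f (s i + s i) - + 2 * f (s i) + (∑[ j ∈ I ] D (s i) (s j)) - f 0ℤ
    pointwise i = trans (cong₂ (λ a b → + 2 * (f a - f (s i)) + ((∑[ j ∈ I ] D (s i) (s j)) - (f (s i + s i) + f b))) (two (s i)) (ℤ.+-inverseʳ (s i)))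
      (l (f (s i + s i)) (f (s i)) (∑[ j ∈ I ] D (s i) (s j)) (f 0ℤ))
      where
      two : ∀ x → + 2 * x ≡ x + x
      two = solve-∀
      l : ∀ a b c d → + 2 * (a - b) + (c - (a + d)) ≡ a - + 2 * b + c - d
      l = solve-∀

-- The residue classes of the border modulo g

word-vertical : ∀ μ {x} → word μ x ≡ 0F → IsVertical μ x
word-vertical μ {x} eq = lemma (isVertical? μ x) eq
  where
  lemma : ∀ {P : Set} (P? : Dec P) → (if does P? then 0F else 1F) ≡ Fin.zero {1} → P
  lemma (yes p) _ = p

vertical-word : ∀ μ {x} → IsVertical μ x → word μ x ≡ 0F
vertical-word μ {x} = if-yes (isVertical? μ x)

nth-replicate : ∀ m n {i} → i ℕ.< m → nth (replicate m n) i ≡ n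
nth-replicate (suc m) n {zero}  _         = refl
nth-replicate (suc m) n {suc i} (s≤s i<m) = nth-replicate m n i<m

nth-replicate-beyond : ∀ m n {i} → m ℕ.≤ i → nth (replicate m n) i ≡ 0
nth-replicate-beyond zero    n _         = refl
nth-replicate-beyond (suc m) n (s≤s m≤i) = nth-replicate-beyond m n m≤i

rectangle-‼ : ∀ m n {i} → suc i ℕ.≤ m → rectangle m n ‼ suc i ≡ n
rectangle-‼ m zero    _   = refl
rectangle-‼ m (suc n) i<m = nth-replicate m (suc n) i<m

rectangle-‼-beyond : ∀ m n {i} → m ℕ.≤ i → rectangle m n ‼ suc i ≡ 0
rectangle-‼-beyond m zero    _   = refl
rectangle-‼-beyond m (suc n) m≤i = nth-replicate-beyond m (suc n) m≤i

-- The vertical steps of `rectangle m n`: the equal parts give a run of length `m` that ends at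
-- `n - 1`, the empty rows give everything below `- m`. For `n = 0` the two runs join, in agreement
-- with the empty partition.
RectangleStep : ℕ → ℕ → ℤ → Set
RectangleStep m n x = (+ n - + m ≤ x × x < + n) ⊎ x < - (+ m)

i<n⇒∃ : ∀ {i j} → i < j → ∃ λ k → 1 ℕ.≤ k × i ≡ j - + k
i<n⇒∃ {i} {j} i<j with k , eq ← ≤⇒∃ (gap i<j) = suc k , s≤s z≤n , trans (lemma i j) (cong (λ z → j - (1ℤ + z)) (trans eq (ℤ.+-identityˡ (+ k))))
  where
  lemma : ∀ i j → i ≡ j - (1ℤ + (j - i - 1ℤ))
  lemma = solve-∀

rectangle-vertical : ∀ m n {x} → IsVertical (rectangle m n) x → RectangleStep m n x
rectangle-vertical m n (suc i , _ , refl) with suc i ℕ.≤? m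
... | yes i<m rewrite rectangle-‼ m n i<m = inj₁
  ( from-gap≤ (ℕ-gap i<m) (lemma (+ n) (+ m) (+ suc i))
  , from-gap (ℕ-gap (s≤s (z≤n {i}))) (lemma₂ (+ n) (+ suc i)))
  where
  lemma : ∀ n m i → m - i ≡ n - i - (n - m)
  lemma = solve-∀
  lemma₂ : ∀ n i → i - 1ℤ ≡ n - (n - i) - 1ℤ
  lemma₂ = solve-∀
... | no i≮m rewrite rectangle-‼-beyond m n (ℕ.≮⇒≥ i≮m) = inj₂
  (from-gap (gap (+<+ (ℕ.≰⇒> i≮m))) (lemma (+ m) (+ suc i)))
  where
  lemma : ∀ m i → i - m - 1ℤ ≡ - m - (0ℤ - i) - 1ℤ
  lemma = solve-∀

vertical-rectangle : ∀ m n {x} → RectangleStep m n x → IsVertical (rectangle m n) x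
vertical-rectangle m n (inj₁ (lower , upper)) with suc i , 1≤i , refl ← i<n⇒∃ upper =
  suc i , 1≤i , cong (λ z → + z - + suc i) (sym (rectangle-‼ m n (ℤ.drop‿+≤+ (from-gap≤ (ℤ.i≤j⇒0≤j-i lower) (lemma (+ n) (+ m) (+ suc i))))))
  where
  lemma : ∀ n m i → n - i - (n - m) ≡ m - i
  lemma = solve-∀
vertical-rectangle m n (inj₂ upper) with suc k , _ , refl ← i<n⇒∃ upper =
  suc (m ℕ.+ k) , s≤s z≤n , trans eq (cong (λ z → + z - + suc (m ℕ.+ k)) (sym (rectangle-‼-beyond m n (ℕ.m≤m+n m k))))
  where
  lemma : ∀ m k → - m - (1ℤ + k) ≡ 0ℤ - (1ℤ + (m + k))
  lemma = solve-∀
  eq : - (+ m) - + suc k ≡ 0ℤ - + suc (m ℕ.+ k)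
  eq = trans (cong (λ z → - (+ m) - z) (ℤ.pos-+ 1 k)) (trans (lemma (+ m) (+ k))
    (cong (λ z → 0ℤ - z) (sym (trans (ℤ.pos-+ 1 (m ℕ.+ k)) (cong (_+_ 1ℤ) (ℤ.pos-+ m k))))))

0≤-* : ∀ {i j} → 0ℤ ≤ i → 0ℤ ≤ j → 0ℤ ≤ i * j
0≤-* {i} {j} 0≤i 0≤j rewrite sym (ℤ.0≤i⇒+∣i∣≡i 0≤i) | sym (ℤ.0≤i⇒+∣i∣≡i 0≤j) = subst (0ℤ ≤_) (ℤ.pos-* ∣ i ∣ ∣ j ∣) (+≤+ z≤n)

¬0≤-1 : ¬ 0ℤ ≤ -1ℤ
¬0≤-1 ()

2*-nonneg : ∀ {a} → 0ℤ ≤ a + a → 0ℤ ≤ a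
2*-nonneg {a} 0≤2a = ℤ.≮⇒≥ λ a<0 → ¬0≤-1 (subst (0ℤ ≤_) (lemma a) (0≤-+ 0≤2a (0≤-+ (gap a<0) (0≤-+ (gap a<0) (+≤+ (z≤n {1}))))))
  where
  lemma : ∀ a → a + a + (0ℤ - a - 1ℤ + (0ℤ - a - 1ℤ + 1ℤ)) ≡ -1ℤ
  lemma = solve-∀

odd≢0 : ∀ q → q + q + 1ℤ ≢ 0ℤ
odd≢0 q eq = ¬0≤-1 (subst (0ℤ ≤_) (trans (lemma₂ q) (cong (_- 1ℤ) eq)) (0≤-+ q≥0 q≥0))
  where
  lemma₂ : ∀ q → q + q ≡ q + q + 1ℤ - 1ℤ
  lemma₂ = solve-∀
  lemma₃ : ∀ q → 0ℤ - q - 1ℤ + (0ℤ - q - 1ℤ) ≡ - (q + q + 1ℤ) - 1ℤ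
  lemma₃ = solve-∀
  q≥0 : 0ℤ ≤ q
  q≥0 = ℤ.≮⇒≥ λ q<0 → ¬0≤-1 (subst (0ℤ ≤_) (trans (lemma₃ q) (cong (λ z → - z - 1ℤ) eq)) (0≤-+ (gap q<0) (gap q<0)))

-- Residue classes and their reflection

module Residues (g : ℕ) where

  infix 7 _∙g+_
  _∙g+_ : ℤ → ℕ → ℤ
  q ∙g+ c = q * + g + + c

  ∙g+-mono : ∀ {q q′ c} c′ → c ℕ.< g → q < q′ → q ∙g+ c < q′ ∙g+ c′
  ∙g+-mono {q} {q′} {c} c′ c<g q<q′ = from-gap (0≤-+ (0≤-+ (0≤-* (gap q<q′) (+≤+ (z≤n {g}))) (gap (+<+ c<g))) (+≤+ (z≤n {c′})))
    (lemma q q′ (+ g) (+ c) (+ c′))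
    where
    lemma : ∀ q q′ g c c′ → (q′ - q - 1ℤ) * g + (g - c - 1ℤ) + c′ ≡ q′ * g + c′ - (q * g + c) - 1ℤ
    lemma = solve-∀

  ∙g+-injective : ∀ {q q′ c c′} → c ℕ.< g → c′ ℕ.< g → q ∙g+ c ≡ q′ ∙g+ c′ → q ≡ q′ × c ≡ c′
  ∙g+-injective {q} {q′} {c} {c′} c< c′< eq with ℤ.<-cmp q q′
  ... | tri< q< _ _ = contradiction eq (ℤ.<⇒≢ (∙g+-mono c′ c< q<))
  ... | tri> _ _ q> = contradiction (sym eq) (ℤ.<⇒≢ (∙g+-mono c c′< q>))
  ... | tri≈ _ refl _ = refl , ℤ.+-injective (+-cancelˡ (q * + g) _ _ eq)

  ∙g+-cancel-≤ : ∀ {q q′ c} → c ℕ.< g → q ∙g+ c ≤ q′ ∙g+ c → q ≤ q′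
  ∙g+-cancel-≤ {c = c} c< le = ℤ.≮⇒≥ λ q′<q → ℤ.<⇒≱ (∙g+-mono c c< q′<q) le

module Classes (p : ℕ) (1≤p : 1 ℕ.≤ p) (g : ℕ) (g≡2p : g ≡ 2 ℕ.* p) (μ : Partition) (legs : LegsExceedArms μ) where

  open Residues g public
  open BoxSum μ legs using (vertical-0; vertical⇒¬vertical-neg; ¬vertical-neg⇒vertical)

  +g : + g ≡ + p + + p
  +g = trans (cong +_ g≡2p) (trans (ℤ.pos-* 2 p) (lemma (+ p)))
    where
    lemma : ∀ p → + 2 * p ≡ p + p
    lemma = solve-∀

  At : ℕ → ℤ → Set
  At c q = IsVertical μ (q ∙g+ c)

  at? : ∀ c q → Dec (At c q)
  at? c q = isVertical? μ (q ∙g+ c)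

  position : ℕ → ℤ → ℤ
  position c q = q ∙g+ c + 1ℤ

  private
    cancel-1 : ∀ x → x + 1ℤ - 1ℤ ≡ x
    cancel-1 = solve-∀

  at⇒vertical : ∀ {c q x} → x ≡ position c q → At c q → Vertical μ x
  at⇒vertical {c} {q} refl = subst (IsVertical μ) (sym (cancel-1 (q ∙g+ c)))

  vertical⇒at : ∀ {c q x} → x ≡ position c q → Vertical μ x → At c q
  vertical⇒at {c} {q} refl = subst (IsVertical μ) (cancel-1 (q ∙g+ c))

  vertical⇒¬ : ∀ {x} → x ≢ 0ℤ → Vertical μ x → ¬ Vertical μ (- x)
  vertical⇒¬ {+ zero}    x≢0 = contradiction refl x≢0
  vertical⇒¬ {+ suc n}   _ v = vertical⇒¬vertical-neg (s≤s z≤n) v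
  vertical⇒¬ { -[1+ n ]} _ v v′ = vertical⇒¬vertical-neg {suc n} (s≤s z≤n) v′ v

  ¬⇒vertical : ∀ {x} → x ≢ 0ℤ → ¬ Vertical μ x → Vertical μ (- x)
  ¬⇒vertical {+ zero}    x≢0 = contradiction refl x≢0
  ¬⇒vertical { -[1+ n ]} _ ¬v = ¬vertical-neg⇒vertical {suc n} (s≤s z≤n) ¬v
  ¬⇒vertical {+ suc n}   _ ¬v with vertical? μ (- (+ suc n))
  ... | yes v  = v
  ... | no ¬v′ = contradiction (¬vertical-neg⇒vertical (s≤s z≤n) ¬v′) ¬v

  -- The antisymmetry for two indices at opposite positions, away from position 0, which is its own
  -- mirror image.
  module Reflect {c c′ q q′} (opposite : - position c q ≡ position c′ q′) (nonzero : position c q ≢ 0ℤ) where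

    at⇒¬at : At c q → ¬ At c′ q′
    at⇒¬at a a′ = vertical⇒¬ nonzero (at⇒vertical {c} {q} refl a) (at⇒vertical {c′} {q′} opposite a′)

    ¬at⇒at : ¬ At c q → At c′ q′
    ¬at⇒at ¬a = vertical⇒at {c′} {q′} opposite (¬⇒vertical nonzero (¬a ∘ vertical⇒at {c} {q} refl))

  private
    -- The positions of this class are the odd multiples of `p`. It is thus its own opposite, with
    -- `q ↦ - 1 - q`, and avoids position 0.
    module Middle {c} (c≡ : suc c ≡ p) where

      position-middle : ∀ q → position c q ≡ + p * (q + q + 1ℤ)
      position-middle q = trans (cong (λ z → q * z + + c + 1ℤ) (trans +g (cong₂ _+_ +p +p)))
        (trans (lemma q (+ c)) (cong (_* (q + q + 1ℤ)) (sym +p)))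
        where
        +p : + p ≡ 1ℤ + + c
        +p = trans (cong +_ (sym c≡)) (ℤ.pos-+ 1 c)
        lemma : ∀ q c → q * (1ℤ + c + (1ℤ + c)) + c + 1ℤ ≡ (1ℤ + c) * (q + q + 1ℤ)
        lemma = solve-∀

      nonzero : ∀ q → position c q ≢ 0ℤ
      nonzero q eq with ℤ.i*j≡0⇒i≡0∨j≡0 (+ p) (trans (sym (position-middle q)) eq)
      ... | inj₁ p≡0 with refl ← ℤ.+-injective p≡0 = contradiction 1≤p (λ ())
      ... | inj₂ odd = odd≢0 q odd

      opposite : ∀ q → - position c q ≡ position c (- 1ℤ - q)
      opposite q = trans (cong -_ (position-middle q)) (trans (lemma (+ p) q) (sym (position-middle (- 1ℤ - q))))
        where
        lemma : ∀ p q → - (p * (q + q + 1ℤ)) ≡ p * (- 1ℤ - q + (- 1ℤ - q) + 1ℤ)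
        lemma = solve-∀

      module Mirror q = Reflect {c} {c} {q} { - 1ℤ - q} (opposite q) (nonzero q)

    -- The positions of this class are the multiples of `g`. It is its own opposite, with
    -- `q ↦ - 2 - q`, and contains position 0 at `q = - 1`, where reflection says nothing.
    module Last {c} (c≡ : suc c ≡ g) where

      position-last : ∀ q → position c q ≡ (q + 1ℤ) * + g
      position-last q = trans (cong (λ z → q * z + + c + 1ℤ) g≡) (trans (lemma q (+ c)) (cong ((q + 1ℤ) *_) (sym g≡)))
        where
        g≡ : + g ≡ 1ℤ + + c
        g≡ = trans (cong +_ (sym c≡)) (ℤ.pos-+ 1 c)
        lemma : ∀ q c → q * (1ℤ + c) + c + 1ℤ ≡ (q + 1ℤ) * (1ℤ + c)
        lemma = solve-∀

      nonzero : ∀ {q} → q + 1ℤ ≢ 0ℤ → position c q ≢ 0ℤ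
      nonzero {q} q≢ eq with ℤ.i*j≡0⇒i≡0∨j≡0 (q + 1ℤ) (trans (sym (position-last q)) eq)
      ... | inj₁ q≡  = q≢ q≡
      ... | inj₂ g≡0 with () ← trans c≡ (ℤ.+-injective g≡0)

      opposite : ∀ q → - position c q ≡ position c (- (+ 2) - q)
      opposite q = trans (cong -_ (position-last q)) (trans (lemma (+ g) q) (sym (position-last (- (+ 2) - q))))
        where
        lemma : ∀ g q → - ((q + 1ℤ) * g) ≡ (- (+ 2) - q + 1ℤ) * g
        lemma = solve-∀

      module Mirror q (q≢ : q + 1ℤ ≢ 0ℤ) = Reflect {c} {c} {q} { - (+ 2) - q} (opposite q) (nonzero {q} q≢)

      at-last : At c -1ℤ
      at-last = vertical⇒at {c} { -1ℤ} (sym (trans (position-last -1ℤ) refl)) vertical-0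

  -- The symmetry of the word forces the squares and rectangles of the quotient
  -- to sit in μ without a shift of indices.
  middle-shift : ∀ {c} → suc c ≡ p → ∀ m a → (∀ q → At c q ⇔ RectangleStep m m (q - a)) → a ≡ 0ℤ
  middle-shift {c} c≡ m a iff = ℤ.≤-antisym a≤0 0≤a
    where
    open Middle c≡
    module Iff q = Equivalence (iff q)
    0≤m : 0ℤ ≤ + m
    0≤m = +≤+ z≤n
    -- In the word of the square the lowest horizontal step is `- m` and the highest vertical one is
    -- `m - 1`. Reflecting the first bounds `a` from below, reflecting the second bounds it from
    -- above.
    ¬at : ¬ At c (a - + m)
    ¬at at with Iff.to (a - + m) at
    ... | inj₁ (lo , hi) = ¬0≤-1 (subst (0ℤ ≤_) (lemma a (+ m)) (0≤-+ (ℤ.i≤j⇒0≤j-i lo) (0≤-+ (ℤ.i≤j⇒0≤j-i lo) (gap hi))))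
      where
      lemma : ∀ a m → a - m - a - (m - m) + (a - m - a - (m - m) + (m - (a - m - a) - 1ℤ)) ≡ -1ℤ
      lemma = solve-∀
    ... | inj₂ lt = ¬0≤-1 (subst (0ℤ ≤_) (lemma a (+ m)) (gap lt))
      where
      lemma : ∀ a m → - m - (a - m - a) - 1ℤ ≡ -1ℤ
      lemma = solve-∀
    0≤a : 0ℤ ≤ a
    0≤a with Iff.to (- 1ℤ - (a - + m)) (Mirror.¬at⇒at (a - + m) ¬at)
    ... | inj₁ (_ , hi) = 2*-nonneg (subst (0ℤ ≤_) (lemma a (+ m)) (gap hi))
      where
      lemma : ∀ a m → m - (- 1ℤ - (a - m) - a) - 1ℤ ≡ a + a
      lemma = solve-∀
    ... | inj₂ lt = 2*-nonneg (subst (0ℤ ≤_) (lemma a (+ m)) (0≤-+ (gap lt) (0≤-+ 0≤m 0≤m)))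
      where
      lemma : ∀ a m → - m - (- 1ℤ - (a - m) - a) - 1ℤ + (m + m) ≡ a + a
      lemma = solve-∀
    top : ∀ m → RectangleStep m m (+ m - 1ℤ)
    top zero    = inj₂ -<+
    top (suc m) = inj₁ (ℤ.≤-trans (ℤ.≤-reflexive (ℤ.+-inverseʳ (+ suc m))) (+≤+ z≤n) , +<+ ℕ.≤-refl)
    at-top : At c (a + (+ m - 1ℤ))
    at-top = Iff.from (a + (+ m - 1ℤ)) (subst (RectangleStep m m) (lemma a (+ m - 1ℤ)) (top m))
      where
      lemma : ∀ a x → x ≡ a + x - a
      lemma = solve-∀
    a≤0 : a ≤ 0ℤ
    a≤0 = ℤ.≮⇒≥ λ 0<a → Mirror.at⇒¬at (a + (+ m - 1ℤ)) at-top
      (Iff.from (- 1ℤ - (a + (+ m - 1ℤ))) (inj₂ (from-gap (0≤-+ (gap 0<a) (0≤-+ (gap 0<a) (+≤+ (z≤n {1})))) (lemma a (+ m)))))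
      where
      lemma : ∀ a m → a - 0ℤ - 1ℤ + (a - 0ℤ - 1ℤ + 1ℤ) ≡ - m - (- 1ℤ - (a + (m - 1ℤ)) - a) - 1ℤ
      lemma = solve-∀

  last-shift : ∀ {c} → suc c ≡ g → ∀ m a → (∀ q → At c q ⇔ RectangleStep (suc m) m (q - a)) → a ≡ 0ℤ
  last-shift {c} c≡ m a iff = ℤ.≤-antisym a≤0 0≤a
    where
    open Last c≡
    module Iff q = Equivalence (iff q)
    0≤m : 0ℤ ≤ + m
    0≤m = +≤+ z≤n
    suc-m : + suc m ≡ 1ℤ + + m
    suc-m = ℤ.pos-+ 1 m
    Step : ℤ → Set
    Step x = (- 1ℤ ≤ x × x < + m) ⊎ x < - (1ℤ + + m)
    to : ∀ q → At c q → Step (q - a)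
    to q at with Iff.to q at
    ... | inj₁ (lo , hi) = inj₁ (ℤ.≤-trans (ℤ.≤-reflexive (trans (lemma (+ m)) (cong (λ z → + m - z) (sym suc-m)))) lo , hi)
      where
      lemma : ∀ m → - 1ℤ ≡ m - (1ℤ + m)
      lemma = solve-∀
    ... | inj₂ lt = inj₂ (subst (λ z → q - a < - z) suc-m lt)
    from : ∀ q → Step (q - a) → At c q
    from q (inj₁ (lo , hi)) = Iff.from q (inj₁ (ℤ.≤-trans (ℤ.≤-reflexive (trans (cong (λ z → + m - z) suc-m) (lemma (+ m)))) lo , hi))
      where
      lemma : ∀ m → m - (1ℤ + m) ≡ - 1ℤ
      lemma = solve-∀
    from q (inj₂ lt) = Iff.from q (inj₂ (subst (λ z → q - a < - z) (sym suc-m) lt))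
    a≤0 : a ≤ 0ℤ
    a≤0 = ℤ.≮⇒≥ λ 0<a → Mirror.at⇒¬at (a + (+ m - 1ℤ))
        ((λ eq → ¬0≤-1 (subst (0ℤ ≤_) (trans (lemma₁ a (+ m)) (cong (_- 1ℤ) eq)) (0≤-+ (gap 0<a) 0≤m))))
        (from (a + (+ m - 1ℤ)) (inj₁ (from-gap≤ 0≤m (lemma₂ a (+ m)) , from-gap (+≤+ (z≤n {0})) (lemma₃ a (+ m)))))
        (from (- (+ 2) - (a + (+ m - 1ℤ))) (inj₂ (from-gap (0≤-+ (gap 0<a) (0≤-+ (gap 0<a) (+≤+ (z≤n {1})))) (lemma₄ a (+ m)))))
      where
      lemma₁ : ∀ a m → a - 0ℤ - 1ℤ + m ≡ a + (m - 1ℤ) + 1ℤ - 1ℤ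
      lemma₁ = solve-∀
      lemma₂ : ∀ a m → m ≡ a + (m - 1ℤ) - a - - 1ℤ
      lemma₂ = solve-∀
      lemma₃ : ∀ a m → 0ℤ ≡ m - (a + (m - 1ℤ) - a) - 1ℤ
      lemma₃ = solve-∀
      lemma₄ : ∀ a m → a - 0ℤ - 1ℤ + (a - 0ℤ - 1ℤ + 1ℤ) ≡ - (1ℤ + m) - (- (+ 2) - (a + (m - 1ℤ)) - a) - 1ℤ
      lemma₄ = solve-∀
    0≤a : 0ℤ ≤ a
    0≤a = ℤ.≮⇒≥ negative
      where
      negative : ¬ a < 0ℤ
      -- With `a < 0`, the vertical step at position 0 forces `m ≥ 1` through `hi`. This excludes
      -- the empty rectangle, whose word has no horizontal step at `- (1 + m)`; for `m ≥ 1` that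
      -- step is horizontal and its reflection gives the contradiction.
      negative a<0 with to -1ℤ at-last
      ... | inj₂ lt = ¬0≤-1 (subst (0ℤ ≤_) (lemma a (+ m)) (0≤-+ (gap lt) (0≤-+ (gap a<0) (0≤-+ 0≤m (+≤+ (z≤n {1}))))))
        where
        lemma : ∀ a m → - (1ℤ + m) - (-1ℤ - a) - 1ℤ + (0ℤ - a - 1ℤ + (m + 1ℤ)) ≡ -1ℤ
        lemma = solve-∀
      ... | inj₁ (_ , hi) with to (- (+ 2) - (a - (1ℤ + + m))) (Mirror.¬at⇒at (a - (1ℤ + + m)) q≢ ¬at)
        where
        lemma₁ : ∀ a m → a - (1ℤ + m) - a - - 1ℤ + (m - (-1ℤ - a) - 1ℤ + (0ℤ - a - 1ℤ)) ≡ -1ℤ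
        lemma₁ = solve-∀
        lemma₂ : ∀ a m → - (1ℤ + m) - (a - (1ℤ + m) - a) - 1ℤ ≡ -1ℤ
        lemma₂ = solve-∀
        ¬at : ¬ At c (a - (1ℤ + + m))
        ¬at at with to (a - (1ℤ + + m)) at
        ... | inj₁ (lo , _) = ¬0≤-1 (subst (0ℤ ≤_) (lemma₁ a (+ m)) (0≤-+ (ℤ.i≤j⇒0≤j-i lo) (0≤-+ (gap hi) (gap a<0))))
        ... | inj₂ lt = ¬0≤-1 (subst (0ℤ ≤_) (lemma₂ a (+ m)) (gap lt))
        lemma₃ : ∀ a m → 0ℤ - a - 1ℤ + m ≡ - (a - (1ℤ + m) + 1ℤ) - 1ℤ
        lemma₃ = solve-∀
        q≢ : a - (1ℤ + + m) + 1ℤ ≢ 0ℤ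
        q≢ eq = ¬0≤-1 (subst (0ℤ ≤_) (trans (lemma₃ a (+ m)) (cong (λ z → - z - 1ℤ) eq)) (0≤-+ (gap a<0) 0≤m))
      ... | inj₁ (_ , hi′) = ℤ.<⇒≱ a<0 (2*-nonneg (subst (0ℤ ≤_) (lemma a (+ m)) (gap hi′)))
        where
        lemma : ∀ a m → m - (- (+ 2) - (a - (1ℤ + m)) - a) - 1ℤ ≡ a + a
        lemma = solve-∀
      ... | inj₂ lt = ℤ.<⇒≱ a<0 (2*-nonneg (subst (0ℤ ≤_) (lemma a (+ m)) (0≤-+ (gap lt) (0≤-+ 0≤m (0≤-+ 0≤m (+≤+ (z≤n {1})))))))
        where
        lemma : ∀ a m → - (1ℤ + m) - (- (+ 2) - (a - (1ℤ + m)) - a) - 1ℤ + (m + (m + 1ℤ)) ≡ a + a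
        lemma = solve-∀

  -- The only horizontal steps below a vertical one run from `- m` to `n - m - 1`, which is negative
  -- when `n ≤ m`.
  rectangle-downward : ∀ {m n q q′} → n ℕ.≤ m → 0ℤ ≤ q′ → q′ ≤ q → RectangleStep m n q → RectangleStep m n q′
  rectangle-downward n≤m 0≤q′ q′≤q (inj₁ (_ , hi)) =
    inj₁ (ℤ.≤-trans (ℤ.≤-trans (ℤ.i≤j⇒i-j≤0 (+≤+ n≤m)) ℤ.≤-refl) 0≤q′ , ℤ.≤-<-trans q′≤q hi)
  rectangle-downward _ _ q′≤q (inj₂ lt) = inj₂ (ℤ.≤-<-trans q′≤q lt)

  -- The indices 0 and `- 1` of this class sit at the opposite positions `p` and `- p`.
  middle-or : ∀ {c} → suc c ≡ p → At c 0ℤ ⊎ At c -1ℤ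
  middle-or {c} c≡ with at? c 0ℤ
  ... | yes at = inj₁ at
  ... | no ¬at = inj₂ (Mirror.¬at⇒at 0ℤ ¬at)
    where open Middle c≡

  last-at : ∀ {c} → suc c ≡ g → At c -1ℤ
  last-at c≡ = Last.at-last c≡

  module Paired {c c′} (paired : suc c ℕ.+ suc c′ ≡ g) (q : ℤ) where

    opposite : - position c q ≡ position c′ (- 1ℤ - q)
    opposite = trans (cong (λ z → - (q * z + + c + 1ℤ)) g≡) (trans (lemma q (+ c) (+ c′))
      (cong (λ z → (- 1ℤ - q) * z + + c′ + 1ℤ) (sym g≡)))
      where
      g≡ : + g ≡ 1ℤ + + c + (1ℤ + + c′)
      g≡ = trans (cong +_ (sym paired)) (trans (ℤ.pos-+ (suc c) (suc c′)) (cong₂ _+_ (ℤ.pos-+ 1 c) (ℤ.pos-+ 1 c′)))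
      lemma : ∀ q c c′ → - (q * (1ℤ + c + (1ℤ + c′)) + c + 1ℤ) ≡ (- 1ℤ - q) * (1ℤ + c + (1ℤ + c′)) + c′ + 1ℤ
      lemma = solve-∀

    nonzero : position c q ≢ 0ℤ
    nonzero eq = contradiction (proj₂ (∙g+-injective {q} {0ℤ} {suc c} {0} c<g (ℕ.≤-trans (s≤s z≤n) c<g) (trans as-position eq))) (λ ())
      where
      c<g : suc c ℕ.< g
      c<g = subst (suc c ℕ.<_) paired (ℕ.m<m+n (suc c) (s≤s z≤n))
      lemma : ∀ q g c → q * g + (1ℤ + c) ≡ q * g + c + 1ℤ
      lemma = solve-∀
      as-position : q ∙g+ suc c ≡ position c q
      as-position = trans (cong (_+_ (q * + g)) (ℤ.pos-+ 1 c)) (lemma q (+ g) (+ c))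

    open Reflect {c} {c′} {q} { - 1ℤ - q} opposite nonzero public

-- The coding and the progressions of vertical steps

∣∣-injective : ∀ i j → ∣ i ∣ ≡ ∣ j ∣ → i ≡ j ⊎ i ≡ - j
∣∣-injective (+ m)       (+ n)       eq   = inj₁ (cong +_ eq)
∣∣-injective (+ m)       -[1+ n ]    refl = inj₂ refl
∣∣-injective -[1+ m ]    (+ .(suc m)) refl = inj₂ refl
∣∣-injective -[1+ m ]    -[1+ .m ]   refl = inj₁ refl

∣∣-≤ : ∀ {i n} → - (+ n) ≤ i → i ≤ + n → ∣ i ∣ ℕ.≤ n
∣∣-≤ {+ _}                 _         (+≤+ i≤n) = i≤n
∣∣-≤ { -[1+ _ ]} {suc n}   (-≤- i≤n) _         = s≤s i≤n

-- Here `p` is `t - 1`. The special classes `t - 2` and `2t - 3` are singled out by `suc (toℕ k)`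
-- being `p` or `g`, which avoids truncated subtraction, and `m₁` is written `suc m`.
module Coding (p : ℕ) (1≤p : 1 ℕ.≤ p) (g : ℕ) (g≡2p : g ≡ 2 ℕ.* p) (μ : Partition) (legs : LegsExceedArms μ)
  (ν : Fin g → Partition) (quotient : IsQuotient g μ ν)
  (rest : ∀ k → suc (toℕ k) ≢ p → suc (toℕ k) ≢ g → ν k ≡ ∅)
  (last : ∀ k → suc (toℕ k) ≡ g → ∃ λ m → ν k ≡ rectangle (suc m) m)
  (middle : ∀ k → suc (toℕ k) ≡ p → ∃ λ m → ν k ≡ rectangle m m)
  (v : Fin (suc p) → ℤ) (coding : IsCoding g (suc p) μ v) where

  open Classes p 1≤p g g≡2p μ legs

  private
    β : Fin g → ℤ
    β = proj₁ coding

    p<g : p ℕ.< g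
    p<g = subst (p ℕ.<_) (sym g≡2p) (ℕ.m<m+n p (ℕ.≤-trans 1≤p (ℕ.m≤m+n p 0)))

    quotient-step : ∀ k {m n} → ν k ≡ rectangle m n → ∃ λ a → ∀ q → At (toℕ k) q ⇔ RectangleStep m n (q - a)
    quotient-step k {m} {n} eq with a , words ← quotient k = a , λ q → mk⇔
      (λ at → rectangle-vertical m n (subst (λ z → IsVertical z (q - a)) eq
        (word-vertical (ν k) (trans (words (q - a)) (vertical-word μ (subst (IsVertical μ) (sym (index≡ a q)) at))))))
      (λ step → subst (IsVertical μ) (index≡ a q) (word-vertical μ (trans (sym (words (q - a)))
        (vertical-word (ν k) (subst (λ z → IsVertical z (q - a)) (sym eq) (vertical-rectangle m n step))))))
      where
      index≡ : ∀ a q → + g * (q - a + a) + + toℕ k ≡ q ∙g+ toℕ k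
      index≡ a q = lemma (+ g) q a (+ toℕ k)
        where
        lemma : ∀ g q a c → g * (q - a + a) + c ≡ q * g + c
        lemma = solve-∀

    maximum : ∀ c → ∃ λ k → β c ≡ (k + 1ℤ) * + g + + toℕ c × word μ (k * + g + + toℕ c) ≡ 0F
    maximum c = proj₁ (proj₁ (proj₂ coding) c)

    -- The first quotient past the last vertical step of class `c`; the increment is the one built
    -- into the definition of `β`.
    Q : Fin g → ℤ
    Q c = proj₁ (maximum c) + 1ℤ

    β≡ : ∀ c → β c ≡ Q c ∙g+ toℕ c
    β≡ c = proj₁ (proj₂ (maximum c))

    at-top : ∀ c → At (toℕ c) (Q c - 1ℤ)
    at-top c = subst (At (toℕ c)) (lemma (proj₁ (maximum c))) (word-vertical μ (proj₂ (proj₂ (maximum c))))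
      where
      lemma : ∀ k → k ≡ k + 1ℤ - 1ℤ
      lemma = solve-∀

    at⇒<B : ∀ c q → At (toℕ c) q → q < Q c
    at⇒<B c q at = ℤ.suc[i]≤j⇒i<j (ℤ.≤-trans (ℤ.≤-reflexive (ℤ.+-comm 1ℤ q)) (∙g+-cancel-≤ (Fin.toℕ<n c)
      (subst ((q + 1ℤ) ∙g+ toℕ c ≤_) (β≡ c) (proj₂ (proj₁ (proj₂ coding) c) _ (q , refl , vertical-word μ at)))))

    pred-≤ : ∀ {q b} → q < b → q ≤ b - 1ℤ
    pred-≤ {q} {b} q<b = from-gap≤ (gap q<b) (lemma q b)
      where
      lemma : ∀ q b → b - q - 1ℤ ≡ b - 1ℤ - q
      lemma = solve-∀

    unshifted : ∀ {a} q → a ≡ 0ℤ → q - a ≡ q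
    unshifted q refl = ℤ.+-identityʳ q

    rest-at : ∀ c → suc (toℕ c) ≢ p → suc (toℕ c) ≢ g → ∀ {q q′} → q′ ≤ q → At (toℕ c) q → At (toℕ c) q′
    rest-at c ≢p ≢g {q} {q′} q′≤q at with a , iff ← quotient-step c {0} {0} (rest c ≢p ≢g) =
      Equivalence.from (iff q′) (inj₂ (ℤ.≤-<-trans (ℤ.+-monoˡ-≤ (- a) q′≤q) (negative (Equivalence.to (iff q) at))))
      where
      negative : ∀ {x} → RectangleStep 0 0 x → x < 0ℤ
      negative (inj₁ (_ , x<0)) = x<0
      negative (inj₂ x<0)       = x<0

    downward : ∀ c {q q′} → 0ℤ ≤ q′ → q′ ≤ q → At (toℕ c) q → At (toℕ c) q′
    downward c {q} {q′} 0≤q′ q′≤q at with suc (toℕ c) ℕ.≟ p | suc (toℕ c) ℕ.≟ g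
    ... | no ≢p | no ≢g = rest-at c ≢p ≢g q′≤q at
    ... | yes ≡p | _ with m , eq ← middle c ≡p with a , iff ← quotient-step c eq =
      let a≡0 = middle-shift ≡p m a iff in
      Equivalence.from (iff q′) (subst (RectangleStep m m) (sym (unshifted q′ a≡0))
        (rectangle-downward ℕ.≤-refl 0≤q′ q′≤q (subst (RectangleStep m m) (unshifted q a≡0) (Equivalence.to (iff q) at))))
    ... | no _ | yes ≡g with m , eq ← last c ≡g with a , iff ← quotient-step c eq =
      let a≡0 = last-shift ≡g m a iff in
      Equivalence.from (iff q′) (subst (RectangleStep (suc m) m) (sym (unshifted q′ a≡0))
        (rectangle-downward (ℕ.n≤1+n m) 0≤q′ q′≤q (subst (RectangleStep (suc m) m) (unshifted q a≡0) (Equivalence.to (iff q) at))))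

    <B⇒at : ∀ c {q} → 0ℤ ≤ q → q < Q c → At (toℕ c) q
    <B⇒at c 0≤q q<B = downward c 0≤q (pred-≤ q<B) (at-top c)

    middle-B : ∀ c → suc (toℕ c) ≡ p → 0ℤ ≤ Q c
    middle-B c ≡p with middle-or ≡p
    ... | inj₁ at = ℤ.<⇒≤ (at⇒<B c 0ℤ at)
    ... | inj₂ at = ℤ.i<j⇒suc[i]≤j (at⇒<B c -1ℤ at)

    last-B : ∀ c → suc (toℕ c) ≡ g → 0ℤ ≤ Q c
    last-B c ≡g = ℤ.i<j⇒suc[i]≤j (at⇒<B c -1ℤ (last-at ≡g))

    -- In these classes the component is empty, so the steps are vertical exactly below the
    -- threshold `Q`. Reflection exchanges the last vertical step of one class with the first
    -- horizontal step of the other.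
    paired-B : ∀ c c′ → suc (toℕ c) ≢ p → suc (toℕ c) ℕ.+ suc (toℕ c′) ≡ g → Q c′ ≡ - Q c
    paired-B c c′ ≢p paired = ℤ.≤-antisym upper lower
      where
      ≢g : suc (toℕ c) ≢ g
      ≢g eq = ℕ.<-irrefl eq (subst (suc (toℕ c) ℕ.<_) paired (ℕ.m<m+n _ (s≤s z≤n)))
      c′≢p : suc (toℕ c′) ≢ p
      c′≢p eq = ≢p (ℕ.+-cancelʳ-≡ p (suc (toℕ c)) p (trans (trans (cong (suc (toℕ c) ℕ.+_) (sym eq)) paired) (trans g≡2p (cong (p ℕ.+_) (ℕ.+-identityʳ p)))))
      c′≢g : suc (toℕ c′) ≢ g
      c′≢g eq = ℕ.<-irrefl eq (subst (suc (toℕ c′) ℕ.<_) paired (ℕ.m<n+m _ (s≤s z≤n)))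
      lower : - Q c ≤ Q c′
      lower = ℤ.≤-trans (ℤ.≤-reflexive (lemma (Q c))) (ℤ.i<j⇒suc[i]≤j
        (at⇒<B c′ (- 1ℤ - Q c) (Paired.¬at⇒at paired (Q c) (λ at → ℤ.<-irrefl refl (at⇒<B c (Q c) at)))))
        where
        lemma : ∀ b → - b ≡ 1ℤ + (- 1ℤ - b)
        lemma = solve-∀
      upper : Q c′ ≤ - Q c
      upper = ℤ.≮⇒≥ λ -B<B′ → Paired.at⇒¬at paired (Q c - 1ℤ) (at-top c)
        (rest-at c′ c′≢p c′≢g (ℤ.≤-trans (ℤ.≤-reflexive (lemma (Q c))) (pred-≤ -B<B′)) (at-top c′))
        where
        lemma : ∀ b → - 1ℤ - (b - 1ℤ) ≡ - b
        lemma = solve-∀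

    -- Over all classes the values are `1 - p, …, p`. The absolute values 0 and `p` belong to the
    -- two self-opposite classes, each of the others to a pair of opposite classes.
    residue : ℕ → ℤ
    residue c = + c - + p + 1ℤ

    R : Fin g → ℤ
    R c = Q c ∙g+ toℕ c - + p + 1ℤ

    R≡ : ∀ c → R c ≡ Q c * + g + residue (toℕ c)
    R≡ c = lemma (Q c * + g) (+ toℕ c) (+ p)
      where
      lemma : ∀ x c p → x + c - p + 1ℤ ≡ x + (c - p + 1ℤ)
      lemma = solve-∀

    residue-suc : ∀ {c d} → suc c ≡ d ℕ.+ p → residue c ≡ + d
    residue-suc {c} {d} eq = trans (lemma (+ c) (+ p)) (trans (cong (_- + p) (trans (sym (ℤ.pos-+ 1 c)) (trans (cong +_ eq) (ℤ.pos-+ d p)))) (lemma₂ (+ d) (+ p)))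
      where
      lemma : ∀ c p → c - p + 1ℤ ≡ 1ℤ + c - p
      lemma = solve-∀
      lemma₂ : ∀ d p → d + p - p ≡ d
      lemma₂ = solve-∀

    residue-neg : ∀ {c d} → suc c ℕ.+ d ≡ p → residue c ≡ - (+ d)
    residue-neg {c} {d} eq = trans (cong (λ z → + c - z + 1ℤ) (trans (cong +_ (sym eq)) (trans (ℤ.pos-+ (suc c) d) (cong (_+ + d) (ℤ.pos-+ 1 c))))) (lemma (+ c) (+ d))
      where
      lemma : ∀ c d → c - (1ℤ + c + d) + 1ℤ ≡ - d
      lemma = solve-∀

    residue-≤ : ∀ (c : Fin g) → residue (toℕ c) ≤ + p
    residue-≤ c = from-gap≤ (gap (+<+ (Fin.toℕ<n c))) (trans (cong (λ z → z - + toℕ c - 1ℤ) +g) (lemma (+ toℕ c) (+ p)))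
      where
      lemma : ∀ c p → p + p - c - 1ℤ ≡ p - (c - p + 1ℤ)
      lemma = solve-∀

    residue-≥ : ∀ c → - (+ p) ≤ residue c
    residue-≥ c = from-gap≤ {s = + c + 1ℤ} (0≤-+ (+≤+ (z≤n {c})) (+≤+ (z≤n {1}))) (lemma (+ c) (+ p))
      where
      lemma : ∀ c p → c + 1ℤ ≡ c - p + 1ℤ - - p
      lemma = solve-∀

    -- These turn out to be the classes selected by the coding, one for each absolute residue
    -- `0, …, p`.
    Good : Fin g → Set
    Good c = 0ℤ ≤ R c

    0≤B⇒good : ∀ c {d} → 0ℤ ≤ Q c → residue (toℕ c) ≡ + d → Good c
    0≤B⇒good c {d} 0≤B eq = subst (0ℤ ≤_) (sym (trans (R≡ c) (cong (_+_ (Q c * + g)) eq))) (0≤-+ (0≤-* 0≤B (+≤+ (z≤n {g}))) (+≤+ (z≤n {d})))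

    1≤B⇒good : ∀ c → 1ℤ ≤ Q c → Good c
    1≤B⇒good c 1≤B = subst (0ℤ ≤_) (trans (lemma (Q c) (+ g) (residue (toℕ c)) (+ p)) (sym (R≡ c)))
      (0≤-+ (0≤-* (ℤ.i≤j⇒0≤j-i 1≤B) (+≤+ (z≤n {g}))) (0≤-+ (ℤ.i≤j⇒0≤j-i (residue-≥ (toℕ c))) (ℤ.i≤j⇒0≤j-i (+≤+ (ℕ.<⇒≤ p<g)))))
      where
      lemma : ∀ b g x p → (b - 1ℤ) * g + ((x - - p) + (g - p)) ≡ b * g + x
      lemma = solve-∀

    good⇒0≤B : ∀ c → Good c → 0ℤ ≤ Q c
    good⇒0≤B c good = ℤ.≮⇒≥ λ B<0 → ℤ.<⇒≱ (from-gap (0≤-+ (0≤-* (gap B<0) (+≤+ (z≤n {g}))) (0≤-+ (gap (+<+ p<g)) (ℤ.i≤j⇒0≤j-i (residue-≤ c))))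
      (lemma (Q c) (+ g) (residue (toℕ c)) (+ p))) (subst (0ℤ ≤_) (R≡ c) good)
      where
      lemma : ∀ b g x p → (0ℤ - b - 1ℤ) * g + ((g - p - 1ℤ) + (p - x)) ≡ 0ℤ - (b * g + x) - 1ℤ
      lemma = solve-∀

    class-of : ∀ {n} → n ℕ.< g → ∃ λ (c : Fin g) → toℕ c ≡ n
    class-of n<g = fromℕ< n<g , Fin.toℕ-fromℕ< n<g

    p+p≡g : p ℕ.+ p ≡ g
    p+p≡g = trans (cong (p ℕ.+_) (sym (ℕ.+-identityʳ p))) (sym g≡2p)

    -- The class with residue `d` serves if its threshold is nonnegative; otherwise the opposite
    -- class has a positive threshold. For `d = p` and `d = 0` the class is its own opposite, and
    -- `last-B` or `middle-B` rules out a negative threshold.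
    good-class : ∀ d → d ℕ.≤ p → ∃ λ c → Good c × ∣ residue (toℕ c) ∣ ≡ d
    good-class d d≤p = choose (0ℤ ℤ.≤? Q c₁)
      where
      p₀ = ℕ.pred p
      suc-p₀ : suc p₀ ≡ p
      suc-p₀ = ℕ.suc-pred p {{ℕ.>-nonZero 1≤p}}
      suc-n₁ : suc (d ℕ.+ p₀) ≡ d ℕ.+ p
      suc-n₁ = trans (sym (ℕ.+-suc d p₀)) (cong (d ℕ.+_) suc-p₀)
      n₁<g : d ℕ.+ p₀ ℕ.< g
      n₁<g = subst (d ℕ.+ p₀ ℕ.<_) p+p≡g (subst (ℕ._≤ p ℕ.+ p) (sym suc-n₁) (ℕ.+-monoˡ-≤ p d≤p))
      c₁ = proj₁ (class-of n₁<g)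
      suc-c₁ : suc (toℕ c₁) ≡ d ℕ.+ p
      suc-c₁ = trans (cong suc (proj₂ (class-of n₁<g))) suc-n₁
      choose : Dec (0ℤ ≤ Q c₁) → ∃ λ c → Good c × ∣ residue (toℕ c) ∣ ≡ d
      choose (yes 0≤B) = c₁ , 0≤B⇒good c₁ 0≤B (residue-suc suc-c₁) , cong ∣_∣ (residue-suc suc-c₁)
      choose (no 0≰B)  = c₂ , 1≤B⇒good c₂ 1≤B , trans (cong ∣_∣ (residue-neg suc-c₂)) (ℤ.∣-i∣≡∣i∣ (+ d))
        where
        d<p : d ℕ.< p
        d<p = ℕ.≤∧≢⇒< d≤p (λ { refl → 0≰B (last-B c₁ (trans suc-c₁ p+p≡g)) })
        n₂ = p ℕ.∸ suc d
        suc-n₂ : suc n₂ ℕ.+ d ≡ p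
        suc-n₂ = trans (sym (ℕ.+-suc n₂ d)) (ℕ.m∸n+n≡m d<p)
        n₂<g : n₂ ℕ.< g
        n₂<g = ℕ.≤-<-trans (ℕ.m∸n≤m p (suc d)) p<g
        c₂ = proj₁ (class-of n₂<g)
        suc-c₂ : suc (toℕ c₂) ℕ.+ d ≡ p
        suc-c₂ = trans (cong (λ n → suc n ℕ.+ d) (proj₂ (class-of n₂<g))) suc-n₂
        paired : suc (toℕ c₁) ℕ.+ suc (toℕ c₂) ≡ g
        paired = trans (cong (ℕ._+ suc (toℕ c₂)) (trans suc-c₁ (ℕ.+-comm d p)))
          (trans (ℕ.+-assoc p d _) (trans (cong (p ℕ.+_) (trans (ℕ.+-comm d _) suc-c₂)) p+p≡g))
        1≤B : 1ℤ ≤ Q c₂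
        1≤B = subst (1ℤ ≤_) (sym (paired-B c₁ c₂ (λ ≡p → 0≰B (middle-B c₁ ≡p)) paired))
          (ℤ.i<j⇒suc[i]≤j (ℤ.neg-mono-< (ℤ.≰⇒> 0≰B)))

    -- Distinct classes with the same absolute residue are opposite, so their `R` are negatives of
    -- each other. If both are nonnegative they vanish, which happens only in the class of `p - 1`,
    -- and that class is its own opposite.
    good-unique : ∀ c c′ → Good c → Good c′ → ∣ residue (toℕ c) ∣ ≡ ∣ residue (toℕ c′) ∣ → c ≡ c′
    good-unique c c′ good good′ eq with ∣∣-injective (residue (toℕ c)) (residue (toℕ c′)) eq
    ... | inj₁ same = Fin.toℕ-injective (ℤ.+-injective (cancel same))
      where
      lemma : ∀ c p → c ≡ c - p + 1ℤ - 1ℤ + p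
      lemma = solve-∀
      cancel : residue (toℕ c) ≡ residue (toℕ c′) → + toℕ c ≡ + toℕ c′
      cancel same = trans (lemma (+ toℕ c) (+ p)) (trans (cong (λ z → z - 1ℤ + + p) same) (sym (lemma (+ toℕ c′) (+ p))))
    ... | inj₂ opp = Fin.toℕ-injective (ℕ.suc-injective (by-middle (suc (toℕ c) ℕ.≟ p)))
      where
      lemma : ∀ c c′ p → 1ℤ + c + (1ℤ + c′) ≡ (c - p + 1ℤ) + (c′ - p + 1ℤ) + (p + p)
      lemma = solve-∀
      paired : suc (toℕ c) ℕ.+ suc (toℕ c′) ≡ g
      paired = ℤ.+-injective (trans (trans (ℤ.pos-+ (suc (toℕ c)) (suc (toℕ c′))) (cong₂ _+_ (ℤ.pos-+ 1 (toℕ c)) (ℤ.pos-+ 1 (toℕ c′))))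
        (trans (lemma (+ toℕ c) (+ toℕ c′) (+ p)) (trans (cong₂ _+_ (trans (cong (_+ residue (toℕ c′)) opp) (ℤ.+-inverseˡ (residue (toℕ c′)))) (sym +g)) (ℤ.+-identityˡ (+ g)))))
      by-middle : Dec (suc (toℕ c) ≡ p) → suc (toℕ c) ≡ suc (toℕ c′)
      by-middle (yes ≡p) = trans ≡p (ℕ.+-cancelˡ-≡ p p (suc (toℕ c′)) (trans p+p≡g (trans (sym paired) (cong (ℕ._+ suc (toℕ c′)) ≡p))))
      by-middle (no ≢p)  = contradiction (trans (cong suc (proj₂ (∙g+-injective {Q c} {0ℤ} (Fin.toℕ<n c) p₀<g Bg+c≡))) (ℕ.suc-pred p {{ℕ.>-nonZero 1≤p}})) ≢p
        where
        p₀<g : ℕ.pred p ℕ.< g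
        p₀<g = ℕ.≤-<-trans ℕ.pred[n]≤n p<g
        R-opposite : R c′ ≡ - R c
        R-opposite = trans (R≡ c′) (trans (cong₂ (λ a b → a * + g + b) (paired-B c c′ ≢p paired) (trans (sym (ℤ.neg-involutive _)) (cong -_ (sym opp))))
          (trans (lemma₂ (Q c) (+ g) (residue (toℕ c))) (cong -_ (sym (R≡ c)))))
          where
          lemma₂ : ∀ b g x → - b * g + - x ≡ - (b * g + x)
          lemma₂ = solve-∀
        R≡0 : R c ≡ 0ℤ
        R≡0 = ℤ.≤-antisym (subst (_≤ 0ℤ) (ℤ.neg-involutive (R c)) (ℤ.neg-mono-≤ (subst (0ℤ ≤_) R-opposite good′))) good
        Bg+c≡ : Q c ∙g+ toℕ c ≡ 0ℤ ∙g+ ℕ.pred p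
        Bg+c≡ = trans (lemma₃ (Q c ∙g+ toℕ c) (+ p)) (trans (cong (λ z → z + + p - 1ℤ) R≡0)
          (trans (cong (λ z → 0ℤ + z - 1ℤ) (trans (cong +_ (sym (ℕ.suc-pred p {{ℕ.>-nonZero 1≤p}}))) (ℤ.pos-+ 1 (ℕ.pred p)))) (lemma₄ (+ ℕ.pred p) (+ g))))
          where
          lemma₃ : ∀ x p → x ≡ x - p + 1ℤ + p - 1ℤ
          lemma₃ = solve-∀
          lemma₄ : ∀ x g → 0ℤ + (1ℤ + x) - 1ℤ ≡ 0ℤ * g + x
          lemma₄ = solve-∀

    class : Fin (suc p) → Fin g
    class i = proj₁ (proj₁ (proj₂ (proj₂ (proj₂ coding))) i)

    v≡β : ∀ i → v i ≡ β (class i)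
    v≡β i = proj₂ (proj₁ (proj₂ (proj₂ (proj₂ coding))) i)

    v-injective : ∀ {i j} → v i ≡ v j → i ≡ j
    v-injective {i} {j} eq with Fin.<-cmp i j
    ... | tri≈ _ i≡j _ = i≡j
    ... | tri< i<j _ _ = contradiction (sym eq) (ℤ.<⇒≢ (proj₁ (proj₂ (proj₂ coding)) i j i<j))
    ... | tri> _ _ j<i = contradiction eq (ℤ.<⇒≢ (proj₁ (proj₂ (proj₂ coding)) j i j<i))

    β-injective : ∀ {c c′} → β c ≡ β c′ → c ≡ c′
    β-injective {c} {c′} eq = Fin.toℕ-injective (proj₂ (∙g+-injective {Q c} {Q c′} (Fin.toℕ<n c) (Fin.toℕ<n c′) (trans (sym (β≡ c)) (trans eq (β≡ c′)))))

  r : Fin (suc p) → ℤ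
  r i = v i - + p + 1ℤ

  private
    r≡R : ∀ i → r i ≡ R (class i)
    r≡R i = cong (λ z → z - + p + 1ℤ) (trans (v≡β i) (β≡ (class i)))

  r-decreasing : ∀ i j → i Fin.< j → r j < r i
  r-decreasing i j i<j = ℤ.+-monoˡ-< 1ℤ (ℤ.+-monoˡ-< (- (+ p)) (proj₁ (proj₂ (proj₂ coding)) i j i<j))

  -- Were some r i negative, the p + 1 good classes would all occur among the
  -- remaining p entries of v.
  0≤r : ∀ i → 0ℤ ≤ r i
  0≤r i = ℤ.≮⇒≥ λ r<0 → absurd r<0
    where
    good : Fin (suc p) → Fin g
    good d = proj₁ (good-class (toℕ d) (ℕ.≤-pred (Fin.toℕ<n d)))
    is-good : ∀ d → Good (good d)
    is-good d = proj₁ (proj₂ (good-class (toℕ d) (ℕ.≤-pred (Fin.toℕ<n d))))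
    folded : ∀ d → ∣ residue (toℕ (good d)) ∣ ≡ toℕ d
    folded d = proj₂ (proj₂ (good-class (toℕ d) (ℕ.≤-pred (Fin.toℕ<n d))))
    absurd : ¬ r i < 0ℤ
    absurd r<0 = let d , d≡i = injective⇒surjective (λ d → proj₁ (occurs d)) inj i in
      ℤ.<⇒≱ (v<β d) (ℤ.≤-reflexive (trans (sym (proj₂ (occurs d))) (cong v d≡i)))
      where
      v<β : ∀ d → v i < β (good d)
      v<β d = from-gap (0≤-+ (gap r<0) (is-good d)) (trans (cong (λ z → 0ℤ - r i - 1ℤ + (z - + p + 1ℤ)) (sym (β≡ (good d)))) (lemma (v i) (β (good d)) (+ p)))
        where
        lemma : ∀ v b p → 0ℤ - (v - p + 1ℤ) - 1ℤ + (b - p + 1ℤ) ≡ b - v - 1ℤ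
        lemma = solve-∀
      occurs : ∀ d → ∃ λ j → v j ≡ β (good d)
      occurs d with proj₂ (proj₂ (proj₂ (proj₂ coding))) (good d)
      ... | inj₁ found = found
      ... | inj₂ below = contradiction (below i) (ℤ.<-asym (v<β d))
      inj : ∀ {d e} → proj₁ (occurs d) ≡ proj₁ (occurs e) → d ≡ e
      inj {d} {e} eq = Fin.toℕ-injective (trans (sym (folded d)) (trans (cong (λ c → ∣ residue (toℕ c) ∣)
        (β-injective (trans (sym (proj₂ (occurs d))) (trans (cong v eq) (proj₂ (occurs e)))))) (folded e)))

  -- `r i` reduced modulo `g` into the range `1 - p, …, p`. It may be negative, which is what the
  -- folding by even functions has to absorb.
  ρ : Fin (suc p) → ℤ
  ρ i = residue (toℕ (class i))

  private
    class-good : ∀ i → Good (class i)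
    class-good i = subst (0ℤ ≤_) (r≡R i) (0≤r i)

    ∣ρ∣≤p : ∀ i → ∣ ρ i ∣ ℕ.≤ p
    ∣ρ∣≤p i = ∣∣-≤ (residue-≥ (toℕ (class i))) (residue-≤ (class i))

    ∣ρ∣-injective : ∀ {i j} → ∣ ρ i ∣ ≡ ∣ ρ j ∣ → i ≡ j
    ∣ρ∣-injective {i} {j} eq = v-injective (trans (v≡β i) (trans (cong β (good-unique (class i) (class j) (class-good i) (class-good j) eq)) (sym (v≡β j))))

    good-occurs : ∀ c → Good c → ∃ λ i → class i ≡ c
    good-occurs c good =
      let i , eq = bounded-injection⇒surjective (λ i → ∣ ρ i ∣) (λ i → s≤s (∣ρ∣≤p i)) ∣ρ∣-injective (s≤s (∣∣-≤ (residue-≥ (toℕ c)) (residue-≤ c)))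
      in i , good-unique (class i) c (class-good i) good eq

  ρ-folds : FoldsTo p ρ
  ρ-folds = folds-to ρ ∣ρ∣≤p ∣ρ∣-injective

  private
    height : Fin (suc p) → ℕ
    height i = ∣ Q (class i) ∣

    height≡ : ∀ i → + height i ≡ Q (class i)
    height≡ i = ℤ.0≤i⇒+∣i∣≡i (good⇒0≤B (class i) (class-good i))

    progression : Fin g → ℕ → ℕ
    progression c a = suc (a ℕ.* g ℕ.+ toℕ c)

    progression-position : ∀ c a → + progression c a ≡ position (toℕ c) (+ a)
    progression-position c a = trans (ℤ.pos-+ 1 _) (trans (cong (_+_ 1ℤ) (trans (ℤ.pos-+ (a ℕ.* g) (toℕ c)) (cong (_+ + toℕ c) (ℤ.pos-* a g)))) (ℤ.+-comm 1ℤ (+ a ∙g+ toℕ c)))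

    progression-injective : ∀ {c c′ a a′} → progression c a ≡ progression c′ a′ → c ≡ c′ × a ≡ a′
    progression-injective {c} {c′} {a} {a′} eq =
      let a≡ , c≡ = ∙g+-injective {+ a} {+ a′} (Fin.toℕ<n c) (Fin.toℕ<n c′)
            (trans (sym (cast a c)) (trans (cong +_ (ℕ.suc-injective eq)) (cast a′ c′)))
      in Fin.toℕ-injective c≡ , ℤ.+-injective a≡
      where
      cast : ∀ a (c : Fin g) → + (a ℕ.* g ℕ.+ toℕ c) ≡ + a ∙g+ toℕ c
      cast a c = trans (ℤ.pos-+ (a ℕ.* g) (toℕ c)) (cong (_+ + toℕ c) (ℤ.pos-* a g))

    progressions : List ℕ
    progressions = concatMap (λ i → map (progression (class i)) (upTo (height i))) (allFin (suc p))

    class-injective : ∀ {i j} → class i ≡ class j → i ≡ j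
    class-injective {i} {j} eq = v-injective (trans (v≡β i) (trans (cong β eq) (sym (v≡β j))))

    progressions-unique : Unique progressions
    progressions-unique = Unique.concat⁺
      (All.map⁺ (All.tabulate (λ {i} _ → Unique.map⁺ (λ {a} {b} eq → proj₂ (progression-injective {class i} {class i} {a} {b} eq)) (Unique.upTo⁺ (height i)))))
      (AllPairs.map⁺ (AllPairs.map disjoint (Unique.allFin⁺ (suc p))))
      where
      disjoint : ∀ {i j} → i ≢ j → ∀ {u} → ¬ (u ∈ map (progression (class i)) (upTo (height i)) × u ∈ map (progression (class j)) (upTo (height j)))
      disjoint {i} {j} i≢j (u∈ , u∈′) with a , _ , refl ← ∈-map⁻ (progression (class i)) u∈ with b , _ , eq ← ∈-map⁻ (progression (class j)) u∈′ =
        i≢j (class-injective (proj₁ (progression-injective {class i} {class j} {a} {b} eq)))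

    U = positiveVerticals μ

    progressions⊆U : ∀ {u} → u ∈ progressions → u ∈ U
    progressions⊆U u∈ with i , _ , u∈ᵢ ← find (∈-concatMap⁻ (λ i → map (progression (class i)) (upTo (height i))) {xs = allFin (suc p)} u∈)
      with a , a∈ , refl ← ∈-map⁻ (progression (class i)) u∈ᵢ =
      ∈-filter⁺ (λ n → vertical? μ (+ n)) (∈-[1⋯]⁺ (s≤s z≤n) (bounded (vertical-rowEnd μ vertical))) vertical
      where
      vertical : Vertical μ (+ progression (class i) a)
      vertical = at⇒vertical {toℕ (class i)} {+ a} (progression-position (class i) a)
        (<B⇒at (class i) (+≤+ z≤n) (subst (+ a <_) (height≡ i) (+<+ (∈-upTo⁻ a∈))))
      bounded : ∀ {u} → (∃ λ k → 1 ℕ.≤ k × + u ≡ rowEnd μ k) → u ℕ.≤ extent μ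
      bounded {u} (k , 1≤k , eq) = ℕ.≤-trans (ℤ.drop‿+≤+ (from-gap≤ (ℕ-gap 1≤k) (trans (lemma (+ (μ ‼ k)) (+ k)) (cong (λ z → + (μ ‼ k) - z) (sym eq)))))
        (ℕ.≤-trans (‼-antitone μ (s≤s z≤n) 1≤k) (ℕ.m≤m+n _ _))
        where
        lemma : ∀ a k → k - 1ℤ ≡ a - (a + 1ℤ - k)
        lemma = solve-∀

    -- Division by `g` places the step in a class `c`. A vertical step with nonnegative quotient
    -- forces `Q c ≥ 1`, so `c` is good and occurs in the coding.
    U⊆progressions : ∀ {u} → u ∈ U → u ∈ progressions
    U⊆progressions {zero} u∈ = contradiction (proj₁ (∈-[1⋯]⁻ {extent μ} (proj₁ (∈-filter⁻ (λ n → vertical? μ (+ n)) {xs = [1⋯ extent μ ]} u∈)))) (λ ())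
    U⊆progressions {suc u} u∈ = subst (_∈ progressions) (cong suc (sym u≡))
      (∈-concatMap⁺ (λ i → map (progression (class i)) (upTo (height i))) (lose (∈-allFin i)
        (subst (λ d → progression d q ∈ map (progression (class i)) (upTo (height i))) class≡
          (∈-map⁺ (progression (class i)) (∈-upTo⁺ (ℤ.drop‿+<+ (subst (+ q <_) (trans (cong Q (sym class≡)) (sym (height≡ i))) q<B)))))))
      where
      g≢0 : NonZero g
      g≢0 = ℕ.>-nonZero (ℕ.≤-trans (s≤s z≤n) p<g)
      c = fromℕ< (ℕ.m%n<n u g {{g≢0}})
      q = ℕ._/_ u g {{g≢0}}
      u≡ : u ≡ q ℕ.* g ℕ.+ toℕ c
      u≡ = trans (ℕ.m≡m%n+[m/n]*n u g {{g≢0}}) (trans (ℕ.+-comm (ℕ._%_ u g {{g≢0}}) _) (cong (q ℕ.* g ℕ.+_) (sym (Fin.toℕ-fromℕ< (ℕ.m%n<n u g {{g≢0}})))))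
      vertical : Vertical μ (+ suc u)
      vertical = proj₂ (∈-filter⁻ (λ n → vertical? μ (+ n)) {xs = [1⋯ extent μ ]} u∈)
      q<B : + q < Q c
      q<B = at⇒<B c (+ q) (vertical⇒at {toℕ c} {+ q} (trans (cong (λ z → + suc z) u≡) (progression-position c q)) vertical)
      c-good : Good c
      c-good = 1≤B⇒good c (ℤ.≤-trans (+≤+ (s≤s z≤n)) (ℤ.i<j⇒suc[i]≤j q<B))
      i = proj₁ (good-occurs c c-good)
      class≡ : class i ≡ c
      class≡ = proj₂ (good-occurs c c-good)

    U↭progressions : U ↭ progressions
    U↭progressions = ∼bag⇒↭ (unique∧set⇒bag (Unique.filter⁺ (λ n → vertical? μ (+ n)) ([1⋯]-unique (extent μ))) progressions-unique
      (mk⇔ U⊆progressions progressions⊆U))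

    -- Consecutive members differ by `g = 2p`, so the upper end `u + p` of one is the lower end of
    -- the next.
    ∑-progression : ∀ (K : ℤ → ℤ) (c : Fin g) n →
      ∑[ a ∈ upTo n ] (K (+ progression c a + + p) - K (+ progression c a - + p)) ≡ K (+ n * + g + residue (toℕ c)) - K (residue (toℕ c))
    ∑-progression K c zero = sym (trans (cong (λ z → K z - K (residue (toℕ c))) (lemma (+ g) (residue (toℕ c)))) (ℤ.+-inverseʳ (K (residue (toℕ c)))))
      where
      lemma : ∀ g x → 0ℤ * g + x ≡ x
      lemma = solve-∀
    ∑-progression K c (suc n) = begin
      (∑[ a ∈ upTo (suc n) ] (K (+ progression c a + + p) - K (+ progression c a - + p)))
        ≡⟨ ∑-upTo-suc n (λ a → K (+ progression c a + + p) - K (+ progression c a - + p)) ⟩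
      (∑[ a ∈ upTo n ] (K (+ progression c a + + p) - K (+ progression c a - + p))) + (K (+ progression c n + + p) - K (+ progression c n - + p))
        ≡⟨ cong₂ _+_ (∑-progression K c n) (cong₂ (λ a b → K a - K b) upper lower) ⟩
      K (+ n * + g + residue (toℕ c)) - K (residue (toℕ c)) + (K (+ suc n * + g + residue (toℕ c)) - K (+ n * + g + residue (toℕ c)))
        ≡⟨ lemma (K (+ n * + g + residue (toℕ c))) (K (residue (toℕ c))) (K (+ suc n * + g + residue (toℕ c))) ⟩
      K (+ suc n * + g + residue (toℕ c)) - K (residue (toℕ c))
        ∎
      where
      open ≡-Reasoning
      lemma : ∀ a b c → a - b + (c - a) ≡ c - b
      lemma = solve-∀
      lower : + progression c n - + p ≡ + n * + g + residue (toℕ c)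
      lower = trans (cong (_- + p) (progression-position c n)) (lemma₂ (+ n * + g) (+ toℕ c) (+ p))
        where
        lemma₂ : ∀ x c p → x + c + 1ℤ - p ≡ x + (c - p + 1ℤ)
        lemma₂ = solve-∀
      upper : + progression c n + + p ≡ + suc n * + g + residue (toℕ c)
      upper = trans (cong (_+ + p) (progression-position c n)) (trans (lemma₂ (+ n * + g) (+ toℕ c) (+ p))
        (trans (cong (λ z → + n * + g + z + residue (toℕ c)) (sym +g)) (trans (cong (_+ residue (toℕ c)) (lemma₃ (+ n) (+ g))) (cong (λ z → z * + g + residue (toℕ c)) (sym (ℤ.pos-+ 1 n))))))
        where
        lemma₂ : ∀ x c p → x + c + 1ℤ + p ≡ x + (p + p) + (c - p + 1ℤ)
        lemma₂ = solve-∀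
        lemma₃ : ∀ n g → n * g + g ≡ (1ℤ + n) * g
        lemma₃ = solve-∀

  telescope : ∀ (K : ℤ → ℤ) → ∑[ u ∈ positiveVerticals μ ] (K (+ u + + p) - K (+ u - + p)) ≡ ∑[ i ∈ allFin (suc p) ] (K (r i) - K (ρ i))
  telescope K = trans (∑-↭ U↭progressions _) (trans (∑-concatMap (λ i → map (progression (class i)) (upTo (height i))) (allFin (suc p)) _)
    (∑-ext (allFin (suc p)) λ i → trans (∑-map (progression (class i)) (upTo (height i)) _) (trans (∑-progression K (class i) (height i))
      (cong (λ z → K z - K (ρ i)) (trans (cong (λ z → z * + g + ρ i) (height≡ i)) (trans (sym (R≡ (class i))) (sym (r≡R i))))))))

-- The identities for the size and for the products

length-conj : ∀ μ → length (parts (conj μ)) ≡ μ ‼ 1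
length-conj μ = List.length-applyUpTo _ (μ ‼ 1)

-- Both sides become indicator sums over the square of side `extent μ`, which contains the diagram
-- and its transpose; there the order of summation can be exchanged.
∑-conj : ∀ μ (F G : Box → ℤ) → (∀ i j → 1 ℕ.≤ i → 1 ℕ.≤ j → F (i , j) ≡ G (j , i)) →
  ∑ (boxes μ) F ≡ ∑ (boxes (conj μ)) G
∑-conj μ F G F≡G = begin
  ∑ (boxes μ) F
    ≡⟨ ∑-boxes μ (ℕ.m≤n+m _ (μ ‼ 1)) F ⟩
  (∑[ i ∈ [1⋯ M ] ] ∑[ j ∈ [1⋯ μ ‼ i ] ] F (i , j))
    ≡⟨ ∑-cong [1⋯ M ] (λ i i∈ → ∑-extend (ℕ.≤-trans (‼-antitone μ (s≤s z≤n) (proj₁ (∈-[1⋯]⁻ i∈))) (ℕ.m≤m+n _ _)) (λ j → F (i , j))) ⟩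
  (∑[ i ∈ [1⋯ M ] ] ∑[ j ∈ [1⋯ M ] ] 𝟙 (j ℕ.≤? μ ‼ i) * F (i , j))
    ≡⟨ ∑-swap [1⋯ M ] [1⋯ M ] _ ⟩
  (∑[ j ∈ [1⋯ M ] ] ∑[ i ∈ [1⋯ M ] ] 𝟙 (j ℕ.≤? μ ‼ i) * F (i , j))
    ≡⟨ ∑-cong [1⋯ M ] (λ j j∈ → ∑-cong [1⋯ M ] (λ i i∈ → let 1≤i = proj₁ (∈-[1⋯]⁻ i∈); 1≤j = proj₁ (∈-[1⋯]⁻ j∈) in
         cong₂ _*_ (𝟙-⇔ (j ℕ.≤? μ ‼ i) (i ℕ.≤? conj μ ‼ j) (≤⇒conj-≤ μ 1≤i 1≤j) (conj-≤⇒ μ 1≤i 1≤j)) (F≡G i j 1≤i 1≤j))) ⟩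
  (∑[ j ∈ [1⋯ M ] ] ∑[ i ∈ [1⋯ M ] ] 𝟙 (i ℕ.≤? conj μ ‼ j) * G (j , i))
    ≡⟨ ∑-cong [1⋯ M ] (λ j j∈ → ∑-extend (ℕ.≤-trans (conj-‼-≤-length μ (proj₁ (∈-[1⋯]⁻ j∈))) (ℕ.m≤n+m _ (μ ‼ 1))) (λ i → G (j , i))) ⟨
  (∑[ j ∈ [1⋯ M ] ] ∑[ i ∈ [1⋯ conj μ ‼ j ] ] G (j , i))
    ≡⟨ ∑-boxes (conj μ) (ℕ.≤-trans (ℕ.≤-reflexive (length-conj μ)) (ℕ.m≤m+n _ _)) G ⟨
  ∑ (boxes (conj μ)) G
    ∎
  where
  open ≡-Reasoning
  M = extent μ

hook-conj : ∀ μ {i j} → 1 ℕ.≤ i → hook μ (i , j) ≡ hook (conj μ) (j , i)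
hook-conj μ {i} {j} 1≤i = cong suc (trans (ℕ.+-comm (μ ‼ i ℕ.∸ j) _) (cong (λ n → (conj μ ‼ j ℕ.∸ i) ℕ.+ (n ℕ.∸ j)) (sym (conj-involutive-‼ μ 1≤i))))

ε-transpose : ∀ i j → ε (j , i) ≡ - ε′ (i , j)
ε-transpose i j with i ℕ.<ᵇ j
... | true  = refl
... | false = refl

∑-const : ∀ (xs : List A) c → ∑[ x ∈ xs ] c ≡ + length xs * c
∑-const xs c = begin
  (∑[ x ∈ xs ] c)         ≡⟨ ∑-ext xs (λ _ → ℤ.*-identityʳ c) ⟨
  (∑[ x ∈ xs ] c * 1ℤ)    ≡⟨ ∑-* c xs (λ _ → 1ℤ) ⟩
  c * (∑[ x ∈ xs ] 1ℤ)    ≡⟨ cong (c *_) (∑-1 xs) ⟩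
  c * + length xs         ≡⟨ ℤ.*-comm c _ ⟩
  + length xs * c         ∎
  where open ≡-Reasoning

size-boxes : ∀ μ → ∑[ s ∈ boxes μ ] 1ℤ ≡ + size μ
size-boxes μ = begin
  (∑[ s ∈ boxes μ ] 1ℤ)
    ≡⟨ ∑-boxes μ ℕ.≤-refl (λ _ → 1ℤ) ⟩
  (∑[ i ∈ [1⋯ length (parts μ) ] ] ∑[ j ∈ [1⋯ μ ‼ i ] ] 1ℤ)
    ≡⟨ ∑-ext [1⋯ length (parts μ) ] (λ i → trans (∑-1 [1⋯ μ ‼ i ]) (cong +_ (List.length-applyUpTo suc (μ ‼ i)))) ⟩
  (∑[ i ∈ [1⋯ length (parts μ) ] ] + (μ ‼ i))
    ≡⟨ ∑-[1⋯] (length (parts μ)) (λ i → + (μ ‼ i)) ⟩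
  (∑[ i ∈ upTo (length (parts μ)) ] + nth (parts μ) i)
    ≡⟨ ∑-nth (parts μ) ⟩
  + size μ
    ∎
  where
  open ≡-Reasoning
  ∑-nth : ∀ xs → ∑[ i ∈ upTo (length xs) ] + nth xs i ≡ + sum xs
  ∑-nth []       = refl
  ∑-nth (x ∷ xs) = trans (cong (_+_ (+ x)) (trans (∑-[1⋯] (length xs) (λ i → + nth (x ∷ xs) i)) (∑-nth xs))) (sym (ℤ.pos-+ x (sum xs)))

∑-squares : ∀ n → + 6 * (∑[ k ∈ upTo n ] + k * + k) ≡ (+ n - 1ℤ) * + n * (+ 2 * + n - 1ℤ)
∑-squares zero    = refl
∑-squares (suc n) = begin
  + 6 * (∑[ k ∈ upTo (suc n) ] + k * + k)                            ≡⟨ cong (+ 6 *_) (∑-upTo-suc n (λ k → + k * + k)) ⟩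
  + 6 * ((∑[ k ∈ upTo n ] + k * + k) + + n * + n)                    ≡⟨ ℤ.*-distribˡ-+ (+ 6) (∑[ k ∈ upTo n ] + k * + k) (+ n * + n) ⟩
  + 6 * (∑[ k ∈ upTo n ] + k * + k) + + 6 * (+ n * + n)              ≡⟨ cong (_+ + 6 * (+ n * + n)) (∑-squares n) ⟩
  (+ n - 1ℤ) * + n * (+ 2 * + n - 1ℤ) + + 6 * (+ n * + n)            ≡⟨ lemma (+ n) ⟩
  (1ℤ + + n - 1ℤ) * (1ℤ + + n) * (+ 2 * (1ℤ + + n) - 1ℤ)             ≡⟨ cong (λ z → (z - 1ℤ) * z * (+ 2 * z - 1ℤ)) (ℤ.pos-+ 1 n) ⟨
  (+ suc n - 1ℤ) * + suc n * (+ 2 * + suc n - 1ℤ)                    ∎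
  where
  open ≡-Reasoning
  lemma : ∀ n → (n - 1ℤ) * n * (+ 2 * n - 1ℤ) + + 6 * (n * n) ≡ (1ℤ + n - 1ℤ) * (1ℤ + n) * (+ 2 * (1ℤ + n) - 1ℤ)
  lemma = solve-∀

integer-quotient : ∀ a b c g .{{_ : NonZero g}} → + g * (+ 12 * a) ≡ + 12 * b - + g * c → a / 1 ≡ b / g ℚ.- c / 12
integer-quotient a b c (suc g) eq = ℚ.toℚᵘ-injective (begin
  ℚ.toℚᵘ (a / 1)                                        ≈⟨ ℚ.toℚᵘ-fromℚᵘ (mkℚᵘ a 0) ⟩
  mkℚᵘ a 0                                              ≈⟨ *≡* cross ⟩
  mkℚᵘ b g ℚᵘ.+ ℚᵘ.- mkℚᵘ c 11                          ≈⟨ ℚᵘ.+-cong (ℚ.toℚᵘ-fromℚᵘ (mkℚᵘ b g)) (ℚᵘ.-‿cong (ℚ.toℚᵘ-fromℚᵘ (mkℚᵘ c 11))) ⟨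
  ℚ.toℚᵘ (b / suc g) ℚᵘ.+ ℚᵘ.- ℚ.toℚᵘ (c / 12)          ≈⟨ ℚᵘ.+-congʳ (ℚ.toℚᵘ (b / suc g)) (ℚ.toℚᵘ-homo‿- (c / 12)) ⟨
  ℚ.toℚᵘ (b / suc g) ℚᵘ.+ ℚ.toℚᵘ (ℚ.- (c / 12))         ≈⟨ ℚ.toℚᵘ-homo-+ (b / suc g) (ℚ.- (c / 12)) ⟨
  ℚ.toℚᵘ (b / suc g ℚ.- c / 12)                         ∎)
  where
  open ℚᵘ.≃-Reasoning
  lemma : ∀ a g → a * (g * + 12) ≡ g * (+ 12 * a)
  lemma = solve-∀
  lemma₂ : ∀ b c g → + 12 * b - g * c ≡ (b * + 12 + - c * g) * 1ℤ
  lemma₂ = solve-∀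
  cross : a * + (suc g ℕ.* 12) ≡ (b * + 12 + - c * + suc g) * 1ℤ
  cross = trans (cong (a *_) (ℤ.pos-* (suc g) 12)) (trans (lemma a (+ suc g)) (trans eq (lemma₂ b c (+ suc g))))

-- The reference vector `p, p - 1, …, 0`, written `κ` below. It has the absolute values of `ρ`, and
-- its differences and sums are the constants `j - i` and `g + 2 - i - j` of the product formula.
descending : ∀ p → Fin (suc p) → ℤ
descending p i = + p - + toℕ i

descending-folds : ∀ p → FoldsTo p (descending p)
descending-folds p = folds-to (descending p)
  (λ i → ℕ.≤-trans (ℕ.≤-reflexive (∣∣≡ i)) (ℕ.m∸n≤m p (toℕ i)))
  (λ {i} {j} eq → Fin.toℕ-injective (ℕ.∸-cancelˡ-≡ (i≤p i) (i≤p j) (trans (sym (∣∣≡ i)) (trans eq (∣∣≡ j)))))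
  where
  i≤p : ∀ i → toℕ i ℕ.≤ p
  i≤p i = ℕ.≤-pred (Fin.toℕ<n i)
  ∣∣≡ : ∀ i → ∣ descending p i ∣ ≡ p ℕ.∸ toℕ i
  ∣∣≡ i = cong ∣_∣ (trans (ℤ.m-n≡m⊖n p (toℕ i)) (ℤ.⊖-≥ (i≤p i)))

reduce-abs : (ℤ → ℤ) → ℤ → ℤ
reduce-abs f n = f (+ ∣ n ∣)

reduce-abs-even : ∀ f n → reduce-abs f (- n) ≡ reduce-abs f n
reduce-abs-even f n = cong (λ k → f (+ k)) (ℤ.∣-i∣≡∣i∣ n)

reduce-abs-nonneg : ∀ f {n} → 0ℤ ≤ n → reduce-abs f n ≡ f n
reduce-abs-nonneg f 0≤n = cong f (ℤ.0≤i⇒+∣i∣≡i 0≤n)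

-- The arguments h - ε′ g with ε′ = 1 and h < g are the only negative ones;
-- the exponents α correct for replacing them by their absolute values.
∑-α : ∀ μ g (f : ℤ → ℤ) →
  ∑[ s ∈ boxes μ ] (f (+ hook μ s - ε′ s * + g) - f (+ hook μ s))
  ≡ (∑[ s ∈ boxes μ ] (reduce-abs f (+ hook μ s - ε′ s * + g) - reduce-abs f (+ hook μ s)))
    + (∑[ i ∈ [1⋯ g ℕ.∸ 1 ] ] + α g i μ * (f (- + i) - f (+ i)))
∑-α μ g f = begin
  (∑[ s ∈ boxes μ ] (f (+ hook μ s - ε′ s * + g) - f (+ hook μ s)))
    ≡⟨ ∑-ext (boxes μ) (λ s → trans (lemma (f (+ hook μ s - ε′ s * + g)) (f (+ hook μ s)) (reduce-abs f (+ hook μ s - ε′ s * + g)))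
         (cong (_+_ (reduce-abs f (+ hook μ s - ε′ s * + g) - f (+ hook μ s))) (sym (correction s)))) ⟩
  (∑[ s ∈ boxes μ ] (reduce-abs f (+ hook μ s - ε′ s * + g) - reduce-abs f (+ hook μ s) + (∑[ i ∈ [1⋯ g ℕ.∸ 1 ] ] 𝟙 (P? i s) * c i)))
    ≡⟨ ∑-+ (boxes μ) (λ s → reduce-abs f (+ hook μ s - ε′ s * + g) - reduce-abs f (+ hook μ s)) (λ s → ∑[ i ∈ [1⋯ g ℕ.∸ 1 ] ] 𝟙 (P? i s) * c i) ⟩
  S + (∑[ s ∈ boxes μ ] ∑[ i ∈ [1⋯ g ℕ.∸ 1 ] ] 𝟙 (P? i s) * c i)
    ≡⟨ cong (_+_ S) (∑-swap (boxes μ) [1⋯ g ℕ.∸ 1 ] (λ s i → 𝟙 (P? i s) * c i)) ⟩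
  S + (∑[ i ∈ [1⋯ g ℕ.∸ 1 ] ] ∑[ s ∈ boxes μ ] 𝟙 (P? i s) * c i)
    ≡⟨ cong (_+_ S) (∑-ext [1⋯ g ℕ.∸ 1 ] (λ i → trans (sym (∑-filter (P? i) (boxes μ) (λ _ → c i))) (∑-const (filter (P? i) (boxes μ)) (c i)))) ⟩
  S + (∑[ i ∈ [1⋯ g ℕ.∸ 1 ] ] + α g i μ * c i)
    ∎
  where
  open ≡-Reasoning
  S = ∑[ s ∈ boxes μ ] (reduce-abs f (+ hook μ s - ε′ s * + g) - reduce-abs f (+ hook μ s))
  c : ℕ → ℤ
  c i = f (- + i) - f (+ i)
  P? : ∀ i s → Dec (+ hook μ s ≡ + g - + i × ε′ s ≡ 1ℤ)
  P? i s = (+ hook μ s ℤ.≟ + g - + i) ×-dec (ε′ s ℤ.≟ 1ℤ)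
  lemma : ∀ a b d → a - b ≡ d - b + (a - d)
  lemma = solve-∀
  ε′-values : ∀ s → ε′ s ≡ 1ℤ ⊎ ε′ s ≡ -1ℤ
  ε′-values (i , j) with i ℕ.<ᵇ j
  ... | true  = inj₁ refl
  ... | false = inj₂ refl
  vanish : ∀ s → (∀ i → 1 ℕ.≤ i → ¬ (+ hook μ s ≡ + g - + i × ε′ s ≡ 1ℤ)) → ∑[ i ∈ [1⋯ g ℕ.∸ 1 ] ] 𝟙 (P? i s) * c i ≡ 0ℤ
  vanish s ¬P = trans (∑-cong [1⋯ g ℕ.∸ 1 ] (λ i i∈ → cong (_* c i) (𝟙-no (P? i s) (¬P i (proj₁ (∈-[1⋯]⁻ i∈)))))) (∑-0 [1⋯ g ℕ.∸ 1 ])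
  nonneg : ∀ {x} → 0ℤ ≤ x → 0ℤ ≡ f x - reduce-abs f x
  nonneg {x} 0≤x = sym (trans (cong (λ z → f x - z) (reduce-abs-nonneg f 0≤x)) (ℤ.+-inverseʳ (f x)))
  correction : ∀ s → ∑[ i ∈ [1⋯ g ℕ.∸ 1 ] ] 𝟙 (P? i s) * c i ≡ f (+ hook μ s - ε′ s * + g) - reduce-abs f (+ hook μ s - ε′ s * + g)
  correction s with ε′-values s | hook μ s ℕ.<? g
  ... | inj₂ ε≡-1 | _ = trans (vanish s (λ i _ (_ , ε≡1) → contradiction (trans (sym ε≡1) ε≡-1) (λ ())))
    (nonneg (subst (λ e → 0ℤ ≤ + hook μ s - e * + g) (sym ε≡-1) (subst (0ℤ ≤_) (lemma₂ (+ hook μ s) (+ g)) (+≤+ z≤n))))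
    where
    lemma₂ : ∀ h g → h + g ≡ h - -1ℤ * g
    lemma₂ = solve-∀
  ... | inj₁ ε≡1 | no h≮g = trans (vanish s (λ i 1≤i (h≡ , _) → h≮g (ℤ.drop‿+<+ (subst (_< + g) (sym h≡) (from-gap (ℕ-gap 1≤i) (lemma₃ (+ g) (+ i)))))))
    (nonneg (subst (λ e → 0ℤ ≤ + hook μ s - e * + g) (sym ε≡1) (subst (0ℤ ≤_) (lemma₂ (+ hook μ s) (+ g)) (ℕ-gap (ℕ.≮⇒≥ h≮g)))))
    where
    lemma₂ : ∀ h g → h - g ≡ h - 1ℤ * g
    lemma₂ = solve-∀
    lemma₃ : ∀ g i → i - 1ℤ ≡ g - (g - i) - 1ℤ
    lemma₃ = solve-∀
  ... | inj₁ ε≡1 | yes h<g = begin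
    (∑[ i ∈ [1⋯ g ℕ.∸ 1 ] ] 𝟙 (P? i s) * c i)
      ≡⟨ ∑-ext [1⋯ g ℕ.∸ 1 ] (λ i → cong (_* c i) (𝟙-⇔ (P? i s) (i ℕ.≟ i₀) (to i) (from i))) ⟩
    (∑[ i ∈ [1⋯ g ℕ.∸ 1 ] ] 𝟙 (i ℕ.≟ i₀) * c i)
      -- A hook length is at least 1, so `i₀` stays within `g - 1`.
      ≡⟨ ∑-δ ℕ._≟_ ([1⋯]-unique (g ℕ.∸ 1)) (∈-[1⋯]⁺ (ℕ.m<n⇒0<n∸m h<g) (ℕ.∸-monoʳ-≤ g (s≤s z≤n))) c ⟩
    f (- + i₀) - f (+ i₀)
      ≡⟨ cong₂ _-_ (cong f (sym argument)) (trans (sym (reduce-abs-even f (+ i₀))) (cong (reduce-abs f) (sym argument))) ⟩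
    f (+ hook μ s - ε′ s * + g) - reduce-abs f (+ hook μ s - ε′ s * + g)
      ∎
    where
    i₀ = g ℕ.∸ hook μ s
    +i₀ : + i₀ ≡ + g - + hook μ s
    +i₀ = trans (sym (ℤ.⊖-≥ (ℕ.<⇒≤ h<g))) (sym (ℤ.m-n≡m⊖n g (hook μ s)))
    argument : + hook μ s - ε′ s * + g ≡ - + i₀
    argument = trans (cong (λ e → + hook μ s - e * + g) ε≡1) (trans (lemma₂ (+ hook μ s) (+ g)) (cong -_ (sym +i₀)))
      where
      lemma₂ : ∀ h g → h - 1ℤ * g ≡ - (g - h)
      lemma₂ = solve-∀
    to : ∀ i → + hook μ s ≡ + g - + i × ε′ s ≡ 1ℤ → i ≡ i₀
    to i (h≡ , _) = ℤ.+-injective (trans (sym (i-[i-j]≡j (+ g) (+ i))) (trans (cong (λ z → + g - z) (sym h≡)) (sym +i₀)))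
    from : ∀ i → i ≡ i₀ → + hook μ s ≡ + g - + i × ε′ s ≡ 1ℤ
    from i refl = trans (sym (i-[i-j]≡j (+ g) (+ hook μ s))) (cong (λ z → + g - z) (sym +i₀)) , ε≡1

-- Specialising the box sums to the size and to the hook quotients

private
  2*-cancel : ∀ {i j} → + 2 * i ≡ + 2 * j → i ≡ j
  2*-cancel {i} {j} = ℤ.*-cancelˡ-≡ (+ 2) i j

module Assembly (p : ℕ) (1≤p : 1 ℕ.≤ p) (g : ℕ) (g≡2p : g ≡ 2 ℕ.* p) (μ : Partition) (legs : LegsExceedArms μ)
  (ν : Fin g → Partition) (quotient : IsQuotient g μ ν)
  (rest : ∀ k → suc (toℕ k) ≢ p → suc (toℕ k) ≢ g → ν k ≡ ∅)
  (last : ∀ k → suc (toℕ k) ≡ g → ∃ λ m → ν k ≡ rectangle (suc m) m)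
  (middle : ∀ k → suc (toℕ k) ≡ p → ∃ λ m → ν k ≡ rectangle m m)
  (v : Fin (suc p) → ℤ) (coding : IsCoding g (suc p) μ v) where

  open Coding p 1≤p g g≡2p μ legs ν quotient rest last middle v coding using (ρ; 0≤r; r-decreasing; ρ-folds; telescope)
  open Coding p 1≤p g g≡2p μ legs ν quotient rest last middle v coding public using (r)

  private
    U = positiveVerticals μ
    I = allFin (suc p)

    κ : Fin (suc p) → ℤ
    κ = descending p

    +g : + g ≡ + 2 * + p
    +g = trans (cong +_ g≡2p) (ℤ.pos-* 2 p)

    -- The case `A = B = 1`: `Φ` is constant, so the double sum vanishes.
    twice-size : + 2 * + size μ ≡ ∑[ m ∈ U ] + 4 * + m
    twice-size = trans (cong (+ 2 *_) (sym (size-boxes μ))) (trans (box-sum-formula (λ _ _ → 1ℤ) refl refl)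
      (trans (cong₂ _+_ (∑-ext U single≡) (trans (∑-ext U (λ m → ∑-0 U)) (∑-0 U))) (ℤ.+-identityʳ _)))
      where
      open BoxSumFormula μ legs (λ _ → 1ℤ) (λ _ → 1ℤ) (λ _ → refl)
      single≡ : ∀ m → single m ≡ + 4 * + m
      single≡ m = trans (cong (λ z → + 2 + 0ℤ + (+ 2 * z - + 2)) (trans (∑-const (upTo m) (+ 2)) (cong (λ n → + n * + 2) (List.length-upTo m)))) (lemma (+ m))
        where
        lemma : ∀ m → + 2 + 0ℤ + (+ 2 * (m * + 2) - + 2) ≡ + 4 * m
        lemma = solve-∀

    squares : ∑[ i ∈ I ] ρ i * ρ i ≡ ∑[ k ∈ upTo (suc p) ] + k * + k
    squares = ρ-folds (λ x → x * x) (λ x → lemma x)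
      where
      lemma : ∀ x → - x * - x ≡ x * x
      lemma = solve-∀

    g*size : + g * + size μ ≡ (∑[ i ∈ I ] r i * r i) - (∑[ k ∈ upTo (suc p) ] + k * + k)
    g*size = begin
      + g * + size μ                                           ≡⟨ cong (_* + size μ) +g ⟩
      + 2 * + p * + size μ                                     ≡⟨ lemma (+ p) (+ size μ) ⟩
      + p * (+ 2 * + size μ)                                   ≡⟨ cong (+ p *_) twice-size ⟩
      + p * (∑[ m ∈ U ] + 4 * + m)                             ≡⟨ ∑-* (+ p) U (λ m → + 4 * + m) ⟨
      (∑[ m ∈ U ] + p * (+ 4 * + m))                           ≡⟨ ∑-ext U (λ m → lemma₂ (+ p) (+ m)) ⟩
      (∑[ m ∈ U ] ((+ m + + p) * (+ m + + p) - (+ m - + p) * (+ m - + p)))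
                                                               ≡⟨ telescope (λ x → x * x) ⟩
      (∑[ i ∈ I ] (r i * r i - ρ i * ρ i))                     ≡⟨ ∑-- I (λ i → r i * r i) (λ i → ρ i * ρ i) ⟩
      (∑[ i ∈ I ] r i * r i) - (∑[ i ∈ I ] ρ i * ρ i)          ≡⟨ cong (λ z → (∑[ i ∈ I ] r i * r i) - z) squares ⟩
      (∑[ i ∈ I ] r i * r i) - (∑[ k ∈ upTo (suc p) ] + k * + k) ∎
      where
      open ≡-Reasoning
      lemma : ∀ p s → + 2 * p * s ≡ p * (+ 2 * s)
      lemma = solve-∀
      lemma₂ : ∀ p m → p * (+ 4 * m) ≡ (m + p) * (m + p) - (m - p) * (m - p)
      lemma₂ = solve-∀

  -- The constant is `0² + … + p²`, that is `p (p + 1) (2p + 1) / 6`, rewritten with `g = 2p`.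
  size-identity : + g * (+ 12 * + size μ) ≡ + 12 * (∑[ i ∈ I ] r i * r i) - + g * + ((p ℕ.+ 1) ℕ.* (g ℕ.+ 1))
  size-identity = begin
    + g * (+ 12 * + size μ)                       ≡⟨ lemma (+ g) (+ size μ) ⟩
    + 12 * (+ g * + size μ)                       ≡⟨ cong (+ 12 *_) g*size ⟩
    + 12 * (S - Q)                                ≡⟨ lemma₂ S Q ⟩
    + 12 * S - + 2 * (+ 6 * Q)                    ≡⟨ cong (λ z → + 12 * S - + 2 * z) (∑-squares (suc p)) ⟩
    + 12 * S - + 2 * ((+ suc p - 1ℤ) * + suc p * (+ 2 * + suc p - 1ℤ))
                                                  ≡⟨ cong (λ z → + 12 * S - + 2 * ((z - 1ℤ) * z * (+ 2 * z - 1ℤ))) (ℤ.pos-+ 1 p) ⟩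
    + 12 * S - + 2 * ((1ℤ + + p - 1ℤ) * (1ℤ + + p) * (+ 2 * (1ℤ + + p) - 1ℤ))
                                                  ≡⟨ cong (λ z → + 12 * S - z) (lemma₃ (+ p)) ⟩
    + 12 * S - + 2 * + p * ((+ p + 1ℤ) * (+ 2 * + p + 1ℤ))
                                                  ≡⟨ cong (λ z → + 12 * S - z * ((+ p + 1ℤ) * (z + 1ℤ))) +g ⟨
    + 12 * S - + g * ((+ p + 1ℤ) * (+ g + 1ℤ))    ≡⟨ cong (λ z → + 12 * S - + g * z) (trans (ℤ.pos-* (p ℕ.+ 1) (g ℕ.+ 1)) (cong₂ _*_ (ℤ.pos-+ p 1) (ℤ.pos-+ g 1))) ⟨
    + 12 * S - + g * + ((p ℕ.+ 1) ℕ.* (g ℕ.+ 1))  ∎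
    where
    open ≡-Reasoning
    S = ∑[ i ∈ I ] r i * r i
    Q = ∑[ k ∈ upTo (suc p) ] + k * + k
    lemma : ∀ g s → g * (+ 12 * s) ≡ + 12 * (g * s)
    lemma = solve-∀
    lemma₂ : ∀ s q → + 12 * (s - q) ≡ + 12 * s - + 2 * (+ 6 * q)
    lemma₂ = solve-∀
    lemma₃ : ∀ p → + 2 * ((1ℤ + p - 1ℤ) * (1ℤ + p) * (+ 2 * (1ℤ + p) - 1ℤ)) ≡ + 2 * p * ((p + 1ℤ) * (+ 2 * p + 1ℤ))
    lemma₃ = solve-∀

  module _ (f : ℤ → ℤ) (even : ∀ n → f (- n) ≡ f n) where

    private
      module E = EvenFunction f even p

      G = + 2 * + p

      -- The argument `e` stands for `ε′`. Its two cases add up to the second difference `E.Φ`,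
      -- which inherits evenness from `f`.
      H : ℤ → ℤ → ℤ
      H e h = f (h - e * + g) - f h

      minus : ∀ n → n - 1ℤ * + g ≡ n - G
      minus n = cong (λ z → n - z) (trans (ℤ.*-identityˡ (+ g)) +g)

      plus : ∀ n → n - -1ℤ * + g ≡ n + G
      plus n = trans (lemma n (+ g)) (cong (_+_ n) +g)
        where
        lemma : ∀ n g → n - -1ℤ * g ≡ n + g
        lemma = solve-∀

      H-sum : ∀ n → H 1ℤ n + H -1ℤ n ≡ E.Φ n
      H-sum n = trans (cong₂ (λ a b → f a - f n + (f b - f n)) (minus n) (plus n)) (lemma (f (n - G)) (f (n + G)) (f n))
        where
        lemma : ∀ a b c → a - c + (b - c) ≡ b + a - + 2 * c
        lemma = solve-∀

      E-Φ-even : ∀ n → E.Φ (- n) ≡ E.Φ n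
      E-Φ-even n = trans (cong₂ (λ a b → a + b - + 2 * f (- n)) (flip (lemma₁ n G)) (flip (lemma₂ n G))) (trans (cong (λ z → f (n - G) + f (n + G) - + 2 * z) (even n))
        (cong (_- + 2 * f n) (ℤ.+-comm (f (n - G)) (f (n + G)))))
        where
        flip : ∀ {x y} → x ≡ - y → f x ≡ f y
        flip {y = y} refl = even y
        lemma₁ : ∀ n g → - n + g ≡ - (n - g)
        lemma₁ = solve-∀
        lemma₂ : ∀ n g → - n - g ≡ - (n + g)
        lemma₂ = solve-∀

      module S = BoxSumFormula μ legs (H 1ℤ) (H -1ℤ) (λ n → trans (H-sum (- n)) (trans (E-Φ-even n) (sym (H-sum n))))

      single≡ : ∀ m → S.single m ≡ + 2 * (f (+ m + G) - f (+ m)) + (f (+ m + + m + G) - f (+ m + + m - G))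
        + (+ 2 * (∑[ k ∈ upTo m ] E.Φ (+ k)) - + 2 * (f G - f 0ℤ))
      single≡ m = cong₂ _+_ (cong₂ _+_ (cong (λ z → + 2 * (f z - f (+ m))) (plus (+ m))) doubled)
        (cong₂ _-_ (cong (+ 2 *_) (∑-ext (upTo m) (λ k → H-sum (+ k)))) (trans (H-sum 0ℤ) at-0))
        where
        x = + m + + m
        doubled : + 2 * H -1ℤ x - (H 1ℤ x + H -1ℤ x) ≡ f (x + G) - f (x - G)
        doubled = trans (cong₂ (λ a b → + 2 * (f b - f x) - (f a - f x + (f b - f x))) (minus x) (plus x)) (lemma (f (x - G)) (f (x + G)) (f x))
          where
          lemma : ∀ a b c → + 2 * (b - c) - (a - c + (b - c)) ≡ b - a
          lemma = solve-∀
        at-0 : E.Φ 0ℤ ≡ + 2 * (f G - f 0ℤ)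
        at-0 = trans (cong₂ (λ a b → a + b - + 2 * f 0ℤ) (cong f (ℤ.+-identityˡ G)) (trans (cong f (ℤ.+-identityˡ (- G))) (even G))) (lemma (f G) (f 0ℤ))
          where
          lemma : ∀ a b → a + a - + 2 * b ≡ + 2 * (a - b)
          lemma = solve-∀

    -- `ρ` and `κ` both fold to `0, …, p`, so `κ` may replace `ρ` in `Ψ`. The terms `f 0ℤ` cancel
    -- because `r` and `κ` have equally many entries.
    even-sum : ∑[ s ∈ boxes μ ] (f (+ hook μ s - ε′ s * + g) - f (+ hook μ s)) ≡ E.half r - E.half κ
    even-sum = 2*-cancel (begin
      + 2 * (∑[ s ∈ boxes μ ] (f (+ hook μ s - ε′ s * + g) - f (+ hook μ s)))
        ≡⟨ S.box-sum-formula H refl refl ⟩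
      ∑ U S.single + (∑[ m ∈ U ] ∑[ n ∈ U ] (S.Φ (+ m + + n) - S.Φ (+ m - + n)))
        ≡⟨ cong (_+_ (∑ U S.single)) (∑-ext U λ m → ∑-ext U λ n → cong₂ _-_ (H-sum (+ m + + n)) (H-sum (+ m - + n))) ⟩
      ∑ U S.single + (∑[ m ∈ U ] ∑[ n ∈ U ] (E.Φ (+ m + + n) - E.Φ (+ m - + n)))
        ≡⟨ E.telescoped U r ρ telescope ρ-folds S.single single≡ ⟩
      E.Ψ r - E.Ψ ρ
        ≡⟨ cong (λ z → E.Ψ r - z) (trans (E.Ψ-folds ρ ρ-folds) (sym (E.Ψ-folds κ (descending-folds p)))) ⟩
      E.Ψ r - E.Ψ κ
        ≡⟨ lemma (E.Ψ r) (E.Ψ κ) (∑[ i ∈ I ] f 0ℤ) ⟩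
      (E.Ψ r - (∑[ i ∈ I ] f 0ℤ)) - (E.Ψ κ - (∑[ i ∈ I ] f 0ℤ))
        ≡⟨ cong₂ _-_ (E.double-half r) (E.double-half κ) ⟨
      + 2 * E.half r - + 2 * E.half κ
        ≡⟨ lemma₂ (E.half r) (E.half κ) ⟨
      + 2 * (E.half r - E.half κ)
        ∎)
      where
      open ≡-Reasoning
      lemma : ∀ a b c → a - b ≡ (a - c) - (b - c)
      lemma = solve-∀
      lemma₂ : ∀ a b → + 2 * (a - b) ≡ + 2 * a - + 2 * b
      lemma₂ = solve-∀

  hooks : List (ℤ × ℤ)
  hooks = map (λ s → + hook μ s - ε′ s * + g , + hook μ s) (boxes μ)

  conjugate-hooks : List (ℤ × ℤ)
  conjugate-hooks = map (λ s → + hook (conj μ) s + ε s * + g , + hook (conj μ) s) (boxes (conj μ))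

  pairTerms : Fin (suc p) → Fin (suc p) → List (ℤ × ℤ)
  pairTerms i j = (r i - r j , + index j - + index i) ∷ (r i + r j , + g + + 2 - + index i - + index j) ∷ []

  pairsAfter : Fin (suc p) → List (ℤ × ℤ)
  pairsAfter i = concatMap (pairTerms i) (after i)

  corrections doubles smalls pairs : List (ℤ × ℤ)
  corrections = concatMap (λ i → replicate (α g i μ) (- + i , + i)) [1⋯ g ℕ.∸ 1 ]
  doubles     = map (λ i → + 2 * r i , r i) I
  smalls      = map (λ i → + i , + 2 * + i) [1⋯ p ]
  pairs       = concatMap pairsAfter I

  -- The formal quotient tested against `f`; two lists with the same degree for every `f` have the
  -- same product.
  degree : (ℤ → ℤ) → List (ℤ × ℤ) → ℤ
  degree f xs = ∑[ (a , b) ∈ xs ] (f a - f b)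

  conjugate-degree : ∀ f → degree f hooks ≡ degree f conjugate-hooks
  conjugate-degree f = trans (∑-map _ (boxes μ) (λ (a , b) → f a - f b)) (trans
    (∑-conj μ (λ s → f (+ hook μ s - ε′ s * + g) - f (+ hook μ s)) (λ s → f (+ hook (conj μ) s + ε s * + g) - f (+ hook (conj μ) s)) transposed)
    (sym (∑-map _ (boxes (conj μ)) (λ (a , b) → f a - f b))))
    where
    lemma : ∀ h e g → h - e * g ≡ h + - e * g
    lemma = solve-∀
    transposed : ∀ i j → 1 ℕ.≤ i → 1 ℕ.≤ j →
      f (+ hook μ (i , j) - ε′ (i , j) * + g) - f (+ hook μ (i , j))
      ≡ f (+ hook (conj μ) (j , i) + ε (j , i) * + g) - f (+ hook (conj μ) (j , i))
    transposed i j 1≤i _ = trans (cong (λ h → f (+ h - ε′ (i , j) * + g) - f (+ h)) (hook-conj μ {i} {j} 1≤i))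
      (cong (λ z → f z - f (+ hook (conj μ) (j , i))) (trans (lemma (+ hook (conj μ) (j , i)) (ε′ (i , j)) (+ g))
        (cong (λ e → + hook (conj μ) (j , i) + e * + g) (sym (ε-transpose i j)))))

  private
    module _ (f : ℤ → ℤ) where

      f̄ = reduce-abs f
      module Ē = EvenFunction f̄ (reduce-abs-even f) p

      at-r : ℤ
      at-r = (∑[ i ∈ I ] (f (+ 2 * r i) - f (r i))) + (∑[ i ∈ I ] ∑[ j ∈ after i ] (f (r i - r j) + f (r i + r j)))

      at-κ : ℤ
      at-κ = (∑[ i ∈ [1⋯ p ] ] (f (+ 2 * + i) - f (+ i))) + (∑[ i ∈ I ] ∑[ j ∈ after i ] (f (+ index j - + index i) + f (+ g + + 2 - + index i - + index j)))

      after-< : ∀ {i j : Fin (suc p)} → j ∈ after i → i Fin.< j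
      after-< {i} j∈ = proj₂ (∈-filter⁻ (i Fin.<?_) {xs = allFin (suc p)} j∈)

      -- Since `r` is nonnegative and decreasing, every argument is nonnegative and `f̄` agrees with
      -- `f` there.
      half-r : Ē.half r ≡ at-r
      half-r = cong₂ _+_
        (∑-ext I λ i → cong₂ _-_ (reduce-abs-nonneg f (0≤-* (+≤+ (z≤n {2})) (0≤r i))) (reduce-abs-nonneg f (0≤r i)))
        (∑-ext I λ i → ∑-cong (after i) λ j j∈ → trans (ℤ.+-comm (f̄ (r i + r j)) (f̄ (r i - r j)))
          (cong₂ _+_ (reduce-abs-nonneg f (ℤ.i≤j⇒0≤j-i (ℤ.<⇒≤ (r-decreasing i j (after-< j∈))))) (reduce-abs-nonneg f (0≤-+ (0≤r i) (0≤r j)))))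

      half-κ : Ē.half κ ≡ at-κ
      half-κ = cong₂ _+_ singles (∑-ext I λ i → ∑-cong (after i) λ j j∈ → pair i j (after-< j∈))
        where
        open ≡-Reasoning
        singles : ∑[ i ∈ I ] (f̄ (+ 2 * κ i) - f̄ (κ i)) ≡ ∑[ i ∈ [1⋯ p ] ] (f (+ 2 * + i) - f (+ i))
        singles = begin
          (∑[ i ∈ I ] (f̄ (+ 2 * κ i) - f̄ (κ i)))
            -- The entry 0 of `κ` contributes nothing, which leaves `1, …, p`.
            ≡⟨ descending-folds p (λ x → f̄ (+ 2 * x) - f̄ x) (λ x → cong₂ _-_ (trans (cong f̄ (lemma x)) (reduce-abs-even f (+ 2 * x))) (reduce-abs-even f x)) ⟩
          f̄ 0ℤ - f̄ 0ℤ + (∑[ k ∈ [1⋯ p ] ] (f̄ (+ 2 * + k) - f̄ (+ k)))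
            ≡⟨ cong (_+ (∑[ k ∈ [1⋯ p ] ] (f̄ (+ 2 * + k) - f̄ (+ k)))) (ℤ.+-inverseʳ (f̄ 0ℤ)) ⟩
          0ℤ + (∑[ k ∈ [1⋯ p ] ] (f̄ (+ 2 * + k) - f̄ (+ k)))
            ≡⟨ ℤ.+-identityˡ _ ⟩
          (∑[ k ∈ [1⋯ p ] ] (f̄ (+ 2 * + k) - f̄ (+ k)))
            ≡⟨ ∑-ext [1⋯ p ] (λ k → cong (_- f (+ k)) (reduce-abs-nonneg f (0≤-* (+≤+ (z≤n {2})) (+≤+ (z≤n {k}))))) ⟩
          (∑[ i ∈ [1⋯ p ] ] (f (+ 2 * + i) - f (+ i)))
            ∎
          where
          lemma : ∀ x → + 2 * - x ≡ - (+ 2 * x)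
          lemma = solve-∀
        pair : ∀ i j → i Fin.< j → f̄ (κ i + κ j) + f̄ (κ i - κ j) ≡ f (+ index j - + index i) + f (+ g + + 2 - + index i - + index j)
        pair i j i<j = trans (ℤ.+-comm (f̄ (κ i + κ j)) (f̄ (κ i - κ j))) (cong₂ _+_
          (trans (reduce-abs-nonneg f (subst (0ℤ ≤_) (lemma₁ (+ toℕ i) (+ toℕ j) (+ p)) (ℕ-gap (ℕ.<⇒≤ i<j))))
            (cong f (trans (lemma₂ (+ toℕ i) (+ toℕ j) (+ p)) (cong₂ _-_ (sym (ℤ.pos-+ 1 (toℕ j))) (sym (ℤ.pos-+ 1 (toℕ i)))))))
          (trans (reduce-abs-nonneg f (0≤-+ (ℕ-gap (ℕ.≤-pred (Fin.toℕ<n i))) (ℕ-gap (ℕ.≤-pred (Fin.toℕ<n j)))))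
            (cong f (trans (lemma₃ (+ toℕ i) (+ toℕ j) (+ p)) (trans (cong (λ z → z + + 2 - (1ℤ + + toℕ i) - (1ℤ + + toℕ j)) (sym +g))
              (cong₂ (λ a b → + g + + 2 - a - b) (sym (ℤ.pos-+ 1 (toℕ i))) (sym (ℤ.pos-+ 1 (toℕ j)))))))))
          where
          lemma₁ : ∀ i j p → j - i ≡ p - i - (p - j)
          lemma₁ = solve-∀
          lemma₂ : ∀ i j p → p - i - (p - j) ≡ 1ℤ + j - (1ℤ + i)
          lemma₂ = solve-∀
          lemma₃ : ∀ i j p → p - i + (p - j) ≡ + 2 * p + + 2 - (1ℤ + i) - (1ℤ + j)
          lemma₃ = solve-∀

      fold-degree : ℤ × ℤ → ℤ
      fold-degree (a , b) = f a - f b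

      ∑-replicate : ∀ n x → ∑ (replicate n x) fold-degree ≡ + n * fold-degree x
      ∑-replicate zero    x = refl
      ∑-replicate (suc n) x = trans (cong (_+_ (fold-degree x)) (∑-replicate n x)) (trans (lemma (+ n) (fold-degree x)) (cong (_* fold-degree x) (sym (ℤ.pos-+ 1 n))))
        where
        lemma : ∀ n x → x + n * x ≡ (1ℤ + n) * x
        lemma = solve-∀

      corrections-degree : degree f corrections ≡ ∑[ i ∈ [1⋯ g ℕ.∸ 1 ] ] + α g i μ * (f (- + i) - f (+ i))
      corrections-degree = trans (∑-concatMap (λ i → replicate (α g i μ) (- + i , + i)) [1⋯ g ℕ.∸ 1 ] fold-degree)
        (∑-ext [1⋯ g ℕ.∸ 1 ] λ i → ∑-replicate (α g i μ) (- + i , + i))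

      pairs-degree : degree f pairs ≡ (∑[ i ∈ I ] ∑[ j ∈ after i ] (f (r i - r j) + f (r i + r j)))
        - (∑[ i ∈ I ] ∑[ j ∈ after i ] (f (+ index j - + index i) + f (+ g + + 2 - + index i - + index j)))
      pairs-degree = trans (∑-concatMap pairsAfter I fold-degree) (trans (∑-ext I λ i → trans (∑-concatMap (pairTerms i) (after i) fold-degree)
        (trans (∑-ext (after i) λ j → lemma (f (r i - r j)) (f (+ index j - + index i)) (f (r i + r j)) (f (+ g + + 2 - + index i - + index j)))
          (∑-- (after i) (λ j → f (r i - r j) + f (r i + r j)) (λ j → f (+ index j - + index i) + f (+ g + + 2 - + index i - + index j)))))
        (∑-- I (λ i → ∑[ j ∈ after i ] (f (r i - r j) + f (r i + r j))) (λ i → ∑[ j ∈ after i ] (f (+ index j - + index i) + f (+ g + + 2 - + index i - + index j)))))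
        where
        lemma : ∀ a b c d → a - b + (c - d + 0ℤ) ≡ (a + c) - (b + d)
        lemma = solve-∀

      smalls-degree : degree f smalls ≡ - (∑[ i ∈ [1⋯ p ] ] (f (+ 2 * + i) - f (+ i)))
      smalls-degree = trans (∑-map _ [1⋯ p ] fold-degree) (trans (∑-- [1⋯ p ] (λ i → f (+ i)) (λ i → f (+ 2 * + i)))
        (trans (lemma (∑[ i ∈ [1⋯ p ] ] f (+ i)) (∑[ i ∈ [1⋯ p ] ] f (+ 2 * + i))) (cong -_ (sym (∑-- [1⋯ p ] (λ i → f (+ 2 * + i)) (λ i → f (+ i)))))))
        where
        lemma : ∀ a b → a - b ≡ - (b - a)
        lemma = solve-∀

  hooks-degree : ∀ f → degree f hooks ≡ degree f (((corrections ++ doubles) ++ smalls) ++ pairs)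
  hooks-degree f = begin
    degree f hooks
      ≡⟨ ∑-map _ (boxes μ) (fold-degree f) ⟩
    (∑[ s ∈ boxes μ ] (f (+ hook μ s - ε′ s * + g) - f (+ hook μ s)))
      ≡⟨ ∑-α μ g f ⟩
    (∑[ s ∈ boxes μ ] (f̄ f (+ hook μ s - ε′ s * + g) - f̄ f (+ hook μ s))) + C
      ≡⟨ cong (_+ C) (trans (even-sum (f̄ f) (reduce-abs-even f)) (cong₂ _-_ (half-r f) (half-κ f))) ⟩
    at-r f - at-κ f + C
      ≡⟨ lemma (∑[ i ∈ I ] (f (+ 2 * r i) - f (r i))) _ _ _ C ⟩
    C + (∑[ i ∈ I ] (f (+ 2 * r i) - f (r i))) + - (∑[ i ∈ [1⋯ p ] ] (f (+ 2 * + i) - f (+ i)))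
      + ((∑[ i ∈ I ] ∑[ j ∈ after i ] (f (r i - r j) + f (r i + r j)))
        - (∑[ i ∈ I ] ∑[ j ∈ after i ] (f (+ index j - + index i) + f (+ g + + 2 - + index i - + index j))))
      ≡⟨ cong₂ _+_ (cong₂ _+_ (cong₂ _+_ (corrections-degree f) (∑-map _ I (fold-degree f))) (smalls-degree f)) (pairs-degree f) ⟨
    degree f corrections + degree f doubles + degree f smalls + degree f pairs
      ≡⟨ cong (λ z → z + degree f smalls + degree f pairs) (∑-++ corrections doubles (fold-degree f)) ⟨
    degree f (corrections ++ doubles) + degree f smalls + degree f pairs
      ≡⟨ cong (_+ degree f pairs) (∑-++ (corrections ++ doubles) smalls (fold-degree f)) ⟨
    degree f ((corrections ++ doubles) ++ smalls) + degree f pairs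
      ≡⟨ ∑-++ ((corrections ++ doubles) ++ smalls) pairs (fold-degree f) ⟨
    degree f (((corrections ++ doubles) ++ smalls) ++ pairs)
      ∎
    where
    open ≡-Reasoning
    C = ∑[ i ∈ [1⋯ g ℕ.∸ 1 ] ] + α g i μ * (f (- + i) - f (+ i))
    lemma : ∀ a b c d e → a + b - (c + d) + e ≡ e + a + - c + (b - d)
    lemma = solve-∀

  module _ {c ℓ₁ ℓ₂} (F : HeytingField c ℓ₁ ℓ₂) (τ : ℤ → Products.F× F) where

    open Products F
    open FormalQuotients F
    open import Relation.Binary.Reasoning.Setoid ≈-setoid

    private
      τ÷ : ℤ × ℤ → Carrier
      τ÷ (a , b) = τ a ÷ τ b

    conjugate-product :
      (∏[ s ∈ boxes μ ] (τ (+ hook μ s - ε′ s * + g) ÷ τ (+ hook μ s)))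
        ≈ (∏[ s ∈ boxes (conj μ) ] (τ (+ hook (conj μ) s + ε s * + g) ÷ τ (+ hook (conj μ) s)))
    conjugate-product = begin
      ∏ (boxes μ) (λ s → τ (+ hook μ s - ε′ s * + g) ÷ τ (+ hook μ s))  ≈⟨ ∏-map _ (boxes μ) τ÷ ⟨
      ⟦ τ ⟧ hooks                                                        ≈⟨ ⟦⟧-cong τ hooks conjugate-hooks conjugate-degree ⟩
      ⟦ τ ⟧ conjugate-hooks                                              ≈⟨ ∏-map _ (boxes (conj μ)) τ÷ ⟩
      ∏ (boxes (conj μ)) (λ s → τ (+ hook (conj μ) s + ε s * + g) ÷ τ (+ hook (conj μ) s)) ∎

    hook-product :
      (∏[ s ∈ boxes (conj μ) ] (τ (+ hook (conj μ) s + ε s * + g) ÷ τ (+ hook (conj μ) s)))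
        ≈ (∏[ i ∈ [1⋯ g ℕ.∸ 1 ] ] (τ (- + i) ÷ τ (+ i)) ^ α g i μ)
        · (∏[ i ∈ I ] (τ (+ 2 * r i) ÷ τ (r i)))
        · (∏[ i ∈ [1⋯ p ] ] (τ (+ i) ÷ τ (+ 2 * + i)))
        · (∏[ i ∈ I ] (∏[ j ∈ after i ]
            ( τ (r i - r j) ÷ τ (+ index j - + index i)
            · τ (r i + r j) ÷ τ (+ g + + 2 - + index i - + index j))))
    hook-product = begin
      ∏ (boxes (conj μ)) (λ s → τ (+ hook (conj μ) s + ε s * + g) ÷ τ (+ hook (conj μ) s))
        ≈⟨ ∏-map _ (boxes (conj μ)) τ÷ ⟨
      ⟦ τ ⟧ conjugate-hooks
        ≈⟨ ⟦⟧-cong τ conjugate-hooks (((corrections ++ doubles) ++ smalls) ++ pairs) (λ f → trans (sym (conjugate-degree f)) (hooks-degree f)) ⟩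
      ⟦ τ ⟧ (((corrections ++ doubles) ++ smalls) ++ pairs)
        ≈⟨ ∏-++ ((corrections ++ doubles) ++ smalls) pairs τ÷ ⟩
      ⟦ τ ⟧ ((corrections ++ doubles) ++ smalls) · ⟦ τ ⟧ pairs
        ≈⟨ *-congʳ (∏-++ (corrections ++ doubles) smalls τ÷) ⟩
      ⟦ τ ⟧ (corrections ++ doubles) · ⟦ τ ⟧ smalls · ⟦ τ ⟧ pairs
        ≈⟨ *-congʳ (*-congʳ (∏-++ corrections doubles τ÷)) ⟩
      ⟦ τ ⟧ corrections · ⟦ τ ⟧ doubles · ⟦ τ ⟧ smalls · ⟦ τ ⟧ pairs
        ≈⟨ *-cong (*-cong (*-cong corrections≈ (∏-map _ I τ÷)) (∏-map _ [1⋯ p ] τ÷)) pairs≈ ⟩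
      ∏ [1⋯ g ℕ.∸ 1 ] (λ i → (τ (- + i) ÷ τ (+ i)) ^ α g i μ)
        · ∏ I (λ i → τ (+ 2 * r i) ÷ τ (r i))
        · ∏ [1⋯ p ] (λ i → τ (+ i) ÷ τ (+ 2 * + i))
        · ∏ I (λ i → ∏ (after i) (pair i))
        ∎
      where
      pair : Fin (suc p) → Fin (suc p) → Carrier
      pair i j = τ (r i - r j) ÷ τ (+ index j - + index i) · τ (r i + r j) ÷ τ (+ g + + 2 - + index i - + index j)
      corrections≈ : ⟦ τ ⟧ corrections ≈ ∏ [1⋯ g ℕ.∸ 1 ] (λ i → (τ (- + i) ÷ τ (+ i)) ^ α g i μ)
      corrections≈ = ≈-trans (∏-concatMap (λ i → replicate (α g i μ) (- + i , + i)) [1⋯ g ℕ.∸ 1 ] τ÷)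
        (∏-ext [1⋯ g ℕ.∸ 1 ] λ i → ∏-replicate (α g i μ) (- + i , + i) τ÷)
      pairs≈ : ⟦ τ ⟧ pairs ≈ ∏ I (λ i → ∏ (after i) (pair i))
      pairs≈ = ≈-trans (∏-concatMap pairsAfter I τ÷) (∏-ext I λ i → ≈-trans (∏-concatMap (pairTerms i) (after i) τ÷)
        (∏-ext (after i) λ j → *-congˡ (*-identityʳ _)))

-- From `t` to `p = t - 1`

private
  2*t∸2≡2*p : ∀ p′ → 2 ℕ.* suc (suc p′) ℕ.∸ 2 ≡ 2 ℕ.* suc p′
  2*t∸2≡2*p p′ = ℕ.+-suc p′ (suc (p′ ℕ.+ 0))

  suc[2*t∸3] : ∀ p′ → suc (2 ℕ.* suc (suc p′) ℕ.∸ 3) ≡ 2 ℕ.* suc (suc p′) ℕ.∸ 2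
  suc[2*t∸3] p′ = ℕ.m+[n∸m]≡n {1} {p′ ℕ.+ suc (suc (p′ ℕ.+ 0))} (ℕ.≤-trans (s≤s z≤n) (ℕ.m≤n+m _ p′))

  half≡p : ∀ p′ → (2 ℕ.* suc (suc p′) ℕ.∸ 2) ℕ./ 2 ≡ suc p′
  half≡p p′ = trans (cong (ℕ._/ 2) (trans (2*t∸2≡2*p p′) (ℕ.*-comm 2 (suc p′)))) (ℕ.m*n/n≡m (suc p′) 2)

  module Instance (p′ : ℕ) (μ : Partition) (v : Fin (suc (suc p′)) → ℤ)
    (d : DD′² (suc (suc p′)) μ) (coding : IsCoding (2 ℕ.* suc (suc p′) ℕ.∸ 2) (suc (suc p′)) μ v) where

    private
      g = 2 ℕ.* suc (suc p′) ℕ.∸ 2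

      ν = proj₁ (proj₂ d)
      conditions = proj₂ (proj₂ (proj₂ d))

      rest : ∀ k → suc (toℕ k) ≢ suc p′ → suc (toℕ k) ≢ g → ν k ≡ ∅
      rest k ≢p ≢g = proj₁ conditions k (λ eq → ≢p (cong suc eq)) (λ eq → ≢g (trans (cong suc eq) (suc[2*t∸3] p′)))

      last : ∀ k → suc (toℕ k) ≡ g → ∃ λ m → ν k ≡ rectangle (suc m) m
      last k eq with suc m , _ , ν≡ ← proj₁ (proj₂ conditions) k (ℕ.suc-injective (trans eq (sym (suc[2*t∸3] p′)))) = m , ν≡

      middle : ∀ k → suc (toℕ k) ≡ suc p′ → ∃ λ m → ν k ≡ rectangle m m
      middle k eq = proj₂ (proj₂ conditions) k (ℕ.suc-injective eq)

    open Assembly (suc p′) (s≤s z≤n) g (2*t∸2≡2*p p′) μ (DD′⇒legsExceedArms (proj₁ d)) ν (proj₁ (proj₂ (proj₂ d))) rest last middle v coding public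

theorem4p27 : ∀ {c ℓ₁ ℓ₂} (t : ℕ) .{{_ : NonTrivial t}} (μ : Partition) (v : Fin t → ℤ) →
  let g = 2 ℕ.* t ℕ.∸ 2
      r = λ (i : Fin t) → v i - + (g ℕ./ 2) + 1ℤ
  in
  DD′² t μ → IsCoding g t μ v →
  ( + size μ / 1
    ≡ (∑[ i ∈ allFin t ] r i * r i) / g ℚ.- + ((g ℕ./ 2 ℕ.+ 1) ℕ.* (g ℕ.+ 1)) / 12
  )
  ×
  ( (F : HeytingField c ℓ₁ ℓ₂) → let open Products F in
    (τ : ℤ → F×) →
    ( (∏[ s ∈ boxes μ ] (τ (+ hook μ s - ε′ s * + g) ÷ τ (+ hook μ s)))
      ≈ (∏[ s ∈ boxes (conj μ) ] (τ (+ hook (conj μ) s + ε s * + g) ÷ τ (+ hook (conj μ) s)))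
    )
    ×
    ( (∏[ s ∈ boxes (conj μ) ] (τ (+ hook (conj μ) s + ε s * + g) ÷ τ (+ hook (conj μ) s)))
      ≈ (∏[ i ∈ [1⋯ g ℕ.∸ 1 ] ] (τ (- + i) ÷ τ (+ i)) ^ α g i μ)
      · (∏[ i ∈ allFin t ] (τ (+ 2 * r i) ÷ τ (r i)))
      · (∏[ i ∈ [1⋯ t ℕ.∸ 1 ] ] (τ (+ i) ÷ τ (+ 2 * + i)))
      · (∏[ i ∈ allFin t ] (∏[ j ∈ after i ]
          ( τ (r i - r j) ÷ τ (+ index j - + index i)
          · τ (r i + r j) ÷ τ (+ g + + 2 - + index i - + index j))))
    )
  )
-- Rewriting `g / 2` to `suc p′` makes the shift in `r` the one used in the instance.
theorem4p27 t@(suc (suc p′)) μ v d coding rewrite half≡p p′ =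
  integer-quotient (+ size μ) (∑[ i ∈ allFin t ] I.r i * I.r i) (+ ((suc p′ ℕ.+ 1) ℕ.* (2 ℕ.* t ℕ.∸ 2 ℕ.+ 1))) (2 ℕ.* t ℕ.∸ 2) I.size-identity
  , λ F τ → I.conjugate-product F τ , I.hook-product F τ
  where module I = Instance p′ μ v d coding
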